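{- Let $n\ge2$, designate each of $1,\ldots,n-1$ as a left point or a right point, and let $\Theta$ be the associated Cambrian congruence on the weak order on $B_n$. Then $\Theta$ is the meet, in the lattice of congruences of $B_n$, of the meet-irreducible congruences $\Theta_o$, $\Theta_r$ and $\Theta_l$, where $\Theta_r$ is omitted if there are no right points and $\Theta_l$ is omitted if there are no left points.
   Context: $B_n$: signed permutations of $\{\pm1,\ldots,\pm n\}$ ($\pi(-i)=-\pi(i)$), one-line notation $\pi_1\cdots\pi_n$, long one-line notation $\pi_{ -n}\cdots\pi_{ -1}\pi_1\cdots\pi_n$. Weak order: $\sigma$ covers $\pi$ iff either $\pi_{ -1}<\pi_1$ and $\sigma$ swaps $\pi_{ -1},\pi_1$, or $\pi_i<\pi_{i+1}$ ($1\le i\le n-1$) and $\sigma$ swaps $\pi_i,\pi_{i+1}$ and $\pi_{ -i-1},\pi_{ -i}$; a finite lattice. Join-irreducible: covers exactly one element $j_*$. Lattice congruences (equivalence relations compatible with $\wedge,\vee$) form a lattice under refinement; $\Theta$ contracts $j$ if $j\equiv j_*$. The associated Cambrian congruence $\Theta$ is generated by contracting $s_0s_1=2(-1)3\cdots n$ and $s_0s_1s_0=(-2)(-1)3\cdots n$ if $1$ is a right point, or $s_1s_0=(-2)13\cdots n$ and $s_1s_0s_1=1(-2)3\cdots n$ if $1$ is a left point, and for $2\le i\le n-1$, $s_{i-1}s_i=1\cdots(i-2)\,i\,(i+1)(i-1)(i+2)\cdots n$ if $i$ is right, or $s_is_{i-1}=1\cdots(i-2)(i+1)(i-1)\,i\,(i+2)\cdots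 n$ if $i$ is left. Orbifold model: numbered points $1,\ldots,n$ above an orbifold point $\times$ (the origin) in the orbifold plane $\mathbb R^2/(x\sim -x)$. Type-B arcs, up to combinatorial equivalence: an orbifold arc with upper endpoint $p$ goes monotone downward from $p$ to $\times$ and is determined by $p$ and the sets $L(\alpha),R(\alpha)$ partitioning $\{1,\ldots,p-1\}$ into points left/right of it; a long arc with left endpoint $p$ and right endpoint $q\ne p$ consists of disjoint left and right pieces descending from $p$ and $q$ and joined by going around $\times$ below it, and is determined by $(p,q)$, $L(\alpha)$ (points in $(0,p)$ left of the left piece) and $R(\alpha)$ (points in $(0,q)$ right of the right piece), disjoint sets; the other points of $(0,\min(p,q))$ lie between the pieces; ordinary arcs join two numbered points. The join-irreducible elements $j$ of $B_n$ are in bijection with type-B arcs via $\delta^\circ(j)=\{\text{arc}\}$, where $\delta^\circ(\pi)$ is obtained from the centrally symmetric arc diagram $\delta(\pi)$ (on points $-n,\ldots,-1,1,\ldots,n$: for each pair of consecutive positions $a,b$ in the order $-n<\cdots<-1<1<\cdots<n$ with $\pi_a>\pi_b$, an arc from $\pi_a$ down to $\pi_b$ passing right of each $\pi_c$ with $\pi_b<\pi_c<\pi_a$, $c$ before $a$, and left of such $\pi_c$ with $c$ after $b$) by identifying $x$ with $-x$. Define $\beta_o$ as the orbifold arc with upper endpoint $n$ with $L(\beta_o)$ = the set of left points and $R(\beta_o)$ = the set of right points (it passes left of every right point and right of every left point). If there is a right point, let $r$ be the highest right point and $\beta_r$ the long arc with left endpoint $n$, right endpoint $r$, no numbered points between its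 pieces, $L(\beta_r)$ = left points in $(0,n)$, $R(\beta_r)$ = right points in $(0,r)$. If there is a left point, let $l$ be the highest left point and $\beta_l$ the long arc with right endpoint $n$, left endpoint $l$, no points between its pieces, $L(\beta_l)$ = left points in $(0,l)$, $R(\beta_l)$ = right points in $(0,n)$. For a type-B arc $\beta$, $\Theta_\beta$ denotes the coarsest congruence not contracting the join-irreducible element corresponding to $\beta$; set $\Theta_o=\Theta_{\beta_o}$, $\Theta_r=\Theta_{\beta_r}$, $\Theta_l=\Theta_{\beta_l}$. -}

module Defs where

open import Data.Nat using (ℕ; zero; suc; _≤_; _<_; _∸_; _+_; _≡ᵇ_)
open import Data.Integer as ℤ using (ℤ; +_; -[1+_]; -_; ∣_∣)
open import Data.Vec using (Vec; []; _∷_; lookup; tabulate)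
open import Data.Fin using (Fin; toℕ)
open import Data.Bool using (Bool; true; false; if_then_else_)
open import Data.Product using (Σ; ∃; _×_; _,_)
open import Data.Empty using (⊥)
open import Relation.Nullary using (¬_)
open import Relation.Binary.PropositionalEquality using (_≡_)
open import Relation.Binary.Structures using (IsEquivalence)
open import Relation.Binary.Construct.Closure.ReflexiveTransitive using (Star)

-- Signed permutations B_n, stored by their one-line notation π₁ ⋯ πₙ
-- (position k ∈ Fin n stands for position k+1).

IsSignedPerm : ∀ {n} → Vec ℤ n → Set
IsSignedPerm {n} w =
  (∀ i → 1 ≤ ∣ lookup w i ∣ × ∣ lookup w i ∣ ≤ n) ×
  (∀ i j → ∣ lookup w i ∣ ≡ ∣ lookup w j ∣ → i ≡ j)

-- validity proof is irrelevant, so two elements are equal iff their words are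
record SP (n : ℕ) : Set where
  constructor sp
  field
    word   : Vec ℤ n
    .valid : IsSignedPerm word
open SP public

Rel : ℕ → Set₁
Rel n = SP n → SP n → Set

-- Long one-line notation: lval π c = π_c for c ∈ {-n,…,-1,1,…,n}
-- (π_{-i} = -π_i); junk value 0 outside this range.

get : ∀ {n} → Vec ℤ n → ℕ → ℤ
get []       _       = + 0
get (x ∷ xs) zero    = x
get (x ∷ xs) (suc m) = get xs m

lval : ∀ {n} → Vec ℤ n → ℤ → ℤ
lval w (+ zero)    = + 0
lval w (+ (suc m)) = get w m
lval w -[1+ m ]    = - get w m

data AdjSwap : ∀ {n} → Vec ℤ n → Vec ℤ n → Set where
  here  : ∀ {n x y} {xs : Vec ℤ n} → x ℤ.< y → AdjSwap (x ∷ y ∷ xs) (y ∷ x ∷ xs)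
  there : ∀ {n x} {xs ys : Vec ℤ n} → AdjSwap xs ys → AdjSwap (x ∷ xs) (x ∷ ys)

data CoverW : ∀ {n} → Vec ℤ n → Vec ℤ n → Set where
  flip0 : ∀ {n x} {xs : Vec ℤ n} → (- x) ℤ.< x → CoverW (x ∷ xs) ((- x) ∷ xs)
  swapi : ∀ {n} {xs ys : Vec ℤ n} → AdjSwap xs ys → CoverW xs ys

_⋖_ : ∀ {n} → SP n → SP n → Set
x ⋖ y = CoverW (word x) (word y)

_≤w_ : ∀ {n} → SP n → SP n → Set
_≤w_ = Star _⋖_

IsMeet : ∀ {n} → SP n → SP n → SP n → Set
IsMeet x y m = m ≤w x × m ≤w y × (∀ z → z ≤w x → z ≤w y → z ≤w m)

IsJoin : ∀ {n} → SP n → SP n → SP n → Set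
IsJoin x y j = x ≤w j × y ≤w j × (∀ z → x ≤w z → y ≤w z → j ≤w z)

IsCongruence : ∀ {n} → Rel n → Set
IsCongruence Θ =
  IsEquivalence Θ ×
  (∀ {x y z m m'} → Θ x y → IsMeet x z m → IsMeet y z m' → Θ m m') ×
  (∀ {x y z j j'} → Θ x y → IsJoin x z j → IsJoin y z j' → Θ j j')

_⊆ᴿ_ : ∀ {n} → Rel n → Rel n → Set
Θ ⊆ᴿ Φ = ∀ {x y} → Θ x y → Φ x y

JoinIrreducible : ∀ {n} → SP n → Set
JoinIrreducible j = Σ _ λ j* → (j* ⋖ j) × (∀ y → y ⋖ j → y ≡ j*)

Contracts : ∀ {n} → Rel n → SP n → Set
Contracts Θ j = Σ _ λ y → (y ⋖ j) × Θ j y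

ContractsW : ∀ {n} → Rel n → Vec ℤ n → Set
ContractsW Θ w = ∀ j → word j ≡ w → Contracts Θ j

IsCoarsestNotContracting : ∀ {n} → SP n → Rel n → Set₁
IsCoarsestNotContracting j Φ =
  IsCongruence Φ × ¬ Contracts Φ j ×
  (∀ Ψ → IsCongruence Ψ → ¬ Contracts Ψ j → Ψ ⊆ᴿ Φ)

-- Left / right designation of the points 1,…,n-1 (values outside are ignored)

data Side : Set where
  left right : Side

isL isR : Side → Bool
isL left  = true
isL right = false
isR left  = false
isR right = true

HasRight HasLeft : ℕ → (ℕ → Side) → Set
HasRight n d = ∃ λ k → 1 ≤ k × k < n × d k ≡ right
HasLeft  n d = ∃ λ k → 1 ≤ k × k < n × d k ≡ left

HighestRight HighestLeft : ℕ → (ℕ → Side) → ℕ → Set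
HighestRight n d r = 1 ≤ r × r < n × d r ≡ right × (∀ k → r < k → k < n → d k ≡ left)
HighestLeft  n d l = 1 ≤ l × l < n × d l ≡ left  × (∀ k → l < k → k < n → d k ≡ right)

mkWord : (n : ℕ) → (ℕ → ℤ) → Vec ℤ n
mkWord n f = tabulate (λ (k : Fin n) → f (suc (toℕ k)))

w-s0s1 : ℕ → ℤ
w-s0s1 1 = + 2
w-s0s1 2 = -[1+ 0 ]
w-s0s1 p = + p

w-s0s1s0 : ℕ → ℤ
w-s0s1s0 1 = -[1+ 1 ]
w-s0s1s0 2 = -[1+ 0 ]
w-s0s1s0 p = + p

w-s1s0 : ℕ → ℤ
w-s1s0 1 = -[1+ 1 ]
w-s1s0 2 = + 1
w-s1s0 p = + p

w-s1s0s1 : ℕ → ℤ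
w-s1s0s1 1 = + 1
w-s1s0s1 2 = -[1+ 1 ]
w-s1s0s1 p = + p

-- s_{i-1}s_i = 1⋯(i-2) i (i+1) (i-1) (i+2)⋯n
w-right : ℕ → ℕ → ℤ
w-right i p =
  if p ≡ᵇ (i ∸ 1) then + i
  else if p ≡ᵇ i then + (i + 1)
  else if p ≡ᵇ (i + 1) then + (i ∸ 1)
  else + p

-- s_i s_{i-1} = 1⋯(i-2) (i+1) (i-1) i (i+2)⋯n
w-left : ℕ → ℕ → ℤ
w-left i p =
  if p ≡ᵇ (i ∸ 1) then + (i + 1)
  else if p ≡ᵇ i then + (i ∸ 1)
  else if p ≡ᵇ (i + 1) then + i
  else + p

data CambGen (n : ℕ) (d : ℕ → Side) : Vec ℤ n → Set where
  g-s0s1   : d 1 ≡ right → CambGen n d (mkWord n w-s0s1)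
  g-s0s1s0 : d 1 ≡ right → CambGen n d (mkWord n w-s0s1s0)
  g-s1s0   : d 1 ≡ left  → CambGen n d (mkWord n w-s1s0)
  g-s1s0s1 : d 1 ≡ left  → CambGen n d (mkWord n w-s1s0s1)
  g-right  : ∀ i → 2 ≤ i → i < n → d i ≡ right → CambGen n d (mkWord n (w-right i))
  g-left   : ∀ i → 2 ≤ i → i < n → d i ≡ left  → CambGen n d (mkWord n (w-left i))

IsCambrian : (n : ℕ) → (ℕ → Side) → Rel n → Set₁
IsCambrian n d Θ =
  IsCongruence Θ × (∀ w → CambGen n d w → ContractsW Θ w) ×
  (∀ Ψ → IsCongruence Ψ → (∀ w → CambGen n d w → ContractsW Ψ w) → Θ ⊆ᴿ Ψ)

-- Type-B arcs (data; compared up to combinatorial equivalence by _≈ᵃ_)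

data BArc : Set where
  -- orbifold arc with upper endpoint p; s k = left iff k ∈ L(α), for 0<k<p
  orbifold : (p : ℕ) → (ℕ → Side) → BArc
  -- long arc, left endpoint l, right endpoint r;
  -- inL k (0<k<l): k ∈ L(α);  inR k (0<k<r): k ∈ R(α)
  long     : (l r : ℕ) → (inL inR : ℕ → Bool) → BArc
  -- ordinary arc between numbered points t > b; s k (b<k<t) = side of k w.r.t. the arc
  ordinary : (t b : ℕ) → (ℕ → Side) → BArc

_≈ᵃ_ : BArc → BArc → Set
orbifold p s ≈ᵃ orbifold p' s' = p ≡ p' × (∀ k → 0 < k → k < p → s k ≡ s' k)
long l r a b ≈ᵃ long l' r' a' b' =
  l ≡ l' × r ≡ r' × (∀ k → 0 < k → k < l → a k ≡ a' k) × (∀ k → 0 < k → k < r → b k ≡ b' k)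
ordinary t b s ≈ᵃ ordinary t' b' s' =
  t ≡ t' × b ≡ b' × (∀ k → b < k → k < t → s k ≡ s' k)
_ ≈ᵃ _ = ⊥

-- InDelta w α : α is (combinatorially equivalent to) an arc of δ°(π), π = w.
-- Each arc of δ(π) comes from a descent at consecutive long positions a,b;
-- an arc from π_a down to π_b passes right of π_c (π_c on its left) for c before a
-- and left of π_c for c after b. Mirror-image descents give the same type-B arc,
-- so one representative of each symmetric pair is listed.
data InDelta {n : ℕ} (w : Vec ℤ n) : BArc → Set where
  mid : ∀ {p s} →
    lval w (-[1+ 0 ]) ≡ + p → lval w (+ 1) ℤ.< lval w (-[1+ 0 ]) →
    (∀ k c → 0 < k → k < p → lval w c ≡ + k →
       (c ℤ.< -[1+ 0 ] → s k ≡ left) × (+ 1 ℤ.< c → s k ≡ right)) →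
    InDelta w (orbifold p s)
  longD : ∀ {i l r a b} → 1 ≤ i → i < n →
    lval w (+ i) ≡ + r → lval w (+ suc i) ≡ - (+ l) → 0 < r → 0 < l →
    (∀ k c → 0 < k → k < l → lval w c ≡ + k →
       (c ℤ.< - (+ suc i) → a k ≡ true) × (- (+ suc i) ℤ.< c → a k ≡ false)) →
    (∀ k c → 0 < k → k < r → lval w c ≡ + k →
       (+ suc i ℤ.< c → b k ≡ true) × (c ℤ.< + suc i → b k ≡ false)) →
    InDelta w (long l r a b)
  ordPos : ∀ {i t bt s} → 1 ≤ i → i < n →
    lval w (+ i) ≡ + t → lval w (+ suc i) ≡ + bt → 0 < bt → bt < t →
    (∀ k c → bt < k → k < t → lval w c ≡ + k →
       (c ℤ.< + i → s k ≡ left) × (+ suc i ℤ.< c → s k ≡ right)) →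
    InDelta w (ordinary t bt s)
  ordNeg : ∀ {i t bt s} → 1 ≤ i → i < n →
    lval w (- (+ suc i)) ≡ + t → lval w (- (+ i)) ≡ + bt → 0 < bt → bt < t →
    (∀ k c → bt < k → k < t → lval w c ≡ + k →
       (c ℤ.< - (+ suc i) → s k ≡ left) × (- (+ i) ℤ.< c → s k ≡ right)) →
    InDelta w (ordinary t bt s)

DeltaIs : ∀ {n} → SP n → BArc → Set
DeltaIs j β = InDelta (word j) β × (∀ α → InDelta (word j) α → α ≈ᵃ β)

IsThetaArc : (n : ℕ) → BArc → Rel n → Set₁
IsThetaArc n β Φ = ∀ (j : SP n) → JoinIrreducible j → DeltaIs j β → IsCoarsestNotContracting j Φ

β-o : ℕ → (ℕ → Side) → BArc
β-o n d = orbifold n d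

β-r : ℕ → (ℕ → Side) → ℕ → BArc
β-r n d r = long n r (λ k → isL (d k)) (λ k → isR (d k))

β-l : ℕ → (ℕ → Side) → ℕ → BArc
β-l n d l = long l n (λ k → isL (d k)) (λ k → isR (d k))

{-# OPTIONS --safe #-}
module Submission where

-- An element is compared through its inversions: pairs of values a < b with b before a in long notation.
-- A meet has as noninversions exactly the chains of noninversions of its arguments, which makes the weak
-- order a lattice and shows that contraction of a cover depends only on its arc, i.e. on the swapped
-- values c < d and on the sides of the values in between.
-- Call an arc designated if all values in between lie on the sides prescribed by the points.
-- * A congruence Ψ contracting exactly the covers with nondesignated arcs is explicit: x Ψ y iff the same
--   designated join-irreducible elements lie below x and y.  Hence Θ ⊆ Ψ, so Θ contracts none of the
--   arcs β_o, β_l, β_r and lies below Θ_o, Θ_l, Θ_r.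
-- * Conversely, hexagons and octagons in the weak order propagate contraction from an arc to larger arcs.
--   A nondesignated arc is reached from a generator, so Θ contracts it; a designated arc leads up to
--   one of β_o, β_l, β_r, so it is not contracted by all of Θ_o, Θ_l, Θ_r.

open import Defs
open import Data.Nat using (ℕ; _≤_)
open import Data.Product using (_×_)
open import Function.Bundles using (_⇔_)

open import Data.Nat as ℕ using (zero; suc; z≤n; s≤s; z<s)
import Data.Nat.Properties as ℕ
open import Data.Nat.Induction using (<-wellFounded)
open import Data.Integer as ℤ using (ℤ; +_; -[1+_]; -_; ∣_∣; _<_; -<-; -<+; +<+)
import Data.Integer.Properties as ℤ
open import Data.Fin as Fin using (Fin; toℕ; fromℕ<; zero; suc)
open import Data.Fin.Patterns using (0F; 1F; 2F; 3F)
import Data.Fin.Properties as Fin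
open import Data.Vec using (Vec; []; _∷_; lookup)
open import Data.List using (List; []; _∷_; cartesianProduct; upTo; _++_; map)
open import Data.List.Membership.Propositional using (_∈_)
open import Data.List.Membership.Propositional.Properties
  using (∈-cartesianProduct⁺; ∈-++⁺ˡ; ∈-++⁺ʳ; ∈-map⁺; ∈-upTo⁺)
open import Data.List.Relation.Unary.Any using (here; there)
open import Data.Bool using (true; false)
open import Data.Unit using (⊤; tt)
open import Data.Product using (∃; ∃₂; _,_; proj₁; proj₂)
open import Data.Sum using (_⊎_; inj₁; inj₂; [_,_]′)
open import Data.Empty using (⊥; ⊥-elim)
open import Function using (_∘_; case_of_)
open import Function.Bundles using (mk⇔)
open import Induction.WellFounded using (Acc; acc)
open import Relation.Nullary using (¬_; Dec; yes; no; contradiction; recompute)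
open import Relation.Nullary.Decidable using (True; toWitness; _×-dec_; _→-dec_; _⊎-dec_)
open import Relation.Binary.Definitions using (Tri; tri<; tri≈; tri>)
open import Relation.Binary.PropositionalEquality
open import Relation.Binary.Structures using (IsEquivalence)
open import Relation.Binary.Construct.Closure.ReflexiveTransitive using (ε; _◅_)

-- Signed permutations as odd bijections of ℤ

-- The obstacle special to type B is that exchanging c and d also exchanges -d and -c. A value f
-- between c and d can be brought next to them only if -f, when it lies between them too, keeps its
-- side. For a label (-p, q) with p < q this can fail for every point below p only if each such
-- point and its reflection lie on opposite sides. The sides then come from a designation of points,
-- and an octagon on the values -q, -p, p, q takes over. A long arc from q down to -p with p < q has
-- the point p strictly between its ends, and the steps that lead upward keep the side of this inner
-- point. Hence there is one maximal long arc per side, attached to the highest point of that side,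
-- while ordinary and orbifold arcs lead to β_o. Ψ is explicit because minimality of Θ bounds it
-- only by a congruence already at hand. Chains of noninversions show compatibility with meets;
-- joins follow through the order-reversing map `neg`, which flips the sides. This is why Ψ takes
-- the sides as a parameter.

ν : ℤ → ℤ
ν (+ m)    = -[1+ m ]
ν -[1+ m ] = + m

-- Absolute value minus one in the numbering of `enc`: a value and its negative share it.
idx : ℤ → ℕ
idx (+ m)    = m
idx -[1+ m ] = m

ν-involutive : ∀ a → ν (ν a) ≡ a
ν-involutive (+ m)    = refl
ν-involutive -[1+ m ] = refl

ν-anti : ∀ {a b} → a < b → ν b < ν a
ν-anti (-<- p) = +<+ p
ν-anti -<+     = -<+
ν-anti (+<+ p) = -<- p

ν-anti⁻ : ∀ {a b} → ν b < ν a → a < b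
ν-anti⁻ {a} {b} p = subst₂ _<_ (ν-involutive a) (ν-involutive b) (ν-anti p)

ν-swapˡ : ∀ {a b} → ν a < b → ν b < a
ν-swapˡ {a} p = subst (_ <_) (ν-involutive a) (ν-anti p)

ν-swapʳ : ∀ {a b} → a < ν b → b < ν a
ν-swapʳ {b = b} p = subst (_< _) (ν-involutive b) (ν-anti p)

ν-injective : ∀ {a b} → ν a ≡ ν b → a ≡ b
ν-injective {a} {b} e = trans (sym (ν-involutive a)) (trans (cong ν e) (ν-involutive b))

ν-fix : ∀ {a b} → ν a ≡ b → a ≡ ν b
ν-fix {a} refl = sym (ν-involutive a)

ν≢ : ∀ {a} → ν a ≢ a
ν≢ {+ _} ()
ν≢ { -[1+ _ ]} ()

idx-ν : ∀ a → idx (ν a) ≡ idx a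
idx-ν (+ m)    = refl
idx-ν -[1+ m ] = refl

idx-≡ : ∀ {a b} → idx a ≡ idx b → a ≡ b ⊎ a ≡ ν b
idx-≡ {+ _}       {+ _}       refl = inj₁ refl
idx-≡ {+ _}       { -[1+ _ ]} refl = inj₂ refl
idx-≡ { -[1+ _ ]} {+ _}       refl = inj₂ refl
idx-≡ { -[1+ _ ]} { -[1+ _ ]} refl = inj₁ refl

odd : (ℕ → ℤ) → ℤ → ℤ
odd f (+ m)    = f m
odd f -[1+ m ] = ν (f m)

odd-ν : ∀ f a → odd f (ν a) ≡ ν (odd f a)
odd-ν f (+ m)    = refl
odd-ν f -[1+ m ] = sym (ν-involutive _)

idx-odd : ∀ f a → idx (odd f a) ≡ idx (f (idx a))
idx-odd f (+ m)    = refl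
idx-odd f -[1+ m ] = idx-ν (f m)

-- Nonzero integers are renumbered so that 0 disappears: k > 0 becomes k - 1, and negation becomes ν.
enc : ℤ → ℤ
enc (+ zero)  = + 0
enc (+ suc m) = + m
enc -[1+ m ]  = -[1+ m ]

dec : ℤ → ℤ
dec (+ m)    = + suc m
dec -[1+ m ] = -[1+ m ]

enc-neg : ∀ z → 1 ℕ.≤ ∣ z ∣ → enc (- z) ≡ ν (enc z)
enc-neg (+ suc m) p = refl
enc-neg -[1+ m ] p = refl

idx-enc : ∀ z → 1 ℕ.≤ ∣ z ∣ → suc (idx (enc z)) ≡ ∣ z ∣
idx-enc (+ suc m) p = refl
idx-enc -[1+ m ] p = refl

enc-< : ∀ {y z} → 1 ℕ.≤ ∣ y ∣ → 1 ℕ.≤ ∣ z ∣ → y < z → enc y < enc z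
enc-< {+ suc m} {+ suc k} _ _ (+<+ (s≤s p)) = +<+ p
enc-< { -[1+ m ]} {+ suc k} _ _ p = -<+
enc-< { -[1+ m ]} { -[1+ k ]} _ _ p = p

dec-< : ∀ {a b} → a < b → dec a < dec b
dec-< (-<- p) = -<- p
dec-< -<+ = -<+
dec-< (+<+ p) = +<+ (s≤s p)

dec-enc : ∀ z → 1 ℕ.≤ ∣ z ∣ → dec (enc z) ≡ z
dec-enc (+ suc m) p = refl
dec-enc -[1+ m ] p = refl

-- Past the end of the word each position holds itself, `o` counting the entries already consumed.
-- The permutation thus acts on all of ℤ, and its inverse and neighbouring positions are total.
wvFrom : ∀ {n} → ℕ → Vec ℤ n → ℕ → ℤ
wvFrom o []       m       = + (o ℕ.+ m)
wvFrom o (x ∷ xs) zero    = enc x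
wvFrom o (x ∷ xs) (suc m) = wvFrom (suc o) xs m

wvFrom-in : ∀ {n} o (w : Vec ℤ n) {m} → m ℕ.< n → wvFrom o w m ≡ enc (get w m)
wvFrom-in o (x ∷ xs) {zero}  _       = refl
wvFrom-in o (x ∷ xs) {suc m} (s≤s p) = wvFrom-in (suc o) xs p

wvFrom-out : ∀ {n} o (w : Vec ℤ n) {m} → n ℕ.≤ m → wvFrom o w m ≡ + (o ℕ.+ m)
wvFrom-out o []       _       = refl
wvFrom-out o (x ∷ xs) (s≤s p) = trans (wvFrom-out (suc o) xs p) (cong +_ (sym (ℕ.+-suc o _)))

lookup-get : ∀ {n} (w : Vec ℤ n) i → lookup w i ≡ get w (toℕ i)
lookup-get (x ∷ xs) Fin.zero    = refl
lookup-get (x ∷ xs) (Fin.suc i) = lookup-get xs i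

get-lookup : ∀ {n} (w : Vec ℤ n) {m} (p : m ℕ.< n) → get w m ≡ lookup w (fromℕ< p)
get-lookup w p = trans (cong (get w) (sym (Fin.toℕ-fromℕ< p))) (sym (lookup-get w _))

GetPerm : ∀ {n} → Vec ℤ n → Set
GetPerm {n} w =
  (∀ {m} → m ℕ.< n → 1 ℕ.≤ ∣ get w m ∣ × ∣ get w m ∣ ℕ.≤ n) ×
  (∀ {m m'} → m ℕ.< n → m' ℕ.< n → ∣ get w m ∣ ≡ ∣ get w m' ∣ → m ≡ m')

isSignedPerm⇒getPerm : ∀ {n} (w : Vec ℤ n) → IsSignedPerm w → GetPerm w
isSignedPerm⇒getPerm w (r , i) =
  (λ p → subst (λ z → 1 ℕ.≤ ∣ z ∣ × ∣ z ∣ ℕ.≤ _) (sym (get-lookup w p)) (r (fromℕ< p))) ,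
  (λ p q e → trans (sym (Fin.toℕ-fromℕ< p)) (trans (cong toℕ (i _ _
     (trans (cong ∣_∣ (sym (get-lookup w p))) (trans e (cong ∣_∣ (get-lookup w q)))))) (Fin.toℕ-fromℕ< q)))

getPerm⇒isSignedPerm : ∀ {n} (w : Vec ℤ n) → GetPerm w → IsSignedPerm w
getPerm⇒isSignedPerm w (r , i) =
  (λ k → subst (λ z → 1 ℕ.≤ ∣ z ∣ × ∣ z ∣ ℕ.≤ _) (sym (lookup-get w k)) (r (Fin.toℕ<n k))) ,
  (λ k l e → Fin.toℕ-injective (i (Fin.toℕ<n k) (Fin.toℕ<n l)
     (trans (cong ∣_∣ (sym (lookup-get w k))) (trans e (cong ∣_∣ (lookup-get w l))))))

-- Validity is stored irrelevantly; decidability is what lets `recompute` recover a usable proof in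
-- `getPerm`.
isSignedPerm? : ∀ {n} (w : Vec ℤ n) → Dec (IsSignedPerm w)
isSignedPerm? {n} w =
  Fin.all? (λ i → (1 ℕ.≤? ∣ lookup w i ∣) ×-dec (∣ lookup w i ∣ ℕ.≤? n)) ×-dec
  Fin.all? (λ i → Fin.all? (λ j → (∣ lookup w i ∣ ℕ.≟ ∣ lookup w j ∣) →-dec (i Fin.≟ j)))

module _ {n : ℕ} where

  getPerm : (x : SP n) → GetPerm (word x)
  getPerm (sp w v) = isSignedPerm⇒getPerm w (recompute (isSignedPerm? w) v)

  wv : SP n → ℕ → ℤ
  wv x = wvFrom 0 (word x)

  wv-in : ∀ x {m} → m ℕ.< n → wv x m ≡ enc (get (word x) m)
  wv-in x = wvFrom-in 0 (word x)

  wv-out : ∀ x {m} → n ℕ.≤ m → wv x m ≡ + m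
  wv-out x = wvFrom-out 0 (word x)

  idx-wv : ∀ x {m} → m ℕ.< n → suc (idx (wv x m)) ≡ ∣ get (word x) m ∣
  idx-wv x p = trans (cong (suc ∘ idx) (wv-in x p)) (idx-enc (get (word x) _) (proj₁ (proj₁ (getPerm x) p)))

  idx-wv-< : ∀ x {m} → m ℕ.< n → idx (wv x m) ℕ.< n
  idx-wv-< x p = subst (ℕ._≤ n) (sym (idx-wv x p)) (proj₂ (proj₁ (getPerm x) p))

  idx-wv-injective : ∀ x {m m'} → idx (wv x m) ≡ idx (wv x m') → m ≡ m'
  idx-wv-injective x {m} {m'} e with m ℕ.<? n | m' ℕ.<? n
  ... | yes p | yes q = proj₂ (getPerm x) p q
          (trans (sym (idx-wv x p)) (trans (cong suc e) (idx-wv x q)))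
  ... | yes p | no  q = contradiction
          (subst (ℕ._< n) (trans e (cong idx (wv-out x (ℕ.≮⇒≥ q)))) (idx-wv-< x p)) q
  ... | no  p | yes q = contradiction
          (subst (ℕ._< n) (trans (sym e) (cong idx (wv-out x (ℕ.≮⇒≥ p)))) (idx-wv-< x q)) p
  ... | no  p | no  q = trans (sym (cong idx (wv-out x (ℕ.≮⇒≥ p))))
                          (trans e (cong idx (wv-out x (ℕ.≮⇒≥ q))))

  -- From n on the word is the identity; below n an injective self-map of a finite set is onto.
  idx-wv-surjective : ∀ x k → ∃ λ m → idx (wv x m) ≡ k
  idx-wv-surjective x k with k ℕ.<? n
  ... | no  k≮n = k , cong idx (wv-out x (ℕ.≮⇒≥ k≮n))
  ... | yes k<n with Fin.any? (λ i → f i Fin.≟ fromℕ< k<n)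
    where
    f : Fin n → Fin n
    f i = fromℕ< (idx-wv-< x (Fin.toℕ<n i))
  ... | yes (i , e) = toℕ i , trans (sym (Fin.toℕ-fromℕ< _)) (trans (cong toℕ e) (Fin.toℕ-fromℕ< k<n))
  ... | no  ¬e = ⊥-elim (noHit n f (fromℕ< k<n) f-inj λ i e → ¬e (i , e))
    where
    f : Fin n → Fin n
    f i = fromℕ< (idx-wv-< x (Fin.toℕ<n i))
    f-inj : ∀ {i j} → f i ≡ f j → i ≡ j
    f-inj e = Fin.toℕ-injective (idx-wv-injective x
      (trans (sym (Fin.toℕ-fromℕ< _)) (trans (cong toℕ e) (Fin.toℕ-fromℕ< _))))
    -- Punching out the missed value would inject a finite set into a smaller one.
    noHit : ∀ m (g : Fin m → Fin m) (t : Fin m) → (∀ {i j} → g i ≡ g j → i ≡ j) → ¬ (∀ i → g i ≢ t)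
    noHit (suc m) g t inj miss = ℕ.1+n≰n (Fin.injective⇒≤
      {f = λ i → Fin.punchOut (λ e → miss i (sym e))}
      (λ {i} {j} e → inj (Fin.punchOut-injective (λ e → miss i (sym e)) (λ e → miss j (sym e)) e)))

  W : SP n → ℤ → ℤ
  W x = odd (wv x)

  W-injective : ∀ x {i j} → W x i ≡ W x j → i ≡ j
  W-injective x {i} {j} e
    with idx-≡ {i} {j} (idx-wv-injective x (trans (sym (idx-odd (wv x) i)) (trans (cong idx e) (idx-odd (wv x) j))))
  ... | inj₁ r = r
  ... | inj₂ refl = contradiction (trans (sym (odd-ν (wv x) j)) e) ν≢

  -- Hiding the definition keeps the finite search behind surjectivity out of later normal forms;
  -- `P` is known only as the odd inverse of `W`.
  abstract
    pos : SP n → ℕ → ℤ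
    pos x k with wv x (proj₁ (idx-wv-surjective x k))
    ... | + _      = + proj₁ (idx-wv-surjective x k)
    ... | -[1+ _ ] = -[1+ proj₁ (idx-wv-surjective x k) ]

    W-pos : ∀ x k → W x (pos x k) ≡ + k
    W-pos x k with wv x (proj₁ (idx-wv-surjective x k)) in eq | proj₂ (idx-wv-surjective x k)
    ... | + _      | refl = eq
    ... | -[1+ _ ] | refl = cong ν eq

    P : SP n → ℤ → ℤ
    P x = odd (pos x)

    W-P : ∀ x a → W x (P x a) ≡ a
    W-P x (+ k)    = W-pos x k
    W-P x -[1+ k ] = trans (odd-ν (wv x) (pos x k)) (cong ν (W-pos x k))

    P-ν : ∀ x a → P x (ν a) ≡ ν (P x a)
    P-ν x = odd-ν (pos x)

  P-W : ∀ x i → P x (W x i) ≡ i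
  P-W x i = W-injective x (W-P x (W x i))

  P-unique : ∀ x {a i} → W x i ≡ a → P x a ≡ i
  P-unique x {i = i} refl = P-W x i

  P-injective : ∀ x {a b} → P x a ≡ P x b → a ≡ b
  P-injective x {a} {b} e = trans (sym (W-P x a)) (trans (cong (W x) e) (W-P x b))

  W-ν : ∀ x a → W x (ν a) ≡ ν (W x a)
  W-ν x = odd-ν (wv x)

  W-big : ∀ x i → n ℕ.≤ idx i → W x i ≡ i
  W-big x (+ m) p = wv-out x p
  W-big x -[1+ m ] p = cong ν (wv-out x p)

  P-big : ∀ x a → n ℕ.≤ idx a → P x a ≡ a
  P-big x a p = P-unique x (W-big x a p)

  P-small : ∀ x a → idx a ℕ.< n → idx (P x a) ℕ.< n
  P-small x a p = ℕ.≰⇒> λ q → ℕ.<⇒≱ p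
    (subst (λ z → n ℕ.≤ idx z) (trans (sym (W-big x (P x a) q)) (W-P x a)) q)

  word-ext : ∀ {x y : SP n} → (∀ i → W x i ≡ W y i) → x ≡ y
  word-ext {x} {y} h = go (ext (word x) (word y) λ {m} p → begin
      get (word x) m             ≡⟨ dec-enc _ (proj₁ (proj₁ (getPerm x) p)) ⟨
      dec (enc (get (word x) m)) ≡⟨ cong dec (wv-in x p) ⟨
      dec (wv x m)               ≡⟨ cong dec (h (+ m)) ⟩
      dec (wv y m)               ≡⟨ cong dec (wv-in y p) ⟩
      dec (enc (get (word y) m)) ≡⟨ dec-enc _ (proj₁ (proj₁ (getPerm y) p)) ⟩
      get (word y) m ∎)
    where
    open ≡-Reasoning
    ext : ∀ {k} (u v : Vec ℤ k) → (∀ {m} → m ℕ.< k → get u m ≡ get v m) → u ≡ v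
    ext [] [] h = refl
    ext (a ∷ u) (b ∷ v) h = cong₂ _∷_ (h z<s) (ext u v λ p → h (s≤s p))
    go : ∀ {x y : SP n} → word x ≡ word y → x ≡ y
    go refl = refl

-- Inversions and covers

small<+ : ∀ {z k} → idx z ℕ.< k → z < + k
small<+ {+ _}       p = +<+ p
small<+ { -[1+ _ ]} p = -<+

-- The next position to the right. In this numbering `-[1+ 0 ]` and `+ 0` are the positions -1 and
-- 1, which are neighbours.
nxt : ℤ → ℤ
nxt (+ m)        = + suc m
nxt -[1+ zero ]  = + 0
nxt -[1+ suc m ] = -[1+ m ]

i<nxt : ∀ i → i < nxt i
i<nxt (+ m)        = +<+ ℕ.≤-refl
i<nxt -[1+ zero ]  = -<+
i<nxt -[1+ suc m ] = -<- ℕ.≤-refl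

nxt-≤ : ∀ {i j} → i < j → nxt i ≡ j ⊎ nxt i < j
nxt-≤ {+ _} (+<+ p) with ℕ.m≤n⇒m<n∨m≡n p
... | inj₁ q = inj₂ (+<+ q)
... | inj₂ refl = inj₁ refl
nxt-≤ { -[1+ zero ]} (-<- ())
nxt-≤ { -[1+ suc _ ]} (-<- (s≤s p)) with ℕ.m≤n⇒m<n∨m≡n p
... | inj₁ q = inj₂ (-<- q)
... | inj₂ refl = inj₁ refl
nxt-≤ { -[1+ zero ]} {+ zero} -<+ = inj₁ refl
nxt-≤ { -[1+ zero ]} {+ suc _} -<+ = inj₂ (+<+ z<s)
nxt-≤ { -[1+ suc _ ]} -<+ = inj₂ -<+

swapℕ : ℕ → ℕ → ℕ
swapℕ zero    zero          = 1
swapℕ zero    (suc zero)    = 0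
swapℕ zero    (suc (suc m)) = suc (suc m)
swapℕ (suc k) zero          = 0
swapℕ (suc k) (suc m)       = suc (swapℕ k m)

swapℕ-involutive : ∀ k m → swapℕ k (swapℕ k m) ≡ m
swapℕ-involutive zero    zero          = refl
swapℕ-involutive zero    (suc zero)    = refl
swapℕ-involutive zero    (suc (suc m)) = refl
swapℕ-involutive (suc k) zero          = refl
swapℕ-involutive (suc k) (suc m)       = cong suc (swapℕ-involutive k m)

swapℕ-k : ∀ k → swapℕ k k ≡ suc k
swapℕ-k zero    = refl
swapℕ-k (suc k) = cong suc (swapℕ-k k)

swapℕ-< : ∀ {k m n} → suc k ℕ.< n → m ℕ.< n → swapℕ k m ℕ.< n
swapℕ-< {zero}  {zero}        p q = p
swapℕ-< {zero}  {suc zero}    p q = ℕ.<-trans z<s p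
swapℕ-< {zero}  {suc (suc m)} p q = q
swapℕ-< {suc k} {zero}        p q = q
swapℕ-< {suc k} {suc m} (s≤s p) (s≤s q) = s≤s (swapℕ-< p q)

swapℕ-mono : ∀ k {i j} → i ℕ.< j → (i ≡ k × j ≡ suc k) ⊎ swapℕ k i ℕ.< swapℕ k j
swapℕ-mono zero {zero} {suc zero} p = inj₁ (refl , refl)
swapℕ-mono zero {zero} {suc (suc j)} p = inj₂ (s≤s z<s)
swapℕ-mono zero {suc zero} {suc zero} (s≤s ())
swapℕ-mono zero {suc zero} {suc (suc j)} p = inj₂ z<s
swapℕ-mono zero {suc (suc i)} {suc zero} (s≤s ())
swapℕ-mono zero {suc (suc i)} {suc (suc j)} p = inj₂ p
swapℕ-mono (suc k) {zero} {suc j} p = inj₂ z<s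
swapℕ-mono (suc k) {suc i} {suc j} (s≤s p) with swapℕ-mono k p
... | inj₁ (refl , refl) = inj₁ (refl , refl)
... | inj₂ q = inj₂ (s≤s q)

-- An exchange of positions s and t together with its mirror image; `mono` says that no other pair
-- changes its order. For the central flip the pair is its own mirror image and the two exceptions
-- coincide.
record PosSwap (s t : ℤ) (τ : ℤ → ℤ) : Set where
  field
    invol : ∀ i → τ (τ i) ≡ i
    τs    : τ s ≡ t
    s<t   : s < t
    mono  : ∀ {i j} → i < j → (i ≡ s × j ≡ t) ⊎ (i ≡ ν t × j ≡ ν s) ⊎ τ i < τ j

swapPos : ℕ → ℤ → ℤ
swapPos k = odd (λ m → + swapℕ k m)

swapPos-PosSwap : ∀ k → PosSwap (+ k) (+ suc k) (swapPos k)
swapPos-PosSwap k = record { invol = invol ; τs = cong +_ (swapℕ-k k) ; s<t = i<nxt (+ k) ; mono = mono }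
  where
  invol : ∀ i → swapPos k (swapPos k i) ≡ i
  invol (+ m)    = cong +_ (swapℕ-involutive k m)
  invol -[1+ m ] = cong -[1+_] (swapℕ-involutive k m)
  mono : ∀ {i j} → i < j → (i ≡ + k × j ≡ + suc k) ⊎ (i ≡ -[1+ suc k ] × j ≡ -[1+ k ]) ⊎ swapPos k i < swapPos k j
  mono (-<- p) with swapℕ-mono k p
  ... | inj₁ (refl , refl) = inj₂ (inj₁ (refl , refl))
  ... | inj₂ q = inj₂ (inj₂ (-<- q))
  mono -<+ = inj₂ (inj₂ -<+)
  mono (+<+ p) with swapℕ-mono k p
  ... | inj₁ (refl , refl) = inj₁ (refl , refl)
  ... | inj₂ q = inj₂ (inj₂ (+<+ q))

flipℕ : ℕ → ℤ
flipℕ zero    = -[1+ 0 ]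
flipℕ (suc m) = + suc m

flipPos-PosSwap : PosSwap -[1+ 0 ] (+ 0) (odd flipℕ)
flipPos-PosSwap = record { invol = invol ; τs = refl ; s<t = -<+ ; mono = mono }
  where
  invol : ∀ i → odd flipℕ (odd flipℕ i) ≡ i
  invol (+ zero) = refl
  invol (+ suc m) = refl
  invol -[1+ zero ] = refl
  invol -[1+ suc m ] = refl
  mono : ∀ {i j} → i < j → (i ≡ -[1+ 0 ] × j ≡ + 0) ⊎ (i ≡ -[1+ 0 ] × j ≡ + 0) ⊎ odd flipℕ i < odd flipℕ j
  mono { -[1+ zero ]} (-<- ())
  mono { -[1+ suc _ ]} { -[1+ zero ]} (-<- p) = inj₂ (inj₂ -<+)
  mono { -[1+ suc _ ]} { -[1+ suc _ ]} (-<- p) = inj₂ (inj₂ (-<- p))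
  mono { -[1+ zero ]} {+ zero} -<+ = inj₁ (refl , refl)
  mono { -[1+ zero ]} {+ suc _} -<+ = inj₂ (inj₂ (+<+ z<s))
  mono { -[1+ suc _ ]} {+ zero} -<+ = inj₂ (inj₂ (-<- z<s))
  mono { -[1+ suc _ ]} {+ suc _} -<+ = inj₂ (inj₂ -<+)
  mono {+ zero} {+ suc _} (+<+ p) = inj₂ (inj₂ -<+)
  mono {+ suc _} {+ suc _} (+<+ p) = inj₂ (inj₂ (+<+ p))

adjSwap-info : ∀ {n} {w w' : Vec ℤ n} → AdjSwap w w' → ∃ λ k → suc k ℕ.< n × get w k < get w (suc k) ×
  (∀ m → get w' m ≡ get w (swapℕ k m)) × (∀ o m → wvFrom o w' m ≡ wvFrom o w (swapℕ k m))
adjSwap-info {w = x ∷ y ∷ xs} (here p) = 0 , s≤s z<s , p ,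
  (λ { zero → refl ; (suc zero) → refl ; (suc (suc m)) → refl }) ,
  (λ { o zero → refl ; o (suc zero) → refl ; o (suc (suc m)) → refl })
adjSwap-info (there s) with adjSwap-info s
... | k , k< , lt , g , v = suc k , s≤s k< , lt ,
  (λ { zero → refl ; (suc m) → g m }) , (λ { o zero → refl ; o (suc m) → v (suc o) m })

adjSwap-at : ∀ {n} (w : Vec ℤ n) k → suc k ℕ.< n → get w k < get w (suc k) →
  ∃ λ w' → AdjSwap w w' × (∀ m → get w' m ≡ get w (swapℕ k m)) × (∀ o m → wvFrom o w' m ≡ wvFrom o w (swapℕ k m))
adjSwap-at (x ∷ y ∷ w) zero p lt = y ∷ x ∷ w , here lt ,
  (λ { zero → refl ; (suc zero) → refl ; (suc (suc m)) → refl }) ,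
  (λ { o zero → refl ; o (suc zero) → refl ; o (suc (suc m)) → refl })
adjSwap-at (x ∷ w) (suc k) (s≤s p) lt with adjSwap-at w k p lt
... | w' , s , g , v = x ∷ w' , there s , (λ { zero → refl ; (suc m) → g m }) , (λ { o zero → refl ; o (suc m) → v (suc o) m })

reindex-getPerm : ∀ {n} (w w' : Vec ℤ n) k → suc k ℕ.< n → (∀ m → get w' m ≡ get w (swapℕ k m)) → GetPerm w → GetPerm w'
reindex-getPerm w w' k k< g (r , i) =
  (λ {m} p → subst (λ z → 1 ℕ.≤ ∣ z ∣ × ∣ z ∣ ℕ.≤ _) (sym (g m)) (r (swapℕ-< k< p))) ,
  (λ {m} {m'} p q e → trans (sym (swapℕ-involutive k m)) (trans (cong (swapℕ k)
     (i (swapℕ-< k< p) (swapℕ-< k< q) (trans (cong ∣_∣ (sym (g m))) (trans e (cong ∣_∣ (g m'))))))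
     (swapℕ-involutive k m')))

flip-getPerm : ∀ {n} {x} {w : Vec ℤ n} → GetPerm (x ∷ w) → GetPerm (- x ∷ w)
flip-getPerm {n} {x} {w} (r , i) =
  (λ {m} p → subst (λ z → 1 ℕ.≤ z × z ℕ.≤ suc n) (sym (same m)) (r p)) ,
  (λ {m} {m'} p q e → i p q (trans (sym (same m)) (trans e (same m'))))
  where
  same : ∀ m → ∣ get (- x ∷ w) m ∣ ≡ ∣ get (x ∷ w) m ∣
  same zero    = ℤ.∣-i∣≡∣i∣ x
  same (suc m) = refl

module _ {n : ℕ} where

  infix 4 _≺⟨_⟩_ _⊑_

  record _≺⟨_⟩_ (a : ℤ) (x : SP n) (b : ℤ) : Set where
    constructor ⟪_⟫
    field P< : P x a < P x b
  open _≺⟨_⟩_ public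

  ≺-cmp : ∀ x {a b} → a ≢ b → a ≺⟨ x ⟩ b ⊎ b ≺⟨ x ⟩ a
  ≺-cmp x {a} {b} ne with ℤ.<-cmp (P x a) (P x b)
  ... | tri< p _ _ = inj₁ ⟪ p ⟫
  ... | tri≈ _ e _ = contradiction (P-injective x e) ne
  ... | tri> _ _ p = inj₂ ⟪ p ⟫

  ≺-trans : ∀ {x a b c} → a ≺⟨ x ⟩ b → b ≺⟨ x ⟩ c → a ≺⟨ x ⟩ c
  ≺-trans ⟪ p ⟫ ⟪ q ⟫ = ⟪ ℤ.<-trans p q ⟫

  ≺-asym : ∀ {x a b} → a ≺⟨ x ⟩ b → ¬ b ≺⟨ x ⟩ a
  ≺-asym ⟪ p ⟫ ⟪ q ⟫ = ℤ.<-asym p q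

  ≺-irrefl : ∀ {x a} → ¬ a ≺⟨ x ⟩ a
  ≺-irrefl ⟪ p ⟫ = ℤ.<-irrefl refl p

  ≺-ν : ∀ {x a b} → a ≺⟨ x ⟩ b → ν b ≺⟨ x ⟩ ν a
  ≺-ν {x} {a} {b} ⟪ p ⟫ = ⟪ subst₂ _<_ (sym (P-ν x b)) (sym (P-ν x a)) (ν-anti p) ⟫

  ≺-ν⁻ : ∀ {x a b} → ν b ≺⟨ x ⟩ ν a → a ≺⟨ x ⟩ b
  ≺-ν⁻ {x} {a} {b} p = subst₂ (_≺⟨ x ⟩_) (ν-involutive a) (ν-involutive b) (≺-ν p)

  ≺-νʳ : ∀ {x a b} → a ≺⟨ x ⟩ ν b → b ≺⟨ x ⟩ ν a
  ≺-νʳ {x} {a} {b} p = subst (_≺⟨ x ⟩ ν a) (ν-involutive b) (≺-ν p)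

  ≺-νˡ : ∀ {x a b} → ν a ≺⟨ x ⟩ b → ν b ≺⟨ x ⟩ a
  ≺-νˡ {x} {a} {b} p = subst (ν b ≺⟨ x ⟩_) (ν-involutive a) (≺-ν p)

  big-≺ : ∀ x {a b} → n ℕ.≤ idx a ⊎ n ℕ.≤ idx b → a < b → a ≺⟨ x ⟩ b
  big-≺ x {a} {b} h lt with n ℕ.≤? idx a | n ℕ.≤? idx b
  ... | yes p | yes q = ⟪ subst₂ _<_ (sym (P-big x a p)) (sym (P-big x b q)) lt ⟫
  ... | no  p | no  q = case h of λ { (inj₁ r) → contradiction r p ; (inj₂ r) → contradiction r q }
  big-≺ x {a} {+ k} h lt | no p | yes q =
    ⟪ subst (P x a <_) (sym (P-big x (+ k) q)) (small<+ (ℕ.<-≤-trans (P-small x a (ℕ.≰⇒> p)) q)) ⟫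
  big-≺ x { -[1+ m ]} { -[1+ k ]} h (-<- lt) | no p | yes q = contradiction (ℕ.≤-trans q (ℕ.<⇒≤ lt)) p
  big-≺ x { -[1+ k ]} {b} h lt | yes p | no q = ≺-ν⁻ ⟪ subst (P x (ν b) <_) (sym (P-big x (+ k) p))
    (small<+ (ℕ.<-≤-trans (P-small x (ν b) (subst (ℕ._< n) (sym (idx-ν b)) (ℕ.≰⇒> q))) p)) ⟫
  big-≺ x {+ m} {+ k} h (+<+ lt) | yes p | no q = contradiction (ℕ.≤-trans p (ℕ.<⇒≤ lt)) q

  inverted-small : ∀ x {a b} → a < b → b ≺⟨ x ⟩ a → idx a ℕ.< n × idx b ℕ.< n
  inverted-small x lt inv =
    ℕ.≰⇒> (λ p → ≺-asym inv (big-≺ x (inj₁ p) lt)) , ℕ.≰⇒> (λ p → ≺-asym inv (big-≺ x (inj₂ p) lt))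

  -- Containment of inversion sets, identified with `_≤w_` by `≤⇒⊑` and `⊑⇒≤`.
  _⊑_ : SP n → SP n → Set
  x ⊑ y = ∀ {a b} → a < b → b ≺⟨ x ⟩ a → b ≺⟨ y ⟩ a

  ⊑-trans : ∀ {x y z} → x ⊑ y → y ⊑ z → x ⊑ z
  ⊑-trans p q lt i = q lt (p lt i)

  ⊑-contra : ∀ {x y} → x ⊑ y → ∀ {a b} → a < b → a ≺⟨ y ⟩ b → a ≺⟨ x ⟩ b
  ⊑-contra {x} {y} h {a} {b} lt p with ≺-cmp x {a} {b} (ℤ.<⇒≢ lt)
  ... | inj₁ q = q
  ... | inj₂ q = contradiction p (≺-asym (h lt q))

  -- x covers y by exchanging c and d (and their mirror images) and nothing else.
  record Cov (y x : SP n) (c d : ℤ) : Set where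
    field
      c<d  : c < d
      c≺d  : c ≺⟨ y ⟩ d
      d≺c  : d ≺⟨ x ⟩ c
      up   : y ⊑ x
      down : ∀ {a b} → a < b → b ≺⟨ x ⟩ a → (a ≡ c × b ≡ d) ⊎ (a ≡ ν d × b ≡ ν c) ⊎ b ≺⟨ y ⟩ a

  mirror : ∀ {y x c d} → Cov y x c d → Cov y x (ν d) (ν c)
  mirror {y} {x} {c} {d} C = record
    { c<d = ν-anti c<d ; c≺d = ≺-ν c≺d ; d≺c = ≺-ν d≺c ; up = up
    ; down = λ lt inv → case down lt inv of λ
        { (inj₁ (refl , refl)) → inj₂ (inj₁ (sym (ν-involutive c) , sym (ν-involutive d)))
        ; (inj₂ (inj₁ (refl , refl))) → inj₁ (refl , refl)
        ; (inj₂ (inj₂ p)) → inj₂ (inj₂ p) } }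
    where open Cov C

  -- Since `τ` is an involution, it carries positions in y to positions in x, so inversions change
  -- only where `τ` fails to be monotone.
  posSwap-Cov : ∀ {y x s t τ} → PosSwap s t τ → (∀ i → W x i ≡ W y (τ i)) → W y s < W y t → Cov y x (W y s) (W y t)
  posSwap-Cov {y} {x} {s} {t} {τ} S h lt = record
    { c<d = lt
    ; c≺d = ⟪ subst₂ _<_ (sym (P-W y s)) (sym (P-W y t)) s<t ⟫
    ; d≺c = ⟪ subst₂ _<_ (sym (trans (Pτ (W y t)) (trans (cong τ (P-W y t)) τt)))
                       (sym (trans (Pτ (W y s)) (trans (cong τ (P-W y s)) τs))) s<t ⟫
    ; up = λ l p → case mono (P< p) of λ
        { (inj₁ (e , f)) → contradiction l (ℤ.<-asym (subst₂ _<_ (P→W e) (P→W f) lt))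
        ; (inj₂ (inj₁ (e , f))) → contradiction l (ℤ.<-asym
              (subst₂ _<_ (trans (sym (W-ν y t)) (P→W e)) (trans (sym (W-ν y s)) (P→W f)) (ν-anti lt)))
        ; (inj₂ (inj₂ q)) → ⟪ subst₂ _<_ (sym (Pτ _)) (sym (Pτ _)) q ⟫ }
    ; down = λ {a} {b} l p → case mono (subst₂ _<_ (Pτ b) (Pτ a) (P< p)) of λ
        { (inj₁ (e , f)) → inj₁ (sym (P→W (trans (trans (sym (invol _)) (cong τ f)) τt)) ,
                                 sym (P→W (trans (trans (sym (invol _)) (cong τ e)) τs)))
        ; (inj₂ (inj₁ (e , f))) → inj₂ (inj₁
            (trans (sym (P→W (τν' f))) (W-ν y t) , trans (sym (P→W (τν e))) (W-ν y s)))
        ; (inj₂ (inj₂ q)) → inj₂ (inj₂ ⟪ subst₂ _<_ (invol _) (invol _) q ⟫) }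
    }
    where
    open PosSwap S
    τt : τ t ≡ s
    τt = trans (cong τ (sym τs)) (invol s)
    Pτ : ∀ a → P x a ≡ τ (P y a)
    Pτ a = P-unique x (trans (h _) (trans (cong (W y) (invol _)) (W-P y a)))
    P→W : ∀ {a i} → P y a ≡ i → W y i ≡ a
    P→W {a} refl = W-P y a
    Wx-ν : ∀ i → W y (τ (ν i)) ≡ W y (ν (τ i))
    Wx-ν i = trans (sym (h (ν i))) (trans (W-ν x i) (trans (cong ν (h i)) (sym (W-ν y (τ i)))))
    τ-ν : ∀ i → τ (ν i) ≡ ν (τ i)
    τ-ν i = W-injective y (Wx-ν i)
    τν : ∀ {i} → τ i ≡ ν t → i ≡ ν s
    τν {i} e = trans (sym (invol i)) (trans (cong τ e) (trans (τ-ν t) (cong ν τt)))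
    τν' : ∀ {i} → τ i ≡ ν s → i ≡ ν t
    τν' {i} e = trans (sym (invol i)) (trans (cong τ e) (trans (τ-ν s) (cong ν τs)))

  swap-W : ∀ {y x : SP n} {k} → (∀ o m → wvFrom o (word x) m ≡ wvFrom o (word y) (swapℕ k m)) → ∀ i → W x i ≡ W y (swapPos k i)
  swap-W h (+ m) = h 0 m
  swap-W h -[1+ m ] = cong ν (h 0 m)

  get<⇒wv< : ∀ y {k m} → k ℕ.< n → m ℕ.< n → get (word y) k < get (word y) m → wv y k < wv y m
  get<⇒wv< y p q lt = subst₂ _<_ (sym (wv-in y p)) (sym (wv-in y q))
    (enc-< (proj₁ (proj₁ (getPerm y) p)) (proj₁ (proj₁ (getPerm y) q)) lt)

  wv<⇒get< : ∀ y {k m} → k ℕ.< n → m ℕ.< n → wv y k < wv y m → get (word y) k < get (word y) m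
  wv<⇒get< y {k} {m} p q lt = subst₂ _<_ (e k p) (e m q) (dec-< lt)
    where
    e : ∀ k (p : k ℕ.< n) → dec (wv y k) ≡ get (word y) k
    e k p = trans (cong dec (wv-in y p)) (dec-enc _ (proj₁ (proj₁ (getPerm y) p)))

flip-W : ∀ {n} {z : ℤ} {w : Vec ℤ n} .{v v'} → 1 ℕ.≤ ∣ z ∣ → ∀ i → W (sp (- z ∷ w) v') i ≡ W (sp (z ∷ w) v) (odd flipℕ i)
flip-W {z = z} p (+ zero) = enc-neg z p
flip-W p (+ suc m) = refl
flip-W {z = z} p -[1+ zero ] = trans (cong ν (enc-neg z p)) (ν-involutive _)
flip-W p -[1+ suc m ] = refl

neg<⇒ν< : ∀ z → - z < z → ν (enc z) < enc z
neg<⇒ν< (+ suc m) p = -<+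
neg<⇒ν< (+ zero) (+<+ ())
neg<⇒ν< -[1+ m ] ()

ν<⇒neg< : ∀ z → 1 ℕ.≤ ∣ z ∣ → ν (enc z) < enc z → - z < z
ν<⇒neg< (+ suc m) _ p = -<+
ν<⇒neg< -[1+ m ] _ ()

cover⇒Cov : ∀ {n} {y x : SP n} → y ⋖ x → ∃ λ i → Cov y x (W y i) (W y (nxt i))
cover⇒Cov {y = sp (z ∷ w) v} {sp .(- z ∷ w) v'} (flip0 p) = -[1+ 0 ] ,
  posSwap-Cov flipPos-PosSwap (flip-W {v = v} {v'} (proj₁ (proj₁ (getPerm (sp (z ∷ w) v)) z<s))) (neg<⇒ν< z p)
cover⇒Cov {y = y} {x} (swapi s) with adjSwap-info s
... | k , k< , lt , g , h = + k , posSwap-Cov (swapPos-PosSwap k) (swap-W {y = y} {x} {k} h)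
  (get<⇒wv< y (ℕ.<-trans ℕ.≤-refl k<) k< lt)

-- The word records only positive positions; an exchange on the negative half is made as the mirror
-- image of one on the positive half.
raise : ∀ {n} (y : SP n) i → idx i ℕ.< n → idx (nxt i) ℕ.< n → W y i < W y (nxt i) → ∃ λ x → (y ⋖ x) × Cov y x (W y i) (W y (nxt i))
raise y@(sp w v) (+ k) p q lt with adjSwap-at w k q (wv<⇒get< y p q lt)
... | w' , s , g , h = x , swapi s , posSwap-Cov (swapPos-PosSwap k) (swap-W {y = y} {x} {k} h) lt
  where
  x = sp w' (getPerm⇒isSignedPerm w' (reindex-getPerm w w' k q g (getPerm y)))
raise (sp (z ∷ w) v) -[1+ zero ] p q lt = sp (- z ∷ w) v' , flip0 (ν<⇒neg< z z≢0 lt) ,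
  posSwap-Cov flipPos-PosSwap (flip-W {v = v} {v'} z≢0) lt
  where
  z≢0 = proj₁ (proj₁ (getPerm (sp (z ∷ w) v)) z<s)
  .v' : IsSignedPerm (- z ∷ w)
  v' = getPerm⇒isSignedPerm (- z ∷ w) (flip-getPerm (getPerm (sp (z ∷ w) v)))
raise y -[1+ suc k ] p q lt with raise y (+ k) q p (ν-anti⁻ lt)
... | x , c , C = x , c , mirror C

-- Elements with prescribed inversions, meets and joins

-- What the left-to-right order of the values of a signed permutation satisfies; `realize` shows
-- that every such order comes from one.
record Ord (n : ℕ) : Set₁ where
  infix 4 _⊏_
  field
    _⊏_     : ℤ → ℤ → Set
    ⊏-cmp   : ∀ {a b} → a ≢ b → a ⊏ b ⊎ b ⊏ a
    ⊏-trans : ∀ {a b c} → a ⊏ b → b ⊏ c → a ⊏ c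
    ⊏-asym  : ∀ {a b} → a ⊏ b → ¬ b ⊏ a
    ⊏-ν     : ∀ {a b} → a ⊏ b → ν b ⊏ ν a
    ⊏-big   : ∀ {a b} → n ℕ.≤ idx a ⊎ n ℕ.≤ idx b → a < b → a ⊏ b

  ⊏-dec : ∀ a b → Dec (a ⊏ b)
  ⊏-dec a b with a ℤ.≟ b
  ... | yes refl = no λ p → ⊏-asym p p
  ... | no  a≢b with ⊏-cmp a≢b
  ... | inj₁ p = yes p
  ... | inj₂ p = no (⊏-asym p)

toOrd : ∀ {n} → SP n → Ord n
toOrd x = record
  { _⊏_ = _≺⟨ x ⟩_ ; ⊏-cmp = ≺-cmp x ; ⊏-trans = ≺-trans ; ⊏-asym = ≺-asym ; ⊏-ν = ≺-ν ; ⊏-big = big-≺ x }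

-- `i < j` as a walk of unit steps, for recursion over neighbouring positions.
data Reach : ℤ → ℤ → Set where
  last : ∀ {i} → Reach i (nxt i)
  next : ∀ {i j} → Reach (nxt i) j → Reach i j

Reach-trans : ∀ {i j k} → Reach i j → Reach j k → Reach i k
Reach-trans last     s = next s
Reach-trans (next r) s = next (Reach-trans r s)

reach : ∀ {i j} → i < j → Reach i j
reach (-<- p) = neg p
  where
  neg : ∀ {m k} → k ℕ.< m → Reach -[1+ m ] -[1+ k ]
  neg {suc m} (s≤s p) with ℕ.m≤n⇒m<n∨m≡n p
  ... | inj₁ q = next (neg q)
  ... | inj₂ refl = last
reach (+<+ p) = nonneg p
  where
  nonneg : ∀ {m k} → m ℕ.< k → Reach (+ m) (+ k)
  nonneg {m} {suc k} (s≤s p) with ℕ.m≤n⇒m<n∨m≡n p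
  ... | inj₁ q = Reach-trans (nonneg q) last
  ... | inj₂ refl = last
reach (-<+ {m} {k}) = cross m k
  where
  cross : ∀ m k → Reach -[1+ m ] (+ k)
  cross zero zero = last
  cross zero (suc k) = Reach-trans (cross zero k) last
  cross (suc m) k = next (cross m k)

reach⇒< : ∀ {i j} → Reach i j → i < j
reach⇒< {i} last     = i<nxt i
reach⇒< {i} (next r) = ℤ.<-trans (i<nxt i) (reach⇒< r)

-- By oddness the image of `-[1+ 0 ]` is the reflection of the image of `+ 0`; as it must be the
-- smaller one, `+ 0` goes to a nonnegative number, and every further step gains at least one.
nonNeg-mono : ∀ {f : ℤ → ℤ} → (∀ {i j} → i < j → f i < f j) → (∀ i → f (ν i) ≡ ν (f i)) →
  ∀ m → ∃ λ k → f (+ m) ≡ + k × m ℕ.≤ k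
nonNeg-mono {f} mono odd zero with f (+ 0) | mono { -[1+ 0 ]} {+ 0} -<+ | odd (+ 0)
... | + k      | _ | _ = k , refl , z≤n
... | -[1+ k ] | p | e with subst (_< -[1+ k ]) e p
... | ()
nonNeg-mono {f} mono odd (suc m) with nonNeg-mono mono odd m
... | k , e , m≤k with f (+ suc m) | mono {+ m} {+ suc m} (+<+ ℕ.≤-refl)
... | z | p with subst (_< z) e p
... | +<+ {n = l} q = l , refl , ℕ.≤-trans (s≤s m≤k) q

count : ∀ {A : Set} {Q : A → Set} → (∀ a → Dec (Q a)) → List A → ℕ
count Q? [] = 0
count Q? (a ∷ as) with Q? a
... | yes _ = suc (count Q? as)
... | no  _ = count Q? as

count-≤ : ∀ {A : Set} {Q R : A → Set} (Q? : ∀ a → Dec (Q a)) (R? : ∀ a → Dec (R a)) →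
  (∀ {a} → Q a → R a) → ∀ as → count Q? as ℕ.≤ count R? as
count-≤ Q? R? h [] = z≤n
count-≤ Q? R? h (a ∷ as) with Q? a | R? a
... | yes q | yes r = s≤s (count-≤ Q? R? h as)
... | yes q | no  r = contradiction (h q) r
... | no  q | yes r = ℕ.m≤n⇒m≤1+n (count-≤ Q? R? h as)
... | no  q | no  r = count-≤ Q? R? h as

count-< : ∀ {A : Set} {Q R : A → Set} (Q? : ∀ a → Dec (Q a)) (R? : ∀ a → Dec (R a)) →
  (∀ {a} → Q a → R a) → ∀ {a as} → a ∈ as → R a → ¬ Q a → count Q? as ℕ.< count R? as
count-< Q? R? h {a} {_ ∷ as} (here refl) r ¬q with Q? a | R? a
... | yes q | _ = contradiction q ¬q
... | no  _ | yes _ = s≤s (count-≤ Q? R? h as)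
... | no  _ | no ¬r = contradiction r ¬r
count-< Q? R? h {a} {b ∷ as} (there i) r ¬q with Q? b | R? b
... | yes q | yes r' = s≤s (count-< Q? R? h i r ¬q)
... | yes q | no  r' = contradiction (h q) r'
... | no  q | yes r' = ℕ.m≤n⇒m≤1+n (count-< Q? R? h i r ¬q)
... | no  q | no  r' = count-< Q? R? h i r ¬q

get-mkWord : ∀ n (f : ℕ → ℤ) {m} → m ℕ.< n → get (mkWord n f) m ≡ f (suc m)
get-mkWord (suc n) f {zero}  p       = refl
get-mkWord (suc n) f {suc m} (s≤s p) = get-mkWord n (f ∘ suc) p

cov-small : ∀ {n} {y x : SP n} {c d} → Cov y x c d → idx c ℕ.< n × idx d ℕ.< n
cov-small {x = x} C = inverted-small x (Cov.c<d C) (Cov.d≺c C)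

module _ {n : ℕ} where

  Below : SP n → Ord n → Set
  Below m R = ∀ {a b} → a < b → b ≺⟨ m ⟩ a → Ord._⊏_ R b a

  ≺-dec : ∀ (x : SP n) a b → Dec (a ≺⟨ x ⟩ b)
  ≺-dec x = Ord.⊏-dec (toOrd x)

  -- Noninversions of a greatest lower bound of R₁ and R₂.
  data Chain (R₁ R₂ : Ord n) : ℤ → ℤ → Set where
    step₁ : ∀ {a b} → a < b → Ord._⊏_ R₁ a b → Chain R₁ R₂ a b
    step₂ : ∀ {a b} → a < b → Ord._⊏_ R₂ a b → Chain R₁ R₂ a b
    _⨾_   : ∀ {a b c} → Chain R₁ R₂ a b → Chain R₁ R₂ b c → Chain R₁ R₂ a c

  module Climb (R₁ R₂ : Ord n) where
    open Ord R₁ using () renaming (_⊏_ to _⊏₁_)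
    open Ord R₂ using () renaming (_⊏_ to _⊏₂_)
    private
      module R₁ = Ord R₁
      module R₂ = Ord R₂

    chain-< : ∀ {a b} → Chain R₁ R₂ a b → a < b
    chain-< (step₁ p _) = p
    chain-< (step₂ p _) = p
    chain-< (p ⨾ q)     = ℤ.<-trans (chain-< p) (chain-< q)

    -- No ascent at neighbouring positions can be reversed without leaving the elements below both
    -- orders.
    Saturated : SP n → Set
    Saturated m = ∀ i → idx i ℕ.< n → idx (nxt i) ℕ.< n → W m i < W m (nxt i) →
      W m i ⊏₁ W m (nxt i) ⊎ W m i ⊏₂ W m (nxt i)

    module _ {m : SP n} (below₁ : Below m R₁) (below₂ : Below m R₂) where

      chain-≺ : ∀ {a b} → Chain R₁ R₂ a b → a ≺⟨ m ⟩ b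
      chain-≺ {a} {b} (step₁ p q) with ≺-cmp m {a} {b} (ℤ.<⇒≢ p)
      ... | inj₁ r = r
      ... | inj₂ r = contradiction (below₁ p r) (R₁.⊏-asym q)
      chain-≺ {a} {b} (step₂ p q) with ≺-cmp m {a} {b} (ℤ.<⇒≢ p)
      ... | inj₁ r = r
      ... | inj₂ r = contradiction (below₂ p r) (R₂.⊏-asym q)
      chain-≺ (p ⨾ q) = ≺-trans (chain-≺ p) (chain-≺ q)

      -- Inversions of m are inversions of both orders, so the link of the chain that jumps over the
      -- value c can start from c instead.
      chain-shift : ∀ {a b c} → Chain R₁ R₂ a b → a < c → c < b → c ≺⟨ m ⟩ a → Chain R₁ R₂ c b
      chain-shift (step₁ _ q) a<c c<b c≺a = step₁ c<b (R₁.⊏-trans (below₁ a<c c≺a) q)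
      chain-shift (step₂ _ q) a<c c<b c≺a = step₂ c<b (R₂.⊏-trans (below₂ a<c c≺a) q)
      chain-shift {c = c} (_⨾_ {b = f} p q) a<c c<b c≺a with ℤ.<-cmp c f
      ... | tri< c<f _ _ = chain-shift p a<c c<f c≺a ⨾ q
      ... | tri≈ _ refl _ = q
      ... | tri> _ _ f<c = chain-shift q f<c c<b (≺-trans c≺a (chain-≺ p))

      module _ (sat : Saturated m) where

        adjacent-step : ∀ i → W m i < W m (nxt i) → W m i ⊏₁ W m (nxt i) ⊎ W m i ⊏₂ W m (nxt i)
        adjacent-step i lt with idx i ℕ.<? n | idx (nxt i) ℕ.<? n
        ... | yes p | yes q = sat i p q lt
        ... | no  p | _ = inj₁ (R₁.⊏-big (inj₁ (subst (n ℕ.≤_) (cong idx (sym (W-big m i (ℕ.≮⇒≥ p)))) (ℕ.≮⇒≥ p))) lt)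
        ... | yes _ | no q = inj₁ (R₁.⊏-big (inj₂
                (subst (n ℕ.≤_) (cong idx (sym (W-big m (nxt i) (ℕ.≮⇒≥ q)))) (ℕ.≮⇒≥ q))) lt)

        -- Let c, e, d be the values at i, `nxt i` and j. If e exceeds d, the order that has c
        -- before e also has e before d, which gives one link. If e is below c, the chain from e to
        -- d is shifted to start at c. Otherwise the link from c to e is prepended.
        reach-chain : ∀ {i j} → Reach i j → W m i < W m j → Chain R₁ R₂ (W m i) (W m j)
        reach-chain {i} last lt with adjacent-step i lt
        ... | inj₁ p = step₁ lt p
        ... | inj₂ p = step₂ lt p
        reach-chain {i} {j} (next r) lt with ℤ.<-cmp (W m (nxt i)) (W m j)
        ... | tri≈ _ e _ = contradiction (W-injective m e) (ℤ.<⇒≢ (reach⇒< r))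
        ... | tri> _ _ d<e with adjacent-step i (ℤ.<-trans lt d<e)
        ...   | inj₁ p = step₁ lt (R₁.⊏-trans p (below₁ d<e ⟪ subst₂ _<_ (sym (P-W m _)) (sym (P-W m _)) (reach⇒< r) ⟫))
        ...   | inj₂ p = step₂ lt (R₂.⊏-trans p (below₂ d<e ⟪ subst₂ _<_ (sym (P-W m _)) (sym (P-W m _)) (reach⇒< r) ⟫))
        reach-chain {i} {j} (next r) lt | tri< e<d _ _ with ℤ.<-cmp (W m i) (W m (nxt i))
        ... | tri≈ _ e _ = contradiction (W-injective m e) (ℤ.<⇒≢ (i<nxt i))
        ... | tri> _ _ e<c = chain-shift (reach-chain r e<d) e<c lt
                ⟪ subst₂ _<_ (sym (P-W m _)) (sym (P-W m _)) (i<nxt i) ⟫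
        ... | tri< c<e _ _ with adjacent-step i c<e
        ...   | inj₁ p = step₁ c<e p ⨾ reach-chain r e<d
        ...   | inj₂ p = step₂ c<e p ⨾ reach-chain r e<d

        saturated-chain : ∀ {a b} → a < b → a ≺⟨ m ⟩ b → Chain R₁ R₂ a b
        saturated-chain {a} {b} lt ⟪ p ⟫ = subst₂ (Chain R₁ R₂) (W-P m a) (W-P m b)
          (reach-chain (reach p) (subst₂ _<_ (sym (W-P m a)) (sym (W-P m b)) lt))

    Bad : SP n → ℤ → Set
    Bad m i = idx i ℕ.< n × idx (nxt i) ℕ.< n × W m i < W m (nxt i) ×
      W m (nxt i) ⊏₁ W m i × W m (nxt i) ⊏₂ W m i

    bad? : ∀ m i → Dec (Bad m i)
    bad? m i = (idx i ℕ.<? n) ×-dec (idx (nxt i) ℕ.<? n) ×-dec (W m i ℤ.<? W m (nxt i)) ×-dec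
      R₁.⊏-dec _ _ ×-dec R₂.⊏-dec _ _

    findBad : ∀ m → ∃ (Bad m) ⊎ Saturated m
    findBad m with ℕ.anyUpTo? (λ k → bad? m (+ k) ⊎-dec bad? m -[1+ k ]) n
    ... | yes (k , _ , inj₁ b) = inj₁ (+ k , b)
    ... | yes (k , _ , inj₂ b) = inj₁ (-[1+ k ] , b)
    ... | no  none = inj₂ sat
      where
      ¬bad : ∀ i → idx i ℕ.< n → ¬ Bad m i
      ¬bad (+ k) p b = none (k , p , inj₁ b)
      ¬bad -[1+ k ] p b = none (k , p , inj₂ b)
      sat : Saturated m
      sat i p q lt with R₁.⊏-dec (W m (nxt i)) (W m i) | R₂.⊏-dec (W m (nxt i)) (W m i)
      ... | yes r | yes s = contradiction (p , q , lt , r , s) (¬bad i p)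
      ... | no  r | _ = inj₁ ([ (λ z → z) , (λ z → contradiction z r) ]′ (R₁.⊏-cmp (ℤ.<⇒≢ lt)))
      ... | yes _ | no s = inj₂ ([ (λ z → z) , (λ z → contradiction z s) ]′ (R₂.⊏-cmp (ℤ.<⇒≢ lt)))

    below-raise : ∀ {R : Ord n} {m x c d} → Below m R → Cov m x c d → Ord._⊏_ R d c → Below x R
    below-raise {R} b C r lt inv with Cov.down C lt inv
    ... | inj₁ (refl , refl) = r
    ... | inj₂ (inj₁ (refl , refl)) = Ord.⊏-ν R r
    ... | inj₂ (inj₂ i) = b lt i

    values : List ℤ
    values = map +_ (upTo n) ++ map -[1+_] (upTo n)

    ∈-values : ∀ {a} → idx a ℕ.< n → a ∈ values
    ∈-values {+ m} p = ∈-++⁺ˡ (∈-map⁺ +_ (∈-upTo⁺ p))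
    ∈-values { -[1+ m ]} p = ∈-++⁺ʳ (map +_ (upTo n)) (∈-map⁺ (λ k → -[1+ k ]) (∈-upTo⁺ p))

    Noninv : SP n → ℤ × ℤ → Set
    Noninv x (a , b) = a < b × a ≺⟨ x ⟩ b

    noninv? : ∀ (x : SP n) ab → Dec (Noninv x ab)
    noninv? x (a , b) = (a ℤ.<? b) ×-dec ≺-dec x a b

    noninvs : SP n → ℕ
    noninvs x = count (noninv? x) (cartesianProduct values values)

    noninvs-< : ∀ {m x c d} → Cov m x c d → noninvs x ℕ.< noninvs m
    noninvs-< {m} {x} {c} {d} C = count-< (noninv? x) (noninv? m)
      (λ { (lt , p) → lt , ⊑-contra up lt p }) {a = c , d}
      (∈-cartesianProduct⁺ (∈-values (proj₁ small)) (∈-values (proj₂ small)))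
      (c<d , c≺d) (λ { (_ , p) → ≺-asym p d≺c })
      where
      open Cov C
      small = inverted-small x c<d d≺c

    -- Every raise loses a noninversion among finitely many values, so raising ends, and it ends at
    -- a saturated element.
    climb : ∀ m → Acc ℕ._<_ (noninvs m) → Below m R₁ → Below m R₂ →
      ∃ λ u → (m ≤w u) × Below u R₁ × Below u R₂ × Saturated u
    climb m (acc rs) b₁ b₂ with findBad m
    ... | inj₂ sat = m , ε , b₁ , b₂ , sat
    ... | inj₁ (i , p , q , lt , r₁ , r₂) with raise m i p q lt
    ... | x , m⋖x , C with climb x (rs (noninvs-< C)) (below-raise {R₁} b₁ C r₁) (below-raise {R₂} b₂ C r₂)
    ... | u , x≤u , rest = u , m⋖x ◅ x≤u , rest

  -- Equal inversion sets make `P y ∘ W x` and its inverse odd and strictly increasing; the bounds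
  -- of `nonNeg-mono` in both directions force the identity.
  ⊑-antisym : ∀ {x y : SP n} → x ⊑ y → y ⊑ x → x ≡ y
  ⊑-antisym {x} {y} p q = word-ext {n} {x} {y} λ { (+ m) → W-eq m ; -[1+ m ] → cong ν (W-eq m) }
    where
    mono : ∀ {u v : SP n} → u ⊑ v → v ⊑ u → ∀ {i j} → i < j → P v (W u i) < P v (W u j)
    mono {u} {v} u⊑v v⊑u {i} {j} i<j with ℤ.<-cmp (W u i) (W u j) | ⟪_⟫ {x = u} (subst₂ _<_ (sym (P-W u i)) (sym (P-W u j)) i<j)
    ... | tri< lt _ _ | r = P< (⊑-contra v⊑u lt r)
    ... | tri≈ _ e _  | r = contradiction (W-injective u e) (ℤ.<⇒≢ i<j)
    ... | tri> _ _ gt | r = P< (u⊑v gt r)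
    od : ∀ (u v : SP n) i → P v (W u (ν i)) ≡ ν (P v (W u i))
    od u v i = trans (cong (P v) (W-ν u i)) (P-ν v (W u i))
    W-eq : ∀ m → W x (+ m) ≡ W y (+ m)
    W-eq m with nonNeg-mono (mono {x} {y} p q) (od x y) m
    ... | k , e , m≤k with nonNeg-mono (mono {y} {x} q p) (od y x) k
    ... | l , e' , k≤l with ℕ.≤-antisym m≤k (subst (k ℕ.≤_)
            (ℤ.+-injective (trans (sym e') (trans (cong (λ i → P x (W y i)) (sym e)) (trans (cong (P x) (W-P y _)) (P-W x (+ m)))))) k≤l)
    ... | refl = trans (sym (W-P y _)) (cong (W y) e)

  cover⇒⊑ : ∀ {x y : SP n} → x ⋖ y → x ⊑ y
  cover⇒⊑ {x} {y} c = Cov.up (proj₂ (cover⇒Cov {n} {x} {y} c))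

  ≤⇒⊑ : ∀ {x y : SP n} → x ≤w y → x ⊑ y
  ≤⇒⊑ ε lt i = i
  ≤⇒⊑ {x} {y} (_◅_ {j = z} c s) = ⊑-trans {_} {x} {z} {y} (cover⇒⊑ {x} {z} c) (≤⇒⊑ s)

  abstract
    -- Climbing from x with y as both bounds cannot stop below y: a chain of noninversions of y is
    -- itself a noninversion of y.
    ⊑⇒≤ : ∀ {x y : SP n} → x ⊑ y → x ≤w y
    ⊑⇒≤ {x} {y} h with Climb.climb (toOrd y) (toOrd y) x (<-wellFounded _) h h
    ... | u , x≤u , b , _ , sat = subst (x ≤w_) (⊑-antisym b y⊑u) x≤u
      where
      chain⇒≺ : ∀ {a b} → Chain (toOrd y) (toOrd y) a b → a ≺⟨ y ⟩ b
      chain⇒≺ (step₁ _ p) = p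
      chain⇒≺ (step₂ _ p) = p
      chain⇒≺ (p ⨾ q) = ≺-trans (chain⇒≺ p) (chain⇒≺ q)
      y⊑u : y ⊑ u
      y⊑u {a} {b'} lt i with ≺-cmp u {a} {b'} (ℤ.<⇒≢ lt)
      ... | inj₂ r = r
      ... | inj₁ r = contradiction (chain⇒≺ (Climb.saturated-chain (toOrd y) (toOrd y) b b sat lt r)) (≺-asym i)

  identity : SP n
  identity = sp (mkWord n +_) (getPerm⇒isSignedPerm (mkWord n +_)
    ((λ p → subst (λ z → 1 ℕ.≤ ∣ z ∣ × ∣ z ∣ ℕ.≤ n) (sym (get-mkWord n +_ p)) (z<s , p)) ,
     (λ p q e → ℕ.suc-injective (trans (cong ∣_∣ (sym (get-mkWord n +_ p))) (trans e (cong ∣_∣ (get-mkWord n +_ q)))))))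

  W-identity : ∀ m → wv identity m ≡ + m
  W-identity m with m ℕ.<? n
  ... | yes p = trans (wv-in identity p) (cong enc (get-mkWord n +_ p))
  ... | no  p = wv-out identity (ℕ.≮⇒≥ p)

  P-identity : ∀ a → P identity a ≡ a
  P-identity (+ m) = P-unique identity (W-identity m)
  P-identity -[1+ m ] = P-unique identity (cong ν (W-identity m))

  identity-below : ∀ (R : Ord n) → Below identity R
  identity-below R {a} {b} lt ⟪ i ⟫ = contradiction lt (ℤ.<-asym (subst₂ _<_ (P-identity b) (P-identity a) i))

  abstract
    -- Climbing from the identity with R as both bounds ends only when every inversion of R has been
    -- made.
    realize : (R : Ord n) → ∃ λ (x : SP n) → ∀ {a b} → Ord._⊏_ R a b → a ≺⟨ x ⟩ b
    realize R with Climb.climb R R identity (<-wellFounded _) (identity-below R) (identity-below R)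
    ... | x , _ , below , _ , sat = x , ord
      where
      chain⇒⊏ : ∀ {a b} → Chain R R a b → Ord._⊏_ R a b
      chain⇒⊏ (step₁ _ p) = p
      chain⇒⊏ (step₂ _ p) = p
      chain⇒⊏ (p ⨾ q) = Ord.⊏-trans R (chain⇒⊏ p) (chain⇒⊏ q)
      ord : ∀ {a b} → Ord._⊏_ R a b → a ≺⟨ x ⟩ b
      ord {a} {b} r with ≺-cmp x {a} {b} (λ { refl → Ord.⊏-asym R r r })
      ... | inj₁ p = p
      ... | inj₂ p with ℤ.<-cmp a b
      ... | tri< lt _ _ = contradiction r (Ord.⊏-asym R (below lt p))
      ... | tri≈ _ refl _ = contradiction r (Ord.⊏-asym R r)
      ... | tri> _ _ gt = contradiction r (Ord.⊏-asym R (chain⇒⊏ (Climb.saturated-chain R R below below sat gt p)))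

  ChainW : SP n → SP n → ℤ → ℤ → Set
  ChainW x z = Chain (toOrd x) (toOrd z)

  abstract
    meet : (x z : SP n) → ∃ λ m → m ⊑ x × m ⊑ z × (∀ {a b} → a < b → a ≺⟨ m ⟩ b → ChainW x z a b)
    meet x z with Climb.climb (toOrd x) (toOrd z) identity (<-wellFounded _) (identity-below (toOrd x)) (identity-below (toOrd z))
    ... | m , _ , b₁ , b₂ , sat = m , b₁ , b₂ , Climb.saturated-chain (toOrd x) (toOrd z) b₁ b₂ sat

  chain-lower : ∀ {x z t : SP n} → t ⊑ x → t ⊑ z → ∀ {a b} → ChainW x z a b → a ≺⟨ t ⟩ b
  chain-lower {x} {z} p q = Climb.chain-≺ (toOrd x) (toOrd z) p q

  meet-greatest : ∀ {x z t : SP n} → t ⊑ x → t ⊑ z → t ⊑ proj₁ (meet x z)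
  meet-greatest {x} {z} {t} p q {a} {b} lt i with ≺-cmp (proj₁ (meet x z)) {a} {b} (ℤ.<⇒≢ lt)
  ... | inj₂ r = r
  ... | inj₁ r = contradiction (chain-lower p q (proj₂ (proj₂ (proj₂ (meet x z))) lt r)) (≺-asym i)

  isMeet-intro : ∀ {x z m : SP n} → m ⊑ x → m ⊑ z → (∀ {t} → t ⊑ x → t ⊑ z → t ⊑ m) → IsMeet x z m
  isMeet-intro p q h = ⊑⇒≤ p , ⊑⇒≤ q , λ t r s → ⊑⇒≤ (h (≤⇒⊑ r) (≤⇒⊑ s))

  meet-isMeet : ∀ x z → IsMeet x z (proj₁ (meet x z))
  meet-isMeet x z = isMeet-intro (proj₁ (proj₂ (meet x z))) (proj₁ (proj₂ (proj₂ (meet x z)))) meet-greatest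

  isMeet-chain : ∀ {x z m : SP n} → IsMeet x z m → ∀ {a b} → a < b → a ≺⟨ m ⟩ b → ChainW x z a b
  isMeet-chain {x} {z} {m} (p , q , h) lt r =
    proj₂ (proj₂ (proj₂ (meet x z))) lt (⊑-contra (≤⇒⊑ (h _ (⊑⇒≤ (proj₁ (proj₂ (meet x z)))) (⊑⇒≤ (proj₁ (proj₂ (proj₂ (meet x z))))))) lt r)

  -- The order-reversing involution and joins

  negEntry : SP n → ℕ → ℤ
  negEntry x zero    = + 0
  negEntry x (suc m) = - get (word x) m

  -- Multiplication by the longest element. Values from n on stay fixed and are not negated, so each
  -- comparison first needs `idx` below n, which inversions supply.
  neg : SP n → SP n
  neg x = sp (mkWord n (negEntry x)) (getPerm⇒isSignedPerm (mkWord n (negEntry x))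
      ((λ {m} p → subst (λ z → 1 ℕ.≤ z × z ℕ.≤ n) (sym (abs p)) (proj₁ (getPerm x) p)) ,
       (λ {m} {m'} p q e → proj₂ (getPerm x) p q (trans (sym (abs p)) (trans e (abs q))))))
    where
    abs : ∀ {m} → m ℕ.< n → ∣ get (mkWord n (negEntry x)) m ∣ ≡ ∣ get (word x) m ∣
    abs p = trans (cong ∣_∣ (get-mkWord n (negEntry x) p)) (ℤ.∣-i∣≡∣i∣ (get (word x) _))

  wv-neg : ∀ x {m} → m ℕ.< n → wv (neg x) m ≡ ν (wv x m)
  wv-neg x {m} p = trans (wv-in (neg x) p) (trans (cong enc (get-mkWord n (negEntry x) p))
    (trans (enc-neg (get (word x) m) (proj₁ (proj₁ (getPerm x) p))) (cong ν (sym (wv-in x p)))))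

  P-neg : ∀ x a → idx a ℕ.< n → P (neg x) a ≡ ν (P x a)
  P-neg x a p = P-unique (neg x) (trans (lem (ν (P x a)) (subst (ℕ._< n) (sym (idx-ν (P x a))) (P-small x a p)))
     (trans (cong ν (W-ν x (P x a))) (trans (ν-involutive _) (W-P x a))))
    where
    lem : ∀ i → idx i ℕ.< n → W (neg x) i ≡ ν (W x i)
    lem (+ m) p = wv-neg x p
    lem -[1+ m ] p = cong ν (wv-neg x p)

  ≺-neg : ∀ {x a b} → idx a ℕ.< n → idx b ℕ.< n → a ≺⟨ x ⟩ b → b ≺⟨ neg x ⟩ a
  ≺-neg {x} {a} {b} p q ⟪ r ⟫ = ⟪ subst₂ _<_ (sym (P-neg x b q)) (sym (P-neg x a p)) (ν-anti r) ⟫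

  ≺-neg⁻ : ∀ {x a b} → idx a ℕ.< n → idx b ℕ.< n → a ≺⟨ neg x ⟩ b → b ≺⟨ x ⟩ a
  ≺-neg⁻ {x} {a} {b} p q ⟪ r ⟫ = ⟪ ν-anti⁻ (subst₂ _<_ (P-neg x a p) (P-neg x b q) r) ⟫

  neg-anti : ∀ {x y} → x ⊑ y → neg y ⊑ neg x
  neg-anti {x} {y} h {a} {b} lt i with inverted-small (neg y) lt i
  ... | p , q = ≺-neg p q (⊑-contra h lt (≺-neg⁻ q p i))

  neg-neg : ∀ {x} → neg (neg x) ⊑ x
  neg-neg {x} lt i with inverted-small (neg (neg x)) lt i
  ... | p , q = ≺-neg⁻ p q (≺-neg⁻ q p i)

  neg-neg⁻ : ∀ {x} → x ⊑ neg (neg x)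
  neg-neg⁻ {x} lt i with inverted-small x lt i
  ... | p , q = ≺-neg p q (≺-neg q p i)

  isJoin⇒isMeet-neg : ∀ {x z j} → IsJoin x z j → IsMeet (neg x) (neg z) (neg j)
  isJoin⇒isMeet-neg {x} {z} {j} (p , q , h) = isMeet-intro (neg-anti (≤⇒⊑ p)) (neg-anti (≤⇒⊑ q))
    λ {t} r s → ⊑-trans {_} {t} {neg (neg t)} {neg j} (neg-neg⁻ {t}) (neg-anti (≤⇒⊑ (h (neg t)
      (⊑⇒≤ (⊑-trans {_} {x} {neg (neg x)} {neg t} (neg-neg⁻ {x}) (neg-anti r)))
      (⊑⇒≤ (⊑-trans {_} {z} {neg (neg z)} {neg t} (neg-neg⁻ {z}) (neg-anti s))))))

  abstract
    join : (x z : SP n) → ∃ λ j → IsJoin x z j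
    join x z = neg m , ⊑⇒≤ (upper x m⊑x) , ⊑⇒≤ (upper z m⊑z) ,
      λ t p q → ⊑⇒≤ (⊑-trans {_} {neg m} {neg (neg t)} {t}
        (neg-anti (meet-greatest {neg x} {neg z} {neg t} (neg-anti (≤⇒⊑ p)) (neg-anti (≤⇒⊑ q)))) (neg-neg {t}))
      where
      m : SP n
      m = proj₁ (meet (neg x) (neg z))
      m⊑x : m ⊑ neg x
      m⊑x = proj₁ (proj₂ (meet (neg x) (neg z)))
      m⊑z : m ⊑ neg z
      m⊑z = proj₁ (proj₂ (proj₂ (meet (neg x) (neg z))))
      upper : ∀ y → m ⊑ neg y → y ⊑ neg m
      upper y h = ⊑-trans {_} {y} {neg (neg y)} {neg m} (neg-neg⁻ {y}) (neg-anti h)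

-- Congruences

isMeetˡ : ∀ {n} {u v : SP n} → u ⊑ v → IsMeet u v u
isMeetˡ h = ε , ⊑⇒≤ h , λ _ p _ → p

isMeetʳ : ∀ {n} {u v : SP n} → u ⊑ v → IsMeet v u u
isMeetʳ h = ⊑⇒≤ h , ε , λ _ _ p → p

isMeet-swap : ∀ {n} {u v m : SP n} → IsMeet u v m → IsMeet v u m
isMeet-swap (p , q , h) = q , p , λ z r s → h z s r

-- Up to mirror image the label is the only inversion of x missing in y, so x is least among the
-- elements above y having it.
cov-least : ∀ {n} {y x z : SP n} {c d} → Cov y x c d → y ⊑ z → d ≺⟨ z ⟩ c → x ⊑ z
cov-least C h p lt i with Cov.down C lt i
... | inj₁ (refl , refl) = p
... | inj₂ (inj₁ (refl , refl)) = ≺-ν p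
... | inj₂ (inj₂ j) = h lt j

cov-greatest : ∀ {n} {y x z : SP n} {c d} → Cov y x c d → z ⊑ x → c ≺⟨ z ⟩ d → z ⊑ y
cov-greatest C h p lt i with Cov.down C lt (h lt i)
... | inj₁ (refl , refl) = contradiction i (≺-asym p)
... | inj₂ (inj₁ (refl , refl)) = contradiction i (≺-asym (≺-ν p))
... | inj₂ (inj₂ j) = j

-- The inversions that f forms with c or d are the same in y, where c precedes d; in each of the
-- cases f below c, between, or above d this contradicts transitivity.
cov-adjacent : ∀ {n} {y x : SP n} {c d f} → Cov y x c d → f ≢ c → f ≢ d → d ≺⟨ x ⟩ f → f ≺⟨ x ⟩ c → ⊥
cov-adjacent {y = y} {x} {c} {d} {f} C f≢c f≢d d≺f f≺c with ℤ.<-cmp c f | ℤ.<-cmp f d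
... | tri≈ _ e _ | _ = f≢c (sym e)
... | _ | tri≈ _ e _ = f≢d e
... | tri> _ _ f<c | _ with Cov.down C (ℤ.<-trans f<c (Cov.c<d C)) d≺f
...   | inj₁ (e , _) = f≢c e
...   | inj₂ (inj₁ (e , e')) = f≢c (trans e (sym (ν-fix (sym e'))))
...   | inj₂ (inj₂ p) = ≺-asym f≺c (Cov.up C f<c (≺-trans (Cov.c≺d C) p))
cov-adjacent C f≢c f≢d d≺f f≺c | tri< c<f _ _ | tri> _ _ d<f with Cov.down C c<f f≺c
...   | inj₁ (_ , e) = f≢d e
...   | inj₂ (inj₁ (e , e')) = f≢d (trans e' (sym (ν-fix (sym e))))
...   | inj₂ (inj₂ p) = ≺-asym d≺f (Cov.up C d<f (≺-trans p (Cov.c≺d C)))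
cov-adjacent C f≢c f≢d d≺f f≺c | tri< c<f _ _ | tri< f<d _ _ with Cov.down C c<f f≺c | Cov.down C f<d d≺f
...   | inj₁ (_ , e) | _ = f≢d e
...   | inj₂ (inj₁ (e , e')) | _ = f≢d (trans e' (sym (ν-fix (sym e))))
...   | inj₂ (inj₂ _) | inj₁ (e , _) = f≢c e
...   | inj₂ (inj₂ _) | inj₂ (inj₁ (e , e')) = f≢c (trans e (sym (ν-fix (sym e'))))
...   | inj₂ (inj₂ p) | inj₂ (inj₂ q) = ≺-asym (≺-trans p (Cov.c≺d C)) q

-- `S` holds of the values to the left of the arc. In the upper element of a cover d and c are
-- adjacent, so standing before d is the same as standing before c.
SidesAre : ∀ {n} → SP n → ℤ → ℤ → (ℤ → Set) → Set
SidesAre x c d S = ∀ {f} → c < f → f < d → (f ≺⟨ x ⟩ d → S f) × (S f → f ≺⟨ x ⟩ d)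

own-sides : ∀ {n} {x : SP n} {c d} → SidesAre x c d (_≺⟨ x ⟩ d)
own-sides _ _ = (λ i → i) , (λ i → i)

-- A single contracted cover serves as witness for the arc; by `transport` its choice is immaterial.
record ArcContracted {n : ℕ} (Θ : Rel n) (c d : ℤ) (S : ℤ → Set) : Set where
  constructor arc
  field
    {lower upper} : SP n
    cov   : Cov lower upper c d
    sides : SidesAre upper c d S
    rel   : Θ upper lower

module Congruence {n : ℕ} {Θ : Rel n} (isC : IsCongruence Θ) where
  open IsEquivalence (proj₁ isC) renaming (refl to Θ-refl; sym to Θ-sym; trans to Θ-trans) public

  Θ-meet : ∀ {x y z m m'} → Θ x y → IsMeet x z m → IsMeet y z m' → Θ m m'
  Θ-meet = proj₁ (proj₂ isC)

  Θ-join : ∀ {x y z j j'} → Θ x y → IsJoin x z j → IsJoin y z j' → Θ j j'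
  Θ-join = proj₂ (proj₂ isC)

  convex : ∀ {u v w} → u ⊑ v → v ⊑ w → Θ w u → Θ v u
  convex p q r = Θ-meet r (isMeetʳ q) (isMeetˡ p)

  -- Joining g ≡ g* with y gives g ∨ y ≡ y. Once this join inverts c and d it lies above x, and
  -- convexity gives x ≡ y.
  joinCov : ∀ {y x c d g g*} → Cov y x c d → Θ g g* → g* ⊑ y → (∀ {z} → y ⊑ z → g ⊑ z → d ≺⟨ z ⟩ c) → Θ x y
  joinCov {y} {x} {c} {d} {g} {g*} C r p h with join g y
  ... | j , J@(g≤j , y≤j , least) = convex (Cov.up C) (cov-least C (≤⇒⊑ y≤j) (h (≤⇒⊑ y≤j) (≤⇒⊑ g≤j)))
          (Θ-join r J (⊑⇒≤ p , ε , λ _ _ q → q))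

  -- Dually, x ≡ t* ∧ x, and this meet lies below y once it keeps c before d.
  meetCov : ∀ {y x c d t t*} → Cov y x c d → Θ t t* → x ⊑ t → (∀ {z} → z ⊑ x → z ⊑ t* → c ≺⟨ z ⟩ d) → Θ x y
  meetCov {y} {x} {c} {d} {t} {t*} C r p h with meet t* x | meet-isMeet t* x
  ... | m , m⊑t* , m⊑x , _ | M = Θ-trans Θxm (Θ-sym (convex (cov-greatest C m⊑x (h m⊑x m⊑t*)) (Cov.up C) Θxm))
    where
    Θxm = Θ-meet r (isMeetʳ p) M

  -- Two covers with the same label and the same sides are contracted together: the label stays inverted
  -- in the meet of the two upper elements, because every chain of noninversions leaving c stays right of d.
  transport : ∀ {y x c d S} → Cov y x c d → SidesAre x c d S → ArcContracted Θ c d S → Θ x y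
  transport {y} {x} {c} {d} {S} C sides (arc {y₀} {x₀} C₀ sides₀ r) =
    joinCov C Θmu (cov-greatest C (u⊑m⊑x) (⊑-contra u⊑y₀ c<d c≺y₀d))
      λ _ m⊑z → m⊑z c<d d≺mc
    where
    open Cov C using (c<d)
    c≺y₀d = Cov.c≺d C₀
    M = meet x₀ x
    m = proj₁ M
    m⊑x₀ = proj₁ (proj₂ M)
    m⊑x = proj₁ (proj₂ (proj₂ M))
    -- Meeting x₀ ≡ y₀ with m gives m ≡ u. Since c precedes d in y₀ and hence in u, u lies below y,
    -- as `joinCov` requires.
    U = meet y₀ m
    u = proj₁ U
    u⊑y₀ = proj₁ (proj₂ U)
    u⊑m⊑x : ∀ {a b} → a < b → b ≺⟨ u ⟩ a → b ≺⟨ x ⟩ a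
    u⊑m⊑x lt i = m⊑x lt (proj₁ (proj₂ (proj₂ U)) lt i)
    Θmu : Θ m u
    Θmu = Θ-meet r (isMeetʳ m⊑x₀) (meet-isMeet y₀ m)
    Good : ℤ → Set
    Good a = d ≺⟨ x₀ ⟩ a × d ≺⟨ x ⟩ a
    keep₀ : ∀ {b} → c < b → b < d → d ≺⟨ x ⟩ b → d ≺⟨ x₀ ⟩ b
    keep₀ {b} p q i with ≺-cmp x₀ {b} {d} (ℤ.<⇒≢ q)
    ... | inj₂ r = r
    ... | inj₁ r = contradiction (proj₂ (sides p q) (proj₁ (sides₀ p q) r)) (≺-asym i)
    keep : ∀ {b} → c < b → b < d → d ≺⟨ x₀ ⟩ b → d ≺⟨ x ⟩ b
    keep {b} p q i with ≺-cmp x {b} {d} (ℤ.<⇒≢ q)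
    ... | inj₂ r = r
    ... | inj₁ r = contradiction (proj₂ (sides₀ p q) (proj₁ (sides p q) r)) (≺-asym i)
    good : ∀ {a b} → ChainW x₀ x a b → c ℤ.≤ a → b < d → Good a → Good b
    good (step₁ lt p) q r (i , j) = ≺-trans i p , keep (ℤ.≤-<-trans q lt) r (≺-trans i p)
    good (step₂ lt p) q r (i , j) = keep₀ (ℤ.≤-<-trans q lt) r (≺-trans j p) , ≺-trans j p
    good (s ⨾ t) q r g = good t (ℤ.≤-trans q (ℤ.<⇒≤ (Climb.chain-< (toOrd x₀) (toOrd x) s))) r
      (good s q (ℤ.<-trans (Climb.chain-< (toOrd x₀) (toOrd x) t) r) g)
    end : ∀ {a} → ChainW x₀ x a d → c ℤ.≤ a → Good a → ⊥
    end (step₁ _ p) q (i , _) = ≺-asym i p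
    end (step₂ _ p) q (_ , j) = ≺-asym j p
    end (s ⨾ t) q g = end t (ℤ.≤-trans q (ℤ.<⇒≤ (Climb.chain-< (toOrd x₀) (toOrd x) s)))
      (good s q (Climb.chain-< (toOrd x₀) (toOrd x) t) g)
    d≺mc : d ≺⟨ m ⟩ c
    d≺mc with ≺-cmp m {c} {d} (ℤ.<⇒≢ c<d)
    ... | inj₂ p = p
    ... | inj₁ p = ⊥-elim (end (proj₂ (proj₂ (proj₂ M)) c<d p) ℤ.≤-refl (Cov.d≺c C₀ , Cov.d≺c C))

-- The congruence Ψ

-- The difference b - a for a < b: the measure of the inductions on labels.
gap : ℤ → ℤ → ℕ
gap (+ a)    (+ b)    = b ℕ.∸ a
gap -[1+ a ] (+ b)    = suc (a ℕ.+ b)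
gap -[1+ a ] -[1+ b ] = a ℕ.∸ b
gap (+ a)    -[1+ b ] = 0

gap-ν : ∀ a b → gap (ν b) (ν a) ≡ gap a b
gap-ν (+ a) (+ b) = refl
gap-ν (+ a) -[1+ b ] = refl
gap-ν -[1+ a ] (+ b) = cong suc (ℕ.+-comm b a)
gap-ν -[1+ a ] -[1+ b ] = refl

gap-<ʳ : ∀ {a b c} → a < b → b < c → gap a b ℕ.< gap a c
gap-<ʳ (-<- p) (-<- q) = ℕ.∸-monoʳ-< q (ℕ.<⇒≤ p)
gap-<ʳ { -[1+ a ]} { -[1+ b ]} {+ c} (-<- p) -<+ = s≤s (ℕ.≤-trans (ℕ.m∸n≤m a b) (ℕ.m≤m+n a c))
gap-<ʳ { -[1+ a ]} -<+ (+<+ q) = s≤s (ℕ.+-monoʳ-< a q)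
gap-<ʳ (+<+ p) (+<+ q) = ℕ.∸-monoˡ-< q (ℕ.<⇒≤ p)

gap-<ˡ : ∀ {a b c} → a < b → b < c → gap b c ℕ.< gap a c
gap-<ˡ {a} {b} {c} p q = subst₂ ℕ._<_ (gap-ν b c) (gap-ν a c) (gap-<ʳ (ν-anti q) (ν-anti p))

flipSide : Side → Side
flipSide left  = right
flipSide right = left

flipSide-involutive : ∀ s → flipSide (flipSide s) ≡ s
flipSide-involutive left  = refl
flipSide-involutive right = refl

Equivariant : (ℤ → Side) → Set
Equivariant σ = ∀ a → σ (ν a) ≡ flipSide (σ a)

-- Read as a point of the centrally symmetric picture, -k lies on the side opposite to k.
extend : (ℕ → Side) → ℤ → Side
extend d (+ m)    = d (suc m)
extend d -[1+ m ] = flipSide (d (suc m))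

extend-equivariant : ∀ d → Equivariant (extend d)
extend-equivariant d (+ m)    = refl
extend-equivariant d -[1+ m ] = sym (flipSide-involutive _)

module _ {n : ℕ} where

  Misplaced : (ℤ → Side) → SP n → ℤ → ℤ → ℤ → Set
  Misplaced σ x c d e = (σ e ≡ left × d ≺⟨ x ⟩ e) ⊎ (σ e ≡ right × e ≺⟨ x ⟩ d)

  Wrong : (ℤ → Side) → SP n → ℤ → ℤ → ℤ → Set
  Wrong σ x c d e = c < e × e < d × Misplaced σ x c d e

  -- Reflection exchanges the two ends as well as the two sides; adjacency of d and c turns a
  -- comparison of e with d into one with c.
  wrong-mirror : ∀ {σ y x c d e} → Equivariant σ → Cov y x c d → Wrong σ x c d e → Wrong σ x (ν d) (ν c) (ν e)
  wrong-mirror {σ} {y} {x} {c} {d} {e} eq C (c<e , e<d , inj₁ (l , p)) = ν-anti e<d , ν-anti c<e ,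
    inj₂ (trans (eq e) (cong flipSide l) , ≺-ν c≺e)
    where
    c≺e : c ≺⟨ x ⟩ e
    c≺e with ≺-cmp x {c} {e} (ℤ.<⇒≢ c<e)
    ... | inj₁ q = q
    ... | inj₂ q = ⊥-elim (cov-adjacent C (≢-sym (ℤ.<⇒≢ c<e)) (ℤ.<⇒≢ e<d) p q)
  wrong-mirror {σ} {y} {x} {c} {d} {e} eq C (c<e , e<d , inj₂ (r , p)) = ν-anti e<d , ν-anti c<e ,
    inj₁ (trans (eq e) (cong flipSide r) , ≺-ν (≺-trans p (Cov.d≺c C)))

  Designated : (ℤ → Side) → ℤ → ℤ → SP n → Set
  Designated σ c d x = SidesAre x c d (λ f → σ f ≡ left)

  -- Values strictly between c and d have bounded `idx`, so a finite search decides.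
  designated-or-wrong : ∀ σ x c d → Designated σ c d x ⊎ ∃ (Wrong σ x c d)
  designated-or-wrong σ x c d with ℕ.anyUpTo? (λ k → wrong? (+ k) ⊎-dec wrong? -[1+ k ]) (suc (idx c ℕ.⊔ idx d))
    where
    _≟ˢ_ : (s t : Side) → Dec (s ≡ t)
    left  ≟ˢ left  = yes refl
    left  ≟ˢ right = no λ ()
    right ≟ˢ left  = no λ ()
    right ≟ˢ right = yes refl
    wrong? : ∀ e → Dec (Wrong σ x c d e)
    wrong? e = (c ℤ.<? e) ×-dec (e ℤ.<? d) ×-dec
      (((σ e ≟ˢ left) ×-dec ≺-dec x d e) ⊎-dec ((σ e ≟ˢ right) ×-dec ≺-dec x e d))
  ... | yes (k , _ , inj₁ w) = inj₂ (+ k , w)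
  ... | yes (k , _ , inj₂ w) = inj₂ (-[1+ k ] , w)
  ... | no none = inj₁ λ {f} p q → (λ i → [ (λ z → z) , (λ z → ⊥-elim (¬wrong f (p , q , inj₂ (z , i)))) ]′ (side f)) ,
      λ l → [ (λ z → z) , (λ z → ⊥-elim (¬wrong f (p , q , inj₁ (l , z)))) ]′ (≺-cmp x (ℤ.<⇒≢ q))
    where
    side : ∀ f → σ f ≡ left ⊎ σ f ≡ right
    side f with σ f
    ... | left  = inj₁ refl
    ... | right = inj₂ refl
    bound : ∀ {c d f} → c < f → f < d → idx f ℕ.< suc (idx c ℕ.⊔ idx d)
    bound {c} {d} {+ m} p (+<+ q) = ℕ.≤-trans q (ℕ.≤-trans (ℕ.m≤n⊔m (idx c) _) (ℕ.n≤1+n _))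
    bound {c} {d} { -[1+ m ]} (-<- p) q = ℕ.≤-trans p (ℕ.≤-trans (ℕ.m≤m⊔n _ (idx d)) (ℕ.n≤1+n _))
    ¬wrong : ∀ f → ¬ Wrong σ x c d f
    ¬wrong (+ k) w = none (k , bound (proj₁ w) (proj₁ (proj₂ w)) , inj₁ w)
    ¬wrong -[1+ k ] w = none (k , bound (proj₁ w) (proj₁ (proj₂ w)) , inj₂ w)

  -- When b stands directly before a, with the left values before them and the right values after
  -- them, these pairs are inverted: the larger value is b or left, the smaller one is a or right.
  record Needed (σ : ℤ → Side) (a b c d : ℤ) : Set where
    field
      a≤c : a ℤ.≤ c
      c<d : c < d
      d≤b : d ℤ.≤ b
      lo  : c ≡ a ⊎ σ c ≡ right
      hi  : d ≡ b ⊎ σ d ≡ left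

  -- The join-irreducible element of the arc from b down to a with sides σ lies below x.
  ArcBelow : (ℤ → Side) → ℤ → ℤ → SP n → Set
  ArcBelow σ a b x = ∀ {c d} → Needed σ a b c d → d ≺⟨ x ⟩ c

  _≤ᴶ⟨_⟩_ : SP n → (ℤ → Side) → SP n → Set
  x ≤ᴶ⟨ σ ⟩ y = ∀ {a b} → idx a ℕ.< n → idx b ℕ.< n → ArcBelow σ a b x → ArcBelow σ a b y

  Ψ : (ℤ → Side) → Rel n
  Ψ σ x y = x ≤ᴶ⟨ σ ⟩ y × y ≤ᴶ⟨ σ ⟩ x

  flip : (ℤ → Side) → ℤ → Side
  flip σ = flipSide ∘ σ

  -- At an intermediate value f one half of the chain is again a needed pair: a left f serves as its
  -- larger value, a right f as its smaller one.
  chain-blocked : ∀ {σ a b x z} → ArcBelow σ a b x → ArcBelow σ a b z → ∀ {c d} → ChainW x z c d → ¬ Needed σ a b c d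
  chain-blocked bx bz (step₁ _ p) N = ≺-asym p (bx N)
  chain-blocked bx bz (step₂ _ p) N = ≺-asym p (bz N)
  chain-blocked {σ} {a} {b} {x} {z} bx bz (_⨾_ {b = f} s t) N with σ f in eq
  ... | left  = chain-blocked bx bz s record
          { a≤c = N.a≤c ; c<d = Climb.chain-< _ _ s ; d≤b = ℤ.≤-trans (ℤ.<⇒≤ (Climb.chain-< _ _ t)) N.d≤b
          ; lo = N.lo ; hi = inj₂ eq }
    where module N = Needed N
  ... | right = chain-blocked bx bz t record
          { a≤c = ℤ.≤-trans N.a≤c (ℤ.<⇒≤ (Climb.chain-< _ _ s)) ; c<d = Climb.chain-< _ _ t ; d≤b = N.d≤b
          ; lo = inj₂ eq ; hi = N.hi }
    where module N = Needed N

  ≤ᴶ-meet : ∀ {σ x y z m m'} → x ≤ᴶ⟨ σ ⟩ y → IsMeet x z m → IsMeet y z m' → m ≤ᴶ⟨ σ ⟩ m'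
  ≤ᴶ-meet {σ} {x} {y} {z} {m} {m'} h M M' p q bm {c} {d} N with ≺-cmp m' {c} {d} (ℤ.<⇒≢ (Needed.c<d N))
  ... | inj₂ r = r
  ... | inj₁ r = ⊥-elim (chain-blocked (h p q (λ N → ≤⇒⊑ (proj₁ M) (Needed.c<d N) (bm N)))
          (λ N → ≤⇒⊑ (proj₁ (proj₂ M)) (Needed.c<d N) (bm N)) (isMeet-chain M' (Needed.c<d N) r) N)

  -- If a needed noninversion failed in y, a shortest failing pair would be the label of a designated
  -- arc below y, hence below x.
  arc-free : ∀ {σ x y a b} → y ≤ᴶ⟨ σ ⟩ x → idx a ℕ.< n → idx b ℕ.< n → ArcBelow (flip σ) a b (neg x) →
    ∀ k {c d} → gap c d ℕ.< k → Needed (flip σ) a b c d → c ≺⟨ y ⟩ d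
  arc-free {σ} {x} {y} {a} {b} h a< b< bx (suc k) {c} {d} (s≤s g) N with ≺-cmp y {c} {d} (ℤ.<⇒≢ (Needed.c<d N))
  ... | inj₁ p = p
  ... | inj₂ d≺c = ⊥-elim (≺-asym (≺-neg⁻ (proj₂ small) (proj₁ small) (bx N)) (h (proj₁ small) (proj₂ small) below record
          { a≤c = ℤ.≤-refl ; c<d = N.c<d ; d≤b = ℤ.≤-refl ; lo = inj₁ refl ; hi = inj₁ refl }))
    where
    module N = Needed N
    small = inverted-small y N.c<d d≺c
    lowSide : ∀ {e} → c ℤ.≤ e → e < d → e ≡ c ⊎ σ e ≡ right → e ≡ c ⊎ c ≺⟨ y ⟩ e
    lowSide {e} p q (inj₁ z) = inj₁ z
    lowSide {e} p q (inj₂ r) with e ℤ.≟ c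
    ... | yes z = inj₁ z
    ... | no  z = inj₂ (arc-free h a< b< bx k (ℕ.<-≤-trans (gap-<ʳ c<e q) g) record
            { a≤c = N.a≤c ; c<d = c<e ; d≤b = ℤ.≤-trans (ℤ.<⇒≤ q) N.d≤b ; lo = N.lo ; hi = inj₂ (cong flipSide r) })
      where c<e = ℤ.≤∧≢⇒< p (λ w → z (sym w))
    highSide : ∀ {f} → c < f → f ℤ.≤ d → f ≡ d ⊎ σ f ≡ left → f ≡ d ⊎ f ≺⟨ y ⟩ d
    highSide {f} p q (inj₁ z) = inj₁ z
    highSide {f} p q (inj₂ r) with f ℤ.≟ d
    ... | yes z = inj₁ z
    ... | no  z = inj₂ (arc-free h a< b< bx k (ℕ.<-≤-trans (gap-<ˡ p f<d) g) record
            { a≤c = ℤ.≤-trans N.a≤c (ℤ.<⇒≤ p) ; c<d = f<d ; d≤b = N.d≤b ; lo = inj₂ (cong flipSide r) ; hi = N.hi })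
      where f<d = ℤ.≤∧≢⇒< q z
    below : ArcBelow σ c d y
    below {e} {f} M with lowSide (Needed.a≤c M) (ℤ.<-≤-trans (Needed.c<d M) (Needed.d≤b M)) (Needed.lo M)
                       | highSide (ℤ.≤-<-trans (Needed.a≤c M) (Needed.c<d M)) (Needed.d≤b M) (Needed.hi M)
    ... | inj₁ refl | inj₁ refl = d≺c
    ... | inj₁ refl | inj₂ p    = ≺-trans p d≺c
    ... | inj₂ q    | inj₁ refl = ≺-trans d≺c q
    ... | inj₂ q    | inj₂ p    = ≺-trans p (≺-trans d≺c q)

  -- For the negated elements needed pairs turn into noninversions of x, which `arc-free` carries
  -- over to y.
  ≤ᴶ-neg : ∀ {σ x y} → y ≤ᴶ⟨ σ ⟩ x → neg x ≤ᴶ⟨ flip σ ⟩ neg y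
  ≤ᴶ-neg {σ} {x} {y} h {a} {b} a< b< bx {c} {d} N = ≺-neg (small c (Needed.a≤c N) c≤b) (small d a≤d (Needed.d≤b N))
    (arc-free h a< b< bx (suc (gap c d)) ℕ.≤-refl N)
    where
    c≤b = ℤ.≤-trans (ℤ.<⇒≤ (Needed.c<d N)) (Needed.d≤b N)
    a≤d = ℤ.≤-trans (Needed.a≤c N) (ℤ.<⇒≤ (Needed.c<d N))
    small : ∀ e → a ℤ.≤ e → e ℤ.≤ b → idx e ℕ.< n
    small (+ m) p (ℤ.+≤+ q) = ℕ.≤-<-trans q b<
    small -[1+ m ] (ℤ.-≤- p) q = ℕ.≤-<-trans p a<

  Ψ-neg : ∀ {σ x y} → Ψ σ x y → Ψ (flip σ) (neg x) (neg y)
  Ψ-neg (p , q) = ≤ᴶ-neg q , ≤ᴶ-neg p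

  Ψ-meet : ∀ {σ x y z m m'} → Ψ σ x y → IsMeet x z m → IsMeet y z m' → Ψ σ m m'
  Ψ-meet (p , q) M M' = ≤ᴶ-meet p M M' , ≤ᴶ-meet q M' M

  neg-involutive : ∀ (x : SP n) → neg (neg x) ≡ x
  neg-involutive x = ⊑-antisym (neg-neg {n} {x}) (neg-neg⁻ {n} {x})

  -- The double flip equals σ only pointwise, so needed pairs have to be converted.
  ≤ᴶ-flip² : ∀ {σ x y} → x ≤ᴶ⟨ flip (flip σ) ⟩ y → x ≤ᴶ⟨ σ ⟩ y
  ≤ᴶ-flip² {σ} h p q b N = h p q (λ M → b (conv (λ _ e → trans (sym (flipSide-involutive _)) e) M)) (conv (λ _ e → trans (flipSide-involutive _) e) N)
    where
    conv : ∀ {σ τ : ℤ → Side} {a b c d} → (∀ e {s} → σ e ≡ s → τ e ≡ s) → Needed σ a b c d → Needed τ a b c d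
    conv h N = record { Needed N hiding (lo ; hi)
      ; lo = [ inj₁ , (λ e → inj₂ (h _ e)) ]′ (Needed.lo N) ; hi = [ inj₁ , (λ e → inj₂ (h _ e)) ]′ (Needed.hi N) }

  -- Joins become meets under `neg` at the price of flipped sides; a second `neg` restores both.
  Ψ-isCongruence : ∀ σ → IsCongruence (Ψ σ)
  Ψ-isCongruence σ =
    record { refl = (λ _ _ b → b) , (λ _ _ b → b)
           ; sym = λ { (p , q) → q , p }
           ; trans = λ { (p , q) (r , s) → (λ i j b → r i j (p i j b)) , (λ i j b → q i j (s i j b)) } } ,
    Ψ-meet ,
    λ {x} {y} {z} {j} {j'} h J J' → unneg (Ψ-neg (Ψ-meet (Ψ-neg h) (isJoin⇒isMeet-neg J) (isJoin⇒isMeet-neg J')))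
    where
    unneg : ∀ {j j'} → Ψ (flip (flip σ)) (neg (neg j)) (neg (neg j')) → Ψ σ j j'
    unneg {j} {j'} (p , q) = subst₂ (Ψ σ) (neg-involutive j) (neg-involutive j') (≤ᴶ-flip² p , ≤ᴶ-flip² q)

  -- An arc below x that needs (c, d) would also need (c, e) or (e, d), against the actual place of
  -- e. So no arc below x uses the one inversion that y lacks.
  wrong⇒Ψ : ∀ {σ y x c d e} → Equivariant σ → Cov y x c d → Wrong σ x c d e → Ψ σ x y
  wrong⇒Ψ {σ} {y} {x} {c} {d} {e} eqv C w = fwd , λ _ _ b N → Cov.up C (Needed.c<d N) (b N)
    where
    blocked : ∀ {c d e a b} → Cov y x c d → Wrong σ x c d e → ArcBelow σ a b x → ¬ Needed σ a b c d
    blocked C (c<e , e<d , inj₁ (l , p)) b N = cov-adjacent C (≢-sym (ℤ.<⇒≢ c<e)) (ℤ.<⇒≢ e<d) p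
      (b record { a≤c = Needed.a≤c N ; c<d = c<e ; d≤b = ℤ.≤-trans (ℤ.<⇒≤ e<d) (Needed.d≤b N) ; lo = Needed.lo N ; hi = inj₂ l })
    blocked C (c<e , e<d , inj₂ (r , p)) b N = ≺-asym p
      (b record { a≤c = ℤ.≤-trans (Needed.a≤c N) (ℤ.<⇒≤ c<e) ; c<d = e<d ; d≤b = Needed.d≤b N ; lo = inj₂ r ; hi = Needed.hi N })
    fwd : x ≤ᴶ⟨ σ ⟩ y
    fwd p q b N with Cov.down C (Needed.c<d N) (b N)
    ... | inj₁ (refl , refl) = ⊥-elim (blocked C w b N)
    ... | inj₂ (inj₁ (refl , refl)) = ⊥-elim (blocked (mirror C) (wrong-mirror {e = e} eqv C w) b N)
    ... | inj₂ (inj₂ i) = i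

  -- The arc of the cover itself separates the two elements: it lies below x, but y lacks the
  -- inversion of its ends.
  designated⇒¬Ψ : ∀ {σ y x c d} → Cov y x c d → Designated σ c d x → ¬ Ψ σ x y
  designated⇒¬Ψ {σ} {y} {x} {c} {d} C D (h , _) = ≺-asym (Cov.c≺d C) (h (proj₁ small) (proj₂ small) below record
      { a≤c = ℤ.≤-refl ; c<d = Cov.c<d C ; d≤b = ℤ.≤-refl ; lo = inj₁ refl ; hi = inj₁ refl })
    where
    small = cov-small C
    below : ArcBelow σ c d x
    below {e} {f} N = before (atC (e ℤ.≟ c)) (atD (f ℤ.≟ d))
      where
      module N = Needed N
      atC : Dec (e ≡ c) → e ≡ c ⊎ c ≺⟨ x ⟩ e
      atC (yes z) = inj₁ z
      atC (no  z) = inj₂ go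
        where
        c<e = ℤ.≤∧≢⇒< N.a≤c (λ w → z (sym w))
        e<d = ℤ.<-≤-trans N.c<d N.d≤b
        go : c ≺⟨ x ⟩ e
        go with ≺-cmp x {c} {e} (λ w → z (sym w))
        ... | inj₁ p = p
        ... | inj₂ p with ≺-cmp x {d} {e} (≢-sym (ℤ.<⇒≢ e<d))
        ...   | inj₁ q = ⊥-elim (cov-adjacent C z (ℤ.<⇒≢ e<d) q p)
        ...   | inj₂ q = case N.lo of λ { (inj₁ w) → contradiction w z
                                        ; (inj₂ r) → case trans (sym r) (proj₁ (D c<e e<d) q) of λ () }
      atD : Dec (f ≡ d) → f ≡ d ⊎ f ≺⟨ x ⟩ d
      atD (yes z) = inj₁ z
      atD (no  z) = inj₂ (proj₂ (D (ℤ.≤-<-trans N.a≤c N.c<d) (ℤ.≤∧≢⇒< N.d≤b z))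
                        (case N.hi of λ { (inj₁ w) → contradiction w z ; (inj₂ l) → l }))
      before : e ≡ c ⊎ c ≺⟨ x ⟩ e → f ≡ d ⊎ f ≺⟨ x ⟩ d → f ≺⟨ x ⟩ e
      before (inj₁ refl) (inj₁ refl) = Cov.d≺c C
      before (inj₁ refl) (inj₂ p)    = ≺-trans p (Cov.d≺c C)
      before (inj₂ q)    (inj₁ refl) = ≺-trans (Cov.d≺c C) q
      before (inj₂ q)    (inj₂ p)    = ≺-trans p (≺-trans (Cov.d≺c C) q)

-- Hexagons

Lex : (ℤ → ℤ) → (ℤ → ℤ) → ℤ → ℤ → Set
Lex p j a b = p a < p b ⊎ (p a ≡ p b × j a < j b)

-- `p` is a coarse position and `j` ranks the values that share it. By `small` the values below n
-- cannot pass the fixed ones; the boundary key n is allowed when ties there are broken by value.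
lexOrd : ∀ {n} (p j : ℤ → ℤ) → (∀ a → p (ν a) ≡ ν (p a)) → (∀ a → j (ν a) ≡ ν (j a)) →
  (∀ {a b} → p a ≡ p b → j a ≡ j b → a ≡ b) →
  (∀ a → n ℕ.≤ idx a → p a ≡ a × j a ≡ a) →
  (∀ a → idx a ℕ.< n → idx (p a) ℕ.< n ⊎ idx (p a) ℕ.≤ n × j a ≡ a) → Ord n
lexOrd {n} p j p-ν j-ν inj big small = record
  { _⊏_ = Lex p j
  ; ⊏-cmp = cmp
  ; ⊏-trans = λ { (inj₁ q) (inj₁ r) → inj₁ (ℤ.<-trans q r)
                ; {a} (inj₁ q) (inj₂ (e , _)) → inj₁ (subst (p a <_) e q)
                ; {c = c} (inj₂ (e , _)) (inj₁ r) → inj₁ (subst (_< p c) (sym e) r)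
                ; (inj₂ (e , q)) (inj₂ (e' , r)) → inj₂ (trans e e' , ℤ.<-trans q r) }
  ; ⊏-asym = λ { (inj₁ q) (inj₁ r) → ℤ.<-asym q r
               ; (inj₁ q) (inj₂ (e , _)) → ℤ.<-irrefl (sym e) q
               ; (inj₂ (e , _)) (inj₁ r) → ℤ.<-irrefl (sym e) r
               ; (inj₂ (_ , q)) (inj₂ (_ , r)) → ℤ.<-asym q r }
  ; ⊏-ν = λ { {a} {b} (inj₁ q) → inj₁ (subst₂ _<_ (sym (p-ν b)) (sym (p-ν a)) (ν-anti q))
            ; {a} {b} (inj₂ (e , q)) → inj₂ (trans (p-ν b) (trans (cong ν (sym e)) (sym (p-ν a))) ,
                 subst₂ _<_ (sym (j-ν b)) (sym (j-ν a)) (ν-anti q)) }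
  ; ⊏-big = bigs }
  where
  cmp : ∀ {a b} → a ≢ b → Lex p j a b ⊎ Lex p j b a
  cmp {a} {b} ne with ℤ.<-cmp (p a) (p b) | ℤ.<-cmp (j a) (j b)
  ... | tri< q _ _ | _ = inj₁ (inj₁ q)
  ... | tri> _ _ q | _ = inj₂ (inj₁ q)
  ... | tri≈ _ e _ | tri< q _ _ = inj₁ (inj₂ (e , q))
  ... | tri≈ _ e _ | tri> _ _ q = inj₂ (inj₂ (sym e , q))
  ... | tri≈ _ e _ | tri≈ _ e' _ = contradiction (inj e e') ne
  above : ∀ {a k} → n ℕ.≤ k → idx a ℕ.< n → a < + k → Lex p j a (+ k)
  above {a} {k} q s lt with p a | small a s
  ... | -[1+ m ] | _ = inj₁ (subst (_ <_) (sym (proj₁ (big (+ k) q))) -<+)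
  ... | + m | inj₁ r = inj₁ (subst (_ <_) (sym (proj₁ (big (+ k) q))) (+<+ (ℕ.<-≤-trans r q)))
  ... | + m | inj₂ (r , e) with ℕ.m≤n⇒m<n∨m≡n (ℕ.≤-trans r q)
  ...   | inj₁ t = inj₁ (subst (_ <_) (sym (proj₁ (big (+ k) q))) (+<+ t))
  ...   | inj₂ refl = inj₂ (sym (proj₁ (big (+ k) q)) , subst₂ _<_ (sym e) (sym (proj₂ (big (+ k) q))) lt)
  below : ∀ {b k} → n ℕ.≤ k → idx b ℕ.< n → -[1+ k ] < b → Lex p j -[1+ k ] b
  below {b} {k} q s lt with p b | small b s
  ... | + m | _ = inj₁ (subst (_< _) (sym (proj₁ (big -[1+ k ] q))) -<+)
  ... | -[1+ m ] | inj₁ r = inj₁ (subst (_< _) (sym (proj₁ (big -[1+ k ] q))) (-<- (ℕ.<-≤-trans r q)))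
  ... | -[1+ m ] | inj₂ (r , e) with ℕ.m≤n⇒m<n∨m≡n (ℕ.≤-trans r q)
  ...   | inj₁ t = inj₁ (subst (_< _) (sym (proj₁ (big -[1+ k ] q))) (-<- t))
  ...   | inj₂ refl = inj₂ (proj₁ (big -[1+ k ] q) , subst₂ _<_ (sym (proj₂ (big -[1+ k ] q))) (sym e) lt)
  bigs : ∀ {a b} → n ℕ.≤ idx a ⊎ n ℕ.≤ idx b → a < b → Lex p j a b
  bigs {a} {b} h lt with n ℕ.≤? idx a | n ℕ.≤? idx b
  ... | yes q | yes r = inj₁ (subst₂ _<_ (sym (proj₁ (big a q))) (sym (proj₁ (big b r))) lt)
  ... | no  q | no  r = case h of λ { (inj₁ s) → contradiction s q ; (inj₂ s) → contradiction s r }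
  bigs {a} {+ k} h lt | no q | yes r = above r (ℕ.≰⇒> q) lt
  bigs { -[1+ m ]} { -[1+ k ]} h (-<- lt) | no q | yes r = contradiction (ℕ.≤-trans r (ℕ.<⇒≤ lt)) q
  bigs { -[1+ k ]} {b} h lt | yes q | no r = below q (ℕ.≰⇒> r) lt
  bigs {+ m} {+ k} h (+<+ lt) | yes q | no r = contradiction (ℕ.≤-trans q (ℕ.<⇒≤ lt)) r

realize⁻ : ∀ {n} (R : Ord n) {a b} → a ≺⟨ proj₁ (realize R) ⟩ b → Ord._⊏_ R a b
realize⁻ R {a} {b} h with Ord.⊏-cmp R {a} {b} (λ { refl → ≺-irrefl h })
... | inj₁ r = r
... | inj₂ r = contradiction h (≺-asym (proj₂ (realize R) r))

-- A family of elements that agree except for the order J of finitely many values.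
record Family (n k : ℕ) (Adm : (Fin k → ℤ) → Set) : Set₁ where
  field
    val : Fin k → ℤ
    Out : ℤ → ℤ → Set
    el  : ∀ J → Adm J → SP n

  In : (Fin k → ℤ) → ℤ → ℤ → Set
  In J a b = ∃₂ λ s t → a ≡ val s × b ≡ val t × J s < J t

  field
    ≺-out : ∀ {J a b} (A : Adm J) → Out a b → a ≺⟨ el J A ⟩ b
    ≺-in  : ∀ {J s t} (A : Adm J) → J s < J t → val s ≺⟨ el J A ⟩ val t
    ≺-el  : ∀ {J a b} (A : Adm J) → a ≺⟨ el J A ⟩ b → Out a b ⊎ In J a b ⊎ In J (ν b) (ν a)

  Agree : (J J' : Fin k → ℤ) → Fin k → Fin k → Set
  Agree J J' s₀ t₀ = ∀ s t → J s < J t → (val s ≡ val s₀ × val t ≡ val t₀) ⊎ (val s ≡ ν (val t₀) × val t ≡ ν (val s₀)) ⊎ J' s < J' t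

  -- All other comparisons are common to the family, so ranks that disagree on one pair, up to
  -- mirror image, give inversion sets that do the same.
  family-Cov : ∀ {J J'} (A : Adm J) (A' : Adm J') s₀ t₀ → val s₀ < val t₀ → J s₀ < J t₀ → J' t₀ < J' s₀ →
    Agree J J' s₀ t₀ → Agree J' J t₀ s₀ → Cov (el J A) (el J' A') (val s₀) (val t₀)
  family-Cov {J} {J'} A A' s₀ t₀ lt l l' ag ag' = record
    { c<d = lt ; c≺d = ≺-in A l ; d≺c = ≺-in A' l' ; up = up ; down = down }
    where
    up : el J A ⊑ el J' A'
    up {a} {b} a<b h with ≺-el A h
    ... | inj₁ o = ≺-out A' o
    ... | inj₂ (inj₁ (s , t , refl , refl , q)) with ag s t q
    ...   | inj₁ (e , e') = contradiction lt (ℤ.<-asym (subst₂ _<_ e' e a<b))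
    ...   | inj₂ (inj₁ (e , e')) = contradiction lt (ℤ.<-asym (ν-anti⁻ (subst₂ _<_ e' e a<b)))
    ...   | inj₂ (inj₂ r) = ≺-in A' r
    up {a} {b} a<b h | inj₂ (inj₂ (s , t , e₁ , e₂ , q)) with ag s t q
    ...   | inj₁ (e , e') = contradiction lt (ℤ.<-asym (subst₂ _<_ (trans e₂ e') (trans e₁ e) (ν-anti a<b)))
    ...   | inj₂ (inj₁ (e , e')) = contradiction lt (ℤ.<-asym (ν-anti⁻ (subst₂ _<_ (trans e₂ e') (trans e₁ e) (ν-anti a<b))))
    ...   | inj₂ (inj₂ r) = ≺-ν⁻ (subst₂ (_≺⟨ el J' A' ⟩_) (sym e₁) (sym e₂) (≺-in A' r))
    down : ∀ {a b} → a < b → b ≺⟨ el J' A' ⟩ a → (a ≡ val s₀ × b ≡ val t₀) ⊎ (a ≡ ν (val t₀) × b ≡ ν (val s₀)) ⊎ b ≺⟨ el J A ⟩ a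
    down {a} {b} a<b h with ≺-el A' h
    ... | inj₁ o = inj₂ (inj₂ (≺-out A o))
    ... | inj₂ (inj₁ (s , t , refl , refl , q)) with ag' s t q
    ...   | inj₁ (e , e') = inj₁ (e' , e)
    ...   | inj₂ (inj₁ (e , e')) = inj₂ (inj₁ (e' , e))
    ...   | inj₂ (inj₂ r) = inj₂ (inj₂ (≺-in A r))
    down {a} {b} a<b h | inj₂ (inj₂ (s , t , e₁ , e₂ , q)) with ag' s t q
    ...   | inj₁ (e , e') = inj₂ (inj₁ (ν-fix (trans e₁ e) , ν-fix (trans e₂ e')))
    ...   | inj₂ (inj₁ (e , e')) = inj₁ (ν-injective (trans e₁ e) , ν-injective (trans e₂ e'))
    ...   | inj₂ (inj₂ r) = inj₂ (inj₂ (≺-ν⁻ (subst₂ (_≺⟨ el J A ⟩_) (sym e₁) (sym e₂) (≺-in A r))))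

-- If d and c occupy T and `nxt T`, this puts -d and -c on the same side of d, unless the two
-- positions are the central ones.
ν<-nxt : ∀ T → nxt T ≢ ν T → (ν (nxt T) < T → ν T < T) × (ν T < T → ν (nxt T) < T)
ν<-nxt (+ m) _ = (λ _ → -<+) , (λ _ → -<+)
ν<-nxt -[1+ zero ] ne = contradiction refl ne
ν<-nxt -[1+ suc m ] _ = (λ ()) , (λ ())

cov-next : ∀ {n} {y x : SP n} {c d} → Cov y x c d → P x c ≡ nxt (P x d)
cov-next {y = y} {x} {c} {d} C with nxt-≤ (P< (Cov.d≺c C))
... | inj₁ e = sym e
... | inj₂ lt = ⊥-elim (cov-adjacent {f = f} C (λ e → ℤ.<-irrefl (trans (sym Pf) (cong (P x) e)) lt)
      (λ e → ℤ.<-irrefl (trans (cong (P x) (sym e)) Pf) (i<nxt (P x d)))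
      ⟪ subst (P x d <_) (sym Pf) (i<nxt _) ⟫ ⟪ subst (_< P x c) (sym Pf) lt ⟫)
  where
  f = W x (nxt (P x d))
  Pf = P-W x (nxt (P x d))

between-small : ∀ {n a b e} → idx a ℕ.< n → idx b ℕ.< n → a < e → e < b → idx e ℕ.< n
between-small {e = + m} p q a<e (+<+ r) = ℕ.<-trans r q
between-small {e = -[1+ m ]} p q (-<- r) _ = ℕ.<-trans r p

rank : (i j k : ℕ) → Fin 3 → ℤ
rank i j k 0F = + i
rank i j k 1F = + j
rank i j k 2F = + k

DistinctRanks : ∀ {k} → (Fin k → ℤ) → Set
DistinctRanks J = ∀ s t → J s ≡ J t → s ≡ t

distinctRanks? : ∀ {k} (J : Fin k → ℤ) → Dec (DistinctRanks J)
distinctRanks? J = Fin.all? λ s → Fin.all? λ t → (J s ℤ.≟ J t) →-dec (s Fin.≟ t)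

agree? : ∀ {k} (J J' : Fin k → ℤ) (s₀ t₀ : Fin k) → Dec (∀ s t → J s < J t → (s ≡ s₀ × t ≡ t₀) ⊎ J' s < J' t)
agree? J J' s₀ t₀ = Fin.all? λ s → Fin.all? λ t →
  (J s ℤ.<? J t) →-dec (((s Fin.≟ s₀) ×-dec (t Fin.≟ t₀)) ⊎-dec (J' s ℤ.<? J' t))

-- The six orders of c < f < d; rank lists the places of c, f and d.
cfd fcd cdf fdc dcf dfc : Fin 3 → ℤ
cfd = rank 0 1 2
fcd = rank 1 0 2
cdf = rank 0 2 1
fdc = rank 2 0 1
dcf = rank 1 2 0
dfc = rank 2 1 0

-- The inequalities make c, f, d and their reflections six distinct values, so the block and its
-- mirror image can be permuted without interfering.
module HexFamily {n : ℕ} {y x : SP n} {c d f : ℤ} (C : Cov y x c d) (c≢νd : c ≢ ν d)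
  (c<f : c < f) (f<d : f < d) (f≢νc : f ≢ ν c) (f≢νd : f ≢ ν d) where

  T : ℤ
  T = P x d

  val : Fin 3 → ℤ
  val 0F          = c
  val 1F       = f
  val 2F = d

  T≢νT : T ≢ ν T
  T≢νT e = ν≢ (sym e)

  val-small : ∀ s → idx (val s) ℕ.< n
  val-small 0F = proj₁ (cov-small C)
  val-small 1F = between-small (val-small 0F) (val-small 2F) c<f f<d
  val-small 2F = proj₂ (cov-small C)

  val-injective : ∀ s t → val s ≡ val t → s ≡ t
  val-injective 0F 0F e = refl
  val-injective 0F 1F e = contradiction c<f (ℤ.<-irrefl e)
  val-injective 0F 2F e = contradiction (Cov.c<d C) (ℤ.<-irrefl e)
  val-injective 1F 0F e = contradiction c<f (ℤ.<-irrefl (sym e))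
  val-injective 1F 1F e = refl
  val-injective 1F 2F e = contradiction f<d (ℤ.<-irrefl e)
  val-injective 2F 0F e = contradiction (Cov.c<d C) (ℤ.<-irrefl (sym e))
  val-injective 2F 1F e = contradiction f<d (ℤ.<-irrefl (sym e))
  val-injective 2F 2F e = refl

  val≢ν : ∀ s t → val s ≢ ν (val t)
  val≢ν 0F 0F e = ν≢ (sym e)
  val≢ν 0F 1F e = f≢νc (sym (trans (cong ν e) (ν-involutive f)))
  val≢ν 0F 2F e = c≢νd e
  val≢ν 1F 0F e = f≢νc e
  val≢ν 1F 1F e = ν≢ (sym e)
  val≢ν 1F 2F e = f≢νd e
  val≢ν 2F 0F e = c≢νd (sym (trans (cong ν e) (ν-involutive c)))
  val≢ν 2F 1F e = f≢νd (sym (trans (cong ν e) (ν-involutive f)))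
  val≢ν 2F 2F e = ν≢ (sym e)

  Other : ℤ → Set
  Other a = ∀ s → a ≢ val s × a ≢ ν (val s)

  data Class (a : ℤ) : Set where
    blk : ∀ s → a ≡ val s → Class a
    mir : ∀ s → a ≡ ν (val s) → Class a
    oth : Other a → Class a

  classify : ∀ a → Class a
  classify a with Fin.any? (λ s → a ℤ.≟ val s) | Fin.any? (λ s → a ℤ.≟ ν (val s))
  ... | yes (s , e) | _ = blk s e
  ... | no  _ | yes (s , e) = mir s e
  ... | no  p | no q = oth λ s → (λ e → p (s , e)) , (λ e → q (s , e))

  -- The values c, f, d move together to the position of d, where they are ranked by J.
  pkey : ℤ → ℤ
  pkey a with classify a
  ... | blk _ _ = T
  ... | mir _ _ = ν T
  ... | oth _   = P x a

  jkey : (Fin 3 → ℤ) → ℤ → ℤ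
  jkey J a with classify a
  ... | blk s _ = J s
  ... | mir s _ = ν (J s)
  ... | oth _   = a

  key-blk : ∀ J {a} s → a ≡ val s → pkey a ≡ T × jkey J a ≡ J s
  key-blk J {a} s e with classify a
  ... | blk t e' = refl , cong J (val-injective t s (trans (sym e') e))
  ... | mir t e' = contradiction (trans (sym e) e') (val≢ν s t)
  ... | oth o    = contradiction e (proj₁ (o s))

  key-mir : ∀ J {a} s → a ≡ ν (val s) → pkey a ≡ ν T × jkey J a ≡ ν (J s)
  key-mir J {a} s e with classify a
  ... | blk t e' = contradiction (trans (sym e') e) (val≢ν t s)
  ... | mir t e' = refl , cong (ν ∘ J) (val-injective t s (ν-injective (trans (sym e') e)))
  ... | oth o    = contradiction e (proj₂ (o s))

  key-oth : ∀ J {a} → Other a → pkey a ≡ P x a × jkey J a ≡ a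
  key-oth J {a} o with classify a
  ... | blk t e = contradiction e (proj₁ (o t))
  ... | mir t e = contradiction e (proj₂ (o t))
  ... | oth _   = refl , refl

  other-ν : ∀ {a} → Other a → Other (ν a)
  other-ν o s = (λ e → proj₂ (o s) (ν-fix e)) , (λ e → proj₁ (o s) (ν-injective e))

  oth≢T : ∀ {a} → Other a → P x a ≢ T
  oth≢T o e = proj₁ (o 2F) (P-injective x e)

  oth≢νT : ∀ {a} → Other a → P x a ≢ ν T
  oth≢νT o e = proj₂ (o 2F) (P-injective x (trans e (sym (P-ν x d))))

  Adm : (Fin 3 → ℤ) → Set
  Adm = DistinctRanks

  ord : ∀ J → Adm J → Ord n
  ord J A = lexOrd pkey (jkey J) p-ν j-ν inj big small
    where
    p-ν : ∀ a → pkey (ν a) ≡ ν (pkey a)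
    p-ν a with classify a
    ... | blk s e = proj₁ (key-mir J s (cong ν e))
    ... | mir s e = trans (proj₁ (key-blk J s (trans (cong ν e) (ν-involutive _)))) (sym (ν-involutive T))
    ... | oth o   = trans (proj₁ (key-oth J (other-ν o))) (P-ν x a)
    j-ν : ∀ a → jkey J (ν a) ≡ ν (jkey J a)
    j-ν a with classify a
    ... | blk s e = proj₂ (key-mir J s (cong ν e))
    ... | mir s e = trans (proj₂ (key-blk J s (trans (cong ν e) (ν-involutive _)))) (sym (ν-involutive _))
    ... | oth o   = proj₂ (key-oth J (other-ν o))
    inj : ∀ {a b} → pkey a ≡ pkey b → jkey J a ≡ jkey J b → a ≡ b
    inj {a} {b} q r with classify a | classify b
    ... | blk s e | blk t e' = trans e (trans (cong val (A s t r)) (sym e'))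
    ... | blk s e | mir t e' = contradiction q T≢νT
    ... | blk s e | oth o    = contradiction (sym q) (oth≢T o)
    ... | mir s e | blk t e' = contradiction (sym q) T≢νT
    ... | mir s e | mir t e' = trans e (trans (cong (ν ∘ val) (A s t (ν-injective r))) (sym e'))
    ... | mir s e | oth o    = contradiction (sym q) (oth≢νT o)
    ... | oth o   | blk t e' = contradiction q (oth≢T o)
    ... | oth o   | mir t e' = contradiction q (oth≢νT o)
    ... | oth o   | oth o'   = r
    big : ∀ a → n ℕ.≤ idx a → pkey a ≡ a × jkey J a ≡ a
    big a q = trans (proj₁ (key-oth J o)) (P-big x a q) , proj₂ (key-oth J o)
      where
      o : Other a
      o s = (λ { refl → ℕ.<⇒≱ (val-small s) q }) ,
            (λ { refl → ℕ.<⇒≱ (val-small s) (subst (n ℕ.≤_) (idx-ν (val s)) q) })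
    small : ∀ a → idx a ℕ.< n → idx (pkey a) ℕ.< n ⊎ idx (pkey a) ℕ.≤ n × jkey J a ≡ a
    small a q with classify a
    ... | blk s e = inj₁ (P-small x d (val-small 2F))
    ... | mir s e = inj₁ (subst (ℕ._< n) (sym (idx-ν T)) (P-small x d (val-small 2F)))
    ... | oth o   = inj₁ (P-small x a q)

  family : Family n 3 Adm
  family = record
    { val = val ; Out = λ a b → pkey a < pkey b ; el = λ J A → proj₁ (realize (ord J A))
    ; ≺-out = λ {J} A o → proj₂ (realize (ord J A)) (inj₁ o)
    ; ≺-in = λ {J} {s} {t} A lt → proj₂ (realize (ord J A)) (inj₂
        (trans (proj₁ (key-blk J s refl)) (sym (proj₁ (key-blk J t refl))) ,
         subst₂ _<_ (sym (proj₂ (key-blk J s refl))) (sym (proj₂ (key-blk J t refl))) lt))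
    ; ≺-el = λ {J} {a} {b} A h → split J a b (realize⁻ (ord J A) h) }
    where
    split : ∀ J a b → Lex pkey (jkey J) a b → pkey a < pkey b ⊎
      (∃₂ λ s t → a ≡ val s × b ≡ val t × J s < J t) ⊎ (∃₂ λ s t → ν b ≡ val s × ν a ≡ val t × J s < J t)
    split J a b (inj₁ o) = inj₁ o
    split J a b (inj₂ (q , r)) with classify a | classify b
    ... | blk s e | blk t e' = inj₂ (inj₁ (s , t , e , e' , r))
    ... | blk s e | mir t e' = contradiction q T≢νT
    ... | blk s e | oth o    = contradiction (sym q) (oth≢T o)
    ... | mir s e | blk t e' = contradiction (sym q) T≢νT
    ... | mir s e | mir t e' = inj₂ (inj₂ (t , s , trans (cong ν e') (ν-involutive _) , trans (cong ν e) (ν-involutive _) , ν-anti⁻ r))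
    ... | mir s e | oth o    = contradiction (sym q) (oth≢νT o)
    ... | oth o   | blk t e' = contradiction q (oth≢T o)
    ... | oth o   | mir t e' = contradiction q (oth≢νT o)
    ... | oth o   | oth o'   = contradiction (P-injective x q) (ℤ.<⇒≢ r)

  open Family family public hiding (val)

  -- f can be moved next to d and c without changing sides of the arc unless νf also crosses the arc's range.
  Movable : Set
  Movable = c < ν f → ν f < d → (ν f ≺⟨ x ⟩ d → ν T < T) × (ν T < T → ν f ≺⟨ x ⟩ d)

  -- Values outside the two blocks do not move. Reflections of the block sit at the place of -d; for
  -- -c this is the same side by adjacency, and for -f it is what `Movable` grants.
  side : Movable → ∀ {J} (A : Adm J) {g} t → c < g → g < d → g ≢ f →
    (g ≺⟨ el J A ⟩ val t → g ≺⟨ x ⟩ d) × (g ≺⟨ x ⟩ d → g ≺⟨ el J A ⟩ val t)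
  side mov {J} A {g} t c<g g<d g≢f with classify g
  ... | blk 0F e = contradiction c<g (ℤ.<-irrefl (sym e))
  ... | blk 1F e = contradiction e g≢f
  ... | blk 2F e = contradiction g<d (ℤ.<-irrefl e)
  ... | oth o = fwd , λ p → proj₂ (realize (ord J A)) (inj₁ (subst₂ _<_ (sym (proj₁ (key-oth J o))) (sym (proj₁ (key-blk J t refl))) (P< p)))
    where
    fwd : g ≺⟨ el J A ⟩ val t → g ≺⟨ x ⟩ d
    fwd h with realize⁻ (ord J A) h
    ... | inj₁ q = ⟪ subst₂ _<_ (proj₁ (key-oth J o)) (proj₁ (key-blk J t refl)) q ⟫
    ... | inj₂ (q , _) = contradiction (trans (sym (proj₁ (key-oth J o))) (trans q (proj₁ (key-blk J t refl)))) (oth≢T o)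
  ... | mir s refl = (λ h → proj₂ (mirSide s c<g g<d) (fwd h)) ,
        λ p → proj₂ (realize (ord J A)) (inj₁ (subst₂ _<_ (sym (proj₁ (key-mir J s refl))) (sym (proj₁ (key-blk J t refl))) (proj₁ (mirSide s c<g g<d) p)))
    where
    fwd : ν (val s) ≺⟨ el J A ⟩ val t → ν T < T
    fwd h with realize⁻ (ord J A) h
    ... | inj₁ q = subst₂ _<_ (proj₁ (key-mir J s refl)) (proj₁ (key-blk J t refl)) q
    ... | inj₂ (q , _) = contradiction (trans (sym (proj₁ (key-blk J t refl))) (trans (sym q) (proj₁ (key-mir J s refl)))) T≢νT
    mirSide : ∀ s → c < ν (val s) → ν (val s) < d → (ν (val s) ≺⟨ x ⟩ d → ν T < T) × (ν T < T → ν (val s) ≺⟨ x ⟩ d)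
    mirSide 0F p q = (λ h → proj₁ N (subst (_< T) Pνc (P< h))) , λ h → ⟪ subst (_< T) (sym Pνc) (proj₂ N h) ⟫
      where
      Pνc : P x (ν c) ≡ ν (nxt T)
      Pνc = trans (P-ν x c) (cong ν (cov-next C))
      N = ν<-nxt T λ e → c≢νd (P-injective x (trans (cov-next C) (trans e (sym (P-ν x d)))))
    mirSide 1F p q = mov p q
    mirSide 2F p q = (λ h → subst (_< T) (P-ν x d) (P< h)) , λ h → ⟪ subst (_< T) (sym (P-ν x d)) h ⟫

  -- For concrete ranks the implicit arguments are settled by evaluating the decision procedures.
  edge : ∀ J J' (A : Adm J) (A' : Adm J') s₀ t₀ → val s₀ < val t₀ → {True (J s₀ ℤ.<? J t₀)} → {True (J' t₀ ℤ.<? J' s₀)} →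
    {True (agree? J J' s₀ t₀)} → {True (agree? J' J t₀ s₀)} → Cov (el J A) (el J' A') (val s₀) (val t₀)
  edge J J' A A' s₀ t₀ lt {u} {v} {w} {z} = family-Cov A A' s₀ t₀ lt (toWitness u) (toWitness v)
    (λ s t q → [ (λ { (e , e') → inj₁ (cong val e , cong val e') }) , (λ r → inj₂ (inj₂ r)) ]′ (toWitness w s t q))
    (λ s t q → [ (λ { (e , e') → inj₁ (cong val e , cong val e') }) , (λ r → inj₂ (inj₂ r)) ]′ (toWitness z s t q))

  A-cfd : Adm cfd
  A-cfd = toWitness {a? = distinctRanks? cfd} _
  A-fcd : Adm fcd
  A-fcd = toWitness {a? = distinctRanks? fcd} _
  A-cdf : Adm cdf
  A-cdf = toWitness {a? = distinctRanks? cdf} _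
  A-fdc : Adm fdc
  A-fdc = toWitness {a? = distinctRanks? fdc} _
  A-dcf : Adm dcf
  A-dcf = toWitness {a? = distinctRanks? dcf} _
  A-dfc : Adm dfc
  A-dfc = toWitness {a? = distinctRanks? dfc} _

  fcd⋖fdc : Cov (el fcd A-fcd) (el fdc A-fdc) c d
  fcd⋖fdc = edge fcd fdc A-fcd A-fdc 0F 2F (Cov.c<d C)

  cdf⋖dcf : Cov (el cdf A-cdf) (el dcf A-dcf) c d
  cdf⋖dcf = edge cdf dcf A-cdf A-dcf 0F 2F (Cov.c<d C)

  cfd⋖fcd : Cov (el cfd A-cfd) (el fcd A-fcd) c f
  cfd⋖fcd = edge cfd fcd A-cfd A-fcd 0F 1F c<f

  cfd⋖cdf : Cov (el cfd A-cfd) (el cdf A-cdf) f d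
  cfd⋖cdf = edge cfd cdf A-cfd A-cdf 1F 2F f<d

  fdc⋖dfc : Cov (el fdc A-fdc) (el dfc A-dfc) f d
  fdc⋖dfc = edge fdc dfc A-fdc A-dfc 1F 2F f<d

  dcf⋖dfc : Cov (el dcf A-dcf) (el dfc A-dfc) c f
  dcf⋖dfc = edge dcf dfc A-dcf A-dfc 0F 1F c<f

  S : ℤ → Set
  S = _≺⟨ x ⟩ d

  f-d : Movable → ∀ {J} (A : Adm J) → SidesAre (el J A) f d S
  f-d mov A {g} p q = side mov A 2F (ℤ.<-trans c<f p) q (≢-sym (ℤ.<⇒≢ p))

  c-f : Movable → ∀ {J} (A : Adm J) → SidesAre (el J A) c f S
  c-f mov A {g} p q = side mov A 1F p (ℤ.<-trans q f<d) (ℤ.<⇒≢ q)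

  -- From c f d up to d f c there are two chains, each with a middle edge labelled (c, d); f is left
  -- of one and right of the other, so its side in x selects the edge. The first or last edge of the
  -- other chain forces it by a join or a meet.
  hexagon : ∀ {Θ} → IsCongruence Θ → Movable → ArcContracted Θ f d S ⊎ ArcContracted Θ c f S → Θ x y
  hexagon {Θ} isC mov arc₀ = go (≺-cmp x {f} {d} (ℤ.<⇒≢ f<d)) arc₀
    where
    open Congruence isC
    c-d : ∀ {J} (A : Adm J) → (f ≺⟨ el J A ⟩ d → S f) × (S f → f ≺⟨ el J A ⟩ d) → SidesAre (el J A) c d S
    c-d A h {g} p q with g ℤ.≟ f
    ... | yes refl = h
    ... | no  ne   = side mov A 2F p q ne
    finish : ∀ {J J'} (A : Adm J) (A' : Adm J') → (f ≺⟨ el J' A' ⟩ d → S f) × (S f → f ≺⟨ el J' A' ⟩ d) →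
      Cov (el J A) (el J' A') c d → Θ (el J' A') (el J A) → Θ x y
    finish A A' h E r = transport C own-sides (arc E (c-d A' h) r)
    go : S f ⊎ d ≺⟨ x ⟩ f → ArcContracted Θ f d S ⊎ ArcContracted Θ c f S → Θ x y
    go (inj₁ s) a = finish A-fcd A-fdc ((λ _ → s) , λ _ → ≺-in A-fdc (+<+ z<s)) fcd⋖fdc (case a of λ
      { (inj₁ a) → joinCov fcd⋖fdc (transport cfd⋖cdf (f-d mov A-cdf) a) (Cov.up cfd⋖fcd)
          λ q r → ≺-trans (r f<d (Cov.d≺c cfd⋖cdf)) (q c<f (Cov.d≺c cfd⋖fcd))
      ; (inj₂ a) → meetCov fcd⋖fdc (transport dcf⋖dfc (c-f mov A-dfc) a) (Cov.up fdc⋖dfc)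
          λ q r → ≺-trans (⊑-contra r c<f (Cov.c≺d dcf⋖dfc)) (⊑-contra q f<d (Cov.c≺d fdc⋖dfc)) })
    go (inj₂ s) a = finish A-cdf A-dcf ((λ h → contradiction h (≺-asym (≺-in {s = 2F} {1F} A-dcf (+<+ z<s)))) ,
        λ h → contradiction h (≺-asym s)) cdf⋖dcf (case a of λ
      { (inj₁ a) → meetCov cdf⋖dcf (transport fdc⋖dfc (f-d mov A-dfc) a) (Cov.up dcf⋖dfc)
          λ q r → ≺-trans (⊑-contra q c<f (Cov.c≺d dcf⋖dfc)) (⊑-contra r f<d (Cov.c≺d fdc⋖dfc))
      ; (inj₂ a) → joinCov cdf⋖dcf (transport cfd⋖fcd (c-f mov A-fcd) a) (Cov.up cfd⋖cdf)
          λ q r → ≺-trans (q f<d (Cov.d≺c cfd⋖cdf)) (r c<f (Cov.d≺c cfd⋖fcd)) })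

  hexagon-upper : ∀ {Θ} → IsCongruence Θ → Movable → (∀ {y' x'} → Cov y' x' f d → SidesAre x' f d S → Θ x' y') → Θ x y
  hexagon-upper isC mov h = hexagon isC mov (inj₁ (arc cfd⋖cdf (f-d mov A-cdf) (h cfd⋖cdf (f-d mov A-cdf))))

  hexagon-lower : ∀ {Θ} → IsCongruence Θ → Movable → (∀ {y' x'} → Cov y' x' c f → SidesAre x' c f S → Θ x' y') → Θ x y
  hexagon-lower isC mov h = hexagon isC mov (inj₂ (arc cfd⋖fcd (c-f mov A-fcd) (h cfd⋖fcd (c-f mov A-fcd))))

-- Octagons

-- Values with equal keys are listed increasingly.
canonOrd : ∀ {n} (key : ℕ → ℤ) → (∀ k → n ℕ.≤ k → key k ≡ + k) → (∀ k → k ℕ.< n → idx (key k) ℕ.≤ n) → Ord n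
canonOrd {n} key big small = lexOrd (odd key) (λ a → a) (odd-ν key) (λ _ → refl) (λ _ e → e)
  (λ a q → bigs a q , refl) (λ a q → inj₂ (subst (ℕ._≤ n) (sym (idx-odd key a)) (small (idx a) q) , refl))
  where
  bigs : ∀ a → n ℕ.≤ idx a → odd key a ≡ a
  bigs (+ k) q = big k q
  bigs -[1+ k ] q = cong ν (big k q)

-- Positions of the values -q, -p, p, q (in this order) when p and q occupy kp and kq.
octRank : (kp kq : ℤ) → Fin 4 → ℤ
octRank kp kq 0F = ν kq
octRank kp kq 1F = ν kp
octRank kp kq 2F = kp
octRank kp kq 3F = kq

opp : Fin 4 → Fin 4
opp 0F = 3F
opp 1F = 2F
opp 2F = 1F
opp 3F = 0F

OctRanks : (Fin 4 → ℤ) → Set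
OctRanks J = (∀ s → J (opp s) ≡ ν (J s) × idx (J s) ℕ.≤ 1) × (∀ s t → J s ≡ J t → s ≡ t)

octRanks? : ∀ J → Dec (OctRanks J)
octRanks? J = Fin.all? (λ s → (J (opp s) ℤ.≟ ν (J s)) ×-dec (idx (J s) ℕ.≤? 1)) ×-dec
  Fin.all? (λ s → Fin.all? λ t → (J s ℤ.≟ J t) →-dec (s Fin.≟ t))

octAgree? : (J J' : Fin 4 → ℤ) (s₀ t₀ : Fin 4) →
  Dec (∀ s t → J s < J t → (s ≡ s₀ × t ≡ t₀) ⊎ (s ≡ opp t₀ × t ≡ opp s₀) ⊎ J' s < J' t)
octAgree? J J' s₀ t₀ = Fin.all? λ s → Fin.all? λ t →
  (J s ℤ.<? J t) →-dec (((s Fin.≟ s₀) ×-dec (t Fin.≟ t₀)) ⊎-dec ((s Fin.≟ opp t₀) ×-dec (t Fin.≟ opp s₀)) ⊎-dec (J' s ℤ.<? J' t))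

-- The eight elements of the octagon. Through the A ranks p stays before q until the last step;
-- through the B ranks q comes before p from the first step on.
jbot jA1 jA2 jA3 jtop jB1 jB2 jB3 : Fin 4 → ℤ
jbot = octRank (+ 0) (+ 1)
jA1  = octRank -[1+ 0 ] (+ 1)
jA2  = octRank -[1+ 1 ] (+ 0)
jA3  = octRank -[1+ 1 ] -[1+ 0 ]
jtop = octRank -[1+ 0 ] -[1+ 1 ]
jB1  = octRank (+ 1) (+ 0)
jB2  = octRank (+ 1) -[1+ 0 ]
jB3  = octRank (+ 0) -[1+ 1 ]

-- With inner ranks of `idx` at most 1 and outer keys of `idx` at least 2, only the sign of the
-- outer key counts; this is why outer comparisons are the same throughout the octagon.
inner<outer : ∀ {z w} → idx z ℕ.≤ 1 → 2 ℕ.≤ idx w → (z < w → + 0 < w) × (+ 0 < w → z < w)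
inner<outer {z} {+ m} p q = (λ _ → +<+ (ℕ.<-≤-trans z<s q)) , λ _ → small<+ (ℕ.≤-<-trans p q)
inner<outer {+ k} { -[1+ m ]} p q = (λ ()) , (λ ())
inner<outer { -[1+ k ]} { -[1+ m ]} p q = (λ { (-<- r) → contradiction (ℕ.≤-trans q (ℕ.≤-trans (ℕ.<⇒≤ r) p)) ℕ.1+n≰n }) , (λ ())

outer<inner : ∀ {z w} → idx z ℕ.≤ 1 → 2 ℕ.≤ idx w → (w < z → w < + 0) × (w < + 0 → w < z)
outer<inner { -[1+ k ]} { -[1+ m ]} p q = (λ _ → -<+) , λ _ → -<- (ℕ.<-≤-trans (s≤s p) q)
outer<inner {+ k} { -[1+ m ]} p q = (λ _ → -<+) , λ _ → -<+
outer<inner {+ k} {+ m} p q = (λ { (+<+ r) → contradiction (ℕ.≤-trans q (ℕ.≤-trans (ℕ.<⇒≤ r) p)) ℕ.1+n≰n }) , λ { (+<+ ()) }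
outer<inner { -[1+ k ]} {+ m} p q = (λ ()) , λ { (+<+ ()) }

sideKey : ℕ → Side → ℤ
sideKey k right = + k
sideKey k left  = -[1+ k ]

idx-sideKey : ∀ k s → idx (sideKey k s) ≡ k
idx-sideKey k left  = refl
idx-sideKey k right = refl

module OctFamily {n p q : ℕ} (p<q : p ℕ.< q) (q<n : q ℕ.< n) (dd : ℕ → Side) where

  -- Points are numbered from 1, values here from 0.
  eps : ℕ → Side
  eps k = dd (suc k)

  val : Fin 4 → ℤ
  val 0F = -[1+ q ]
  val 1F = -[1+ p ]
  val 2F = + p
  val 3F = + q

  val-opp : ∀ s → val (opp s) ≡ ν (val s)
  val-opp 0F = refl
  val-opp 1F = refl
  val-opp 2F = refl
  val-opp 3F = refl

  2≤n : 2 ℕ.≤ n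
  2≤n = ℕ.≤-trans (s≤s (ℕ.≤-trans z<s p<q)) q<n

  -- The values other than ±p, ±q lie beyond the four central positions, sorted by value on each half.
  outKey : ℕ → ℤ
  outKey k with k ℕ.<? n
  ... | yes _ = sideKey 2 (eps k)
  ... | no  _ = + k

  outKey-big : ∀ {k} → n ℕ.≤ k → outKey k ≡ + k
  outKey-big {k} r with k ℕ.<? n
  ... | yes s = contradiction s (ℕ.≤⇒≯ r)
  ... | no  _ = refl

  outKey-small : ∀ {k} → k ℕ.< n → outKey k ≡ sideKey 2 (eps k)
  outKey-small {k} r with k ℕ.<? n
  ... | yes _ = refl
  ... | no  s = contradiction r s

  2≤outKey : ∀ k → 2 ℕ.≤ idx (outKey k)
  2≤outKey k with k ℕ.<? n
  ... | yes _ = subst (2 ℕ.≤_) (sym (idx-sideKey 2 (eps k))) ℕ.≤-refl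
  ... | no  r = ℕ.≤-trans 2≤n (ℕ.≮⇒≥ r)

  key : (Fin 4 → ℤ) → ℕ → ℤ
  key J k with k ℕ.≟ p | k ℕ.≟ q
  ... | yes _ | _     = J 2F
  ... | no  _ | yes _ = J 3F
  ... | no  _ | no  _ = outKey k

  OuterIdx : ℕ → Set
  OuterIdx k = k ≢ p × k ≢ q

  key-outer : ∀ J k → OuterIdx k → key J k ≡ outKey k
  key-outer J k (np , nq) with k ℕ.≟ p | k ℕ.≟ q
  ... | yes e | _     = contradiction e np
  ... | no  _ | yes e = contradiction e nq
  ... | no  _ | no  _ = refl

  key-p : ∀ J → key J p ≡ J 2F
  key-p J with p ℕ.≟ p | p ℕ.≟ q
  ... | yes _ | _ = refl
  ... | no  r | _ = contradiction refl r

  key-q : ∀ J → key J q ≡ J 3F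
  key-q J with q ℕ.≟ p | q ℕ.≟ q
  ... | yes e | _     = contradiction p<q (ℕ.<-irrefl (sym e))
  ... | no  _ | yes _ = refl
  ... | no  _ | no  r = contradiction refl r

  data Class (a : ℤ) : Set where
    inner : ∀ s → a ≡ val s → Class a
    outer : OuterIdx (idx a) → Class a

  classify : ∀ a → Class a
  classify (+ k) with k ℕ.≟ p | k ℕ.≟ q
  ... | yes refl | _ = inner 2F refl
  ... | no _ | yes refl = inner 3F refl
  ... | no r | no s = outer (r , s)
  classify -[1+ k ] with k ℕ.≟ p | k ℕ.≟ q
  ... | yes refl | _ = inner 1F refl
  ... | no _ | yes refl = inner 0F refl
  ... | no r | no s = outer (r , s)

  inner-not-outer : ∀ s → ¬ OuterIdx (idx (val s))
  inner-not-outer 0F (_ , r) = r refl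
  inner-not-outer 1F (r , _) = r refl
  inner-not-outer 2F (r , _) = r refl
  inner-not-outer 3F (_ , r) = r refl

  okey : ℤ → ℤ
  okey = odd outKey

  pkey : (Fin 4 → ℤ) → ℤ → ℤ
  pkey J = odd (key J)

  pkey-inner : ∀ {J} → OctRanks J → ∀ s → pkey J (val s) ≡ J s
  pkey-inner {J} A 0F = trans (cong ν (key-q J)) (sym (proj₁ (proj₁ A 3F)))
  pkey-inner {J} A 1F = trans (cong ν (key-p J)) (sym (proj₁ (proj₁ A 2F)))
  pkey-inner {J} A 2F = key-p J
  pkey-inner {J} A 3F = key-q J

  pkey-outer : ∀ {J} a → OuterIdx (idx a) → pkey J a ≡ okey a
  pkey-outer {J} (+ k) o = key-outer J k o
  pkey-outer {J} -[1+ k ] o = cong ν (key-outer J k o)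

  2≤okey : ∀ a → 2 ℕ.≤ idx (okey a)
  2≤okey a = subst (2 ℕ.≤_) (sym (idx-odd outKey a)) (2≤outKey (idx a))

  ord : ∀ J → OctRanks J → Ord n
  ord J A = canonOrd (key J) big small
    where
    big : ∀ k → n ℕ.≤ k → key J k ≡ + k
    big k r with k ℕ.≟ p | k ℕ.≟ q
    ... | yes refl | _ = contradiction (ℕ.<-trans p<q q<n) (ℕ.≤⇒≯ r)
    ... | no  _ | yes refl = contradiction q<n (ℕ.≤⇒≯ r)
    ... | no  _ | no  _ = outKey-big r
    small : ∀ k → k ℕ.< n → idx (key J k) ℕ.≤ n
    small k r with k ℕ.≟ p | k ℕ.≟ q
    ... | yes _ | _ = ℕ.≤-trans (proj₂ (proj₁ A 2F)) (ℕ.≤-trans z<s 2≤n)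
    ... | no  _ | yes _ = ℕ.≤-trans (proj₂ (proj₁ A 3F)) (ℕ.≤-trans z<s 2≤n)
    ... | no  _ | no  _ = subst (λ z → idx z ℕ.≤ n) (sym (outKey-small r)) (subst (ℕ._≤ n) (sym (idx-sideKey 2 (eps k))) 2≤n)

  data Out (a b : ℤ) : Set where
    out-in  : OuterIdx (idx a) → ∀ t → b ≡ val t → okey a < + 0 → Out a b
    in-out  : ∀ s → a ≡ val s → OuterIdx (idx b) → + 0 < okey b → Out a b
    out-out : OuterIdx (idx a) → OuterIdx (idx b) → Lex okey (λ a → a) a b → Out a b

  family : Family n 4 OctRanks
  family = record
    { val = val ; Out = Out ; el = λ J A → proj₁ (realize (ord J A))
    ; ≺-out = λ {J} A o → proj₂ (realize (ord J A)) (lex A o)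
    ; ≺-in = λ {J} {s} {t} A lt → proj₂ (realize (ord J A))
        (inj₁ (subst₂ _<_ (sym (pkey-inner A s)) (sym (pkey-inner A t)) lt))
    ; ≺-el = λ {J} {a} {b} A h → split A (classify a) (classify b) (realize⁻ (ord J A) h) }
    where
    lex : ∀ {J a b} (A : OctRanks J) → Out a b → Lex (pkey J) (λ a → a) a b
    lex {J} {a} A (out-in o t refl h) = inj₁ (subst₂ _<_ (sym (pkey-outer a o)) (sym (pkey-inner A t))
      (proj₂ (outer<inner (proj₂ (proj₁ A t)) (2≤okey a)) h))
    lex {J} {a} {b} A (in-out s refl o h) = inj₁ (subst₂ _<_ (sym (pkey-inner A s)) (sym (pkey-outer b o))
      (proj₂ (inner<outer (proj₂ (proj₁ A s)) (2≤okey b)) h))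
    lex {J} {a} {b} A (out-out o o' (inj₁ h)) = inj₁ (subst₂ _<_ (sym (pkey-outer a o)) (sym (pkey-outer b o')) h)
    lex {J} {a} {b} A (out-out o o' (inj₂ (e , h))) = inj₂ (trans (pkey-outer a o) (trans e (sym (pkey-outer b o'))) , h)
    split : ∀ {J a b} (A : OctRanks J) → Class a → Class b → Lex (pkey J) (λ a → a) a b →
      Out a b ⊎ (∃₂ λ s t → a ≡ val s × b ≡ val t × J s < J t) ⊎ (∃₂ λ s t → ν b ≡ val s × ν a ≡ val t × J s < J t)
    split A (inner s refl) (inner t refl) (inj₁ h) = inj₂ (inj₁ (s , t , refl , refl , subst₂ _<_ (pkey-inner A s) (pkey-inner A t) h))
    split A (inner s refl) (inner t refl) (inj₂ (e , h)) =
      contradiction h (ℤ.<-irrefl (cong val (proj₂ A s t (trans (sym (pkey-inner A s)) (trans e (pkey-inner A t))))))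
    split {J} {a} {b} A (inner s refl) (outer o) (inj₁ h) = inj₁ (in-out s refl o
      (proj₁ (inner<outer (proj₂ (proj₁ A s)) (2≤okey b)) (subst₂ _<_ (pkey-inner A s) (pkey-outer b o) h)))
    split {J} {a} {b} A (inner s refl) (outer o) (inj₂ (e , _)) = contradiction (subst (2 ℕ.≤_)
      (cong idx (trans (sym (pkey-outer b o)) (trans (sym e) (pkey-inner A s)))) (2≤okey b)) (ℕ.<⇒≱ (s≤s (proj₂ (proj₁ A s))))
    split {J} {a} {b} A (outer o) (inner t refl) (inj₁ h) = inj₁ (out-in o t refl
      (proj₁ (outer<inner (proj₂ (proj₁ A t)) (2≤okey a)) (subst₂ _<_ (pkey-outer a o) (pkey-inner A t) h)))
    split {J} {a} {b} A (outer o) (inner t refl) (inj₂ (e , _)) = contradiction (subst (2 ℕ.≤_)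
      (cong idx (trans (sym (pkey-outer a o)) (trans e (pkey-inner A t)))) (2≤okey a)) (ℕ.<⇒≱ (s≤s (proj₂ (proj₁ A t))))
    split {J} {a} {b} A (outer o) (outer o') (inj₁ h) = inj₁ (out-out o o' (inj₁ (subst₂ _<_ (pkey-outer a o) (pkey-outer b o') h)))
    split {J} {a} {b} A (outer o) (outer o') (inj₂ (e , h)) =
      inj₁ (out-out o o' (inj₂ (trans (sym (pkey-outer a o)) (trans e (pkey-outer b o')) , h)))

  open Family family public hiding (val; Out)

  epsZ : ℤ → Side
  epsZ = extend dd

  okey-side : ∀ a → idx a ℕ.< n → (okey a < + 0 → epsZ a ≡ left) × (epsZ a ≡ left → okey a < + 0)
  okey-side (+ k) r = subst (λ z → (z < + 0 → eps k ≡ left) × (eps k ≡ left → z < + 0)) (sym (outKey-small r)) (by (eps k))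
    where
    by : ∀ s → (sideKey 2 s < + 0 → s ≡ left) × (s ≡ left → sideKey 2 s < + 0)
    by left  = (λ _ → refl) , λ _ → -<+
    by right = (λ { (+<+ ()) }) , λ ()
  okey-side -[1+ k ] r = subst (λ z → (ν z < + 0 → flipSide (eps k) ≡ left) × (flipSide (eps k) ≡ left → ν z < + 0)) (sym (outKey-small r)) (by (eps k))
    where
    by : ∀ s → (ν (sideKey 2 s) < + 0 → flipSide s ≡ left) × (flipSide s ≡ left → ν (sideKey 2 s) < + 0)
    by left  = (λ { (+<+ ()) }) , λ ()
    by right = (λ _ → refl) , λ _ → -<+

  outer-side : ∀ {J a} (A : OctRanks J) t → OuterIdx (idx a) → idx a ℕ.< n →
    (a ≺⟨ el J A ⟩ val t → epsZ a ≡ left) × (epsZ a ≡ left → a ≺⟨ el J A ⟩ val t)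
  outer-side {J} {a} A t o r = fwd , λ e → ≺-out A (out-in o t refl (proj₂ (okey-side a r) e))
    where
    fwd : a ≺⟨ el J A ⟩ val t → epsZ a ≡ left
    fwd h with ≺-el A h
    ... | inj₁ (out-in _ _ _ z) = proj₁ (okey-side a r) z
    ... | inj₁ (in-out s refl _ _) = contradiction o (inner-not-outer s)
    ... | inj₁ (out-out _ o' _) = contradiction o' (inner-not-outer t)
    ... | inj₂ (inj₁ (s , _ , refl , _)) = contradiction o (inner-not-outer s)
    ... | inj₂ (inj₂ (_ , s , _ , e , _)) = contradiction o (λ o → inner-not-outer s
            (subst OuterIdx (trans (sym (idx-ν a)) (cong idx e)) o))

  edge : ∀ J J' (A : OctRanks J) (A' : OctRanks J') s₀ t₀ → val s₀ < val t₀ → {True (J s₀ ℤ.<? J t₀)} → {True (J' t₀ ℤ.<? J' s₀)} →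
    {True (octAgree? J J' s₀ t₀)} → {True (octAgree? J' J t₀ s₀)} → Cov (el J A) (el J' A') (val s₀) (val t₀)
  edge J J' A A' s₀ t₀ lt {u} {v} {w} {z} = family-Cov A A' s₀ t₀ lt (toWitness u) (toWitness v)
    (λ s t r → conv s t s₀ t₀ (toWitness w s t r)) (λ s t r → conv s t t₀ s₀ (toWitness z s t r))
    where
    conv : ∀ s t s₀ t₀ {X : Set} → (s ≡ s₀ × t ≡ t₀) ⊎ (s ≡ opp t₀ × t ≡ opp s₀) ⊎ X →
      (val s ≡ val s₀ × val t ≡ val t₀) ⊎ (val s ≡ ν (val t₀) × val t ≡ ν (val s₀)) ⊎ X
    conv s t s₀ t₀ (inj₁ (refl , refl)) = inj₁ (refl , refl)
    conv s t s₀ t₀ (inj₂ (inj₁ (refl , refl))) = inj₂ (inj₁ (val-opp t₀ , val-opp s₀))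
    conv s t s₀ t₀ (inj₂ (inj₂ x)) = inj₂ (inj₂ x)

  abot : OctRanks jbot
  abot = toWitness {a? = octRanks? jbot} _
  aA1 : OctRanks jA1
  aA1 = toWitness {a? = octRanks? jA1} _
  aA2 : OctRanks jA2
  aA2 = toWitness {a? = octRanks? jA2} _
  aA3 : OctRanks jA3
  aA3 = toWitness {a? = octRanks? jA3} _
  atop : OctRanks jtop
  atop = toWitness {a? = octRanks? jtop} _
  aB1 : OctRanks jB1
  aB1 = toWitness {a? = octRanks? jB1} _
  aB2 : OctRanks jB2
  aB2 = toWitness {a? = octRanks? jB2} _
  aB3 : OctRanks jB3
  aB3 = toWitness {a? = octRanks? jB3} _

  bot A1 A2 A3 top B1 B2 B3 : SP n
  bot = el jbot abot
  A1 = el jA1 aA1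
  A2 = el jA2 aA2
  A3 = el jA3 aA3
  top = el jtop atop
  B1 = el jB1 aB1
  B2 = el jB2 aB2
  B3 = el jB3 aB3

  bot-A1 : Cov bot A1 -[1+ p ] (+ p)
  bot-A1 = edge jbot jA1 abot aA1 1F 2F -<+
  A1-A2 : Cov A1 A2 -[1+ p ] (+ q)
  A1-A2 = edge jA1 jA2 aA1 aA2 1F 3F -<+
  A2-A3 : Cov A2 A3 -[1+ q ] (+ q)
  A2-A3 = edge jA2 jA3 aA2 aA3 0F 3F -<+
  A3-top : Cov A3 top (+ p) (+ q)
  A3-top = edge jA3 jtop aA3 atop 2F 3F (+<+ p<q)
  bot-B1 : Cov bot B1 (+ p) (+ q)
  bot-B1 = edge jbot jB1 abot aB1 2F 3F (+<+ p<q)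
  B1-B2 : Cov B1 B2 -[1+ q ] (+ q)
  B1-B2 = edge jB1 jB2 aB1 aB2 0F 3F -<+
  B2-B3 : Cov B2 B3 -[1+ p ] (+ q)
  B2-B3 = edge jB2 jB3 aB2 aB3 1F 3F -<+
  B3-top : Cov B3 top -[1+ p ] (+ p)
  B3-top = edge jB3 jtop aB3 atop 1F 2F -<+

  L : ℤ → Set
  L a = epsZ a ≡ left

  outer-between : ∀ {a} → idx a ≢ p → -[1+ q ] < a → a < + q → OuterIdx (idx a) × idx a ℕ.< n
  outer-between {a} ne r s = (ne , λ e → ℕ.<-irrefl e (lt a r s)) , ℕ.<-trans (lt a r s) q<n
    where
    lt : ∀ a → -[1+ q ] < a → a < + q → idx a ℕ.< q
    lt (+ k) _ (+<+ h) = h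
    lt -[1+ k ] (-<- h) _ = h

  sides-p : ∀ {J} (A : OctRanks J) → SidesAre (el J A) -[1+ p ] (+ p) L
  sides-p A {a} r s = outer-side A 2F (proj₁ o) (proj₂ o)
    where
    idx< : ∀ a → -[1+ p ] < a → a < + p → idx a ℕ.< p
    idx< (+ k) _ (+<+ h) = h
    idx< -[1+ k ] (-<- h) _ = h
    o = outer-between {a} (ℕ.<⇒≢ (idx< a r s)) (ℤ.<-trans (-<- p<q) r) (ℤ.<-trans s (+<+ p<q))
  sides-pq : ∀ {J} (A : OctRanks J) → SidesAre (el J A) (+ p) (+ q) L
  sides-pq A {+ k} (+<+ r) (+<+ s) = outer-side A 3F ((≢-sym (ℕ.<⇒≢ r)) , (ℕ.<⇒≢ s)) (ℕ.<-trans s q<n)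

  p≺q : ∀ {z : SP n} → z ⊑ A3 → + p ≺⟨ z ⟩ + q
  p≺q h = ⊑-contra h (+<+ p<q) (Cov.c≺d A3-top)

  q≺p : ∀ {z : SP n} → B1 ⊑ z → + q ≺⟨ z ⟩ + p
  q≺p h = h (+<+ p<q) (Cov.d≺c bot-B1)

  -- The bottom and top edges of the octagon carry the two small labels; contracting one of them
  -- contracts both chains of side edges.
  module _ {Θ : Rel n} (isC : IsCongruence Θ) (basic : ArcContracted Θ -[1+ p ] (+ p) L ⊎ ArcContracted Θ (+ p) (+ q) L) where
    open Congruence isC
    private
      p≺νp : ∀ {z} → A1 ⊑ z → + p ≺⟨ z ⟩ -[1+ p ]
      p≺νp h = h -<+ (Cov.d≺c bot-A1)
      νp≺p : ∀ {z} → z ⊑ B3 → -[1+ p ] ≺⟨ z ⟩ + p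
      νp≺p h = ⊑-contra h -<+ (Cov.c≺d B3-top)
      up : ∀ {u v w : SP n} {c d} → Cov u v c d → v ⊑ w → u ⊑ w
      up C h lt i = h lt (Cov.up C lt i)
      dn : ∀ {u v w : SP n} {c d} → Cov u v c d → w ⊑ u → w ⊑ v
      dn C h lt i = Cov.up C lt (h lt i)

      bases : (Θ A1 bot × Θ top B3) ⊎ (Θ B1 bot × Θ top A3)
      bases = case basic of λ
        { (inj₁ a) → inj₁ (transport bot-A1 (sides-p aA1) a , transport B3-top (sides-p atop) a)
        ; (inj₂ a) → inj₂ (transport bot-B1 (sides-pq aB1) a , transport A3-top (sides-pq atop) a) }

    Θ-A1-A2 : Θ A2 A1
    Θ-A1-A2 = case bases of λ
      { (inj₁ (_ , t)) → meetCov A1-A2 t (dn A3-top (Cov.up A2-A3)) λ h k → ≺-trans (νp≺p k) (p≺q (dn A2-A3 h))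
      ; (inj₂ (b , _)) → joinCov A1-A2 b (Cov.up bot-A1) λ h k → ≺-trans (q≺p k) (p≺νp h) }

    Θ-A2-A3 : Θ A3 A2
    Θ-A2-A3 = case bases of λ
      { (inj₁ (_ , t)) → meetCov A2-A3 t (Cov.up A3-top)
          λ h k → ≺-trans (≺-ν (p≺q h)) (≺-trans (νp≺p k) (p≺q h))
      -- An element above both has q before p, p before -p and -p before -q.
      ; (inj₂ (b , _)) → joinCov A2-A3 b (dn A1-A2 (Cov.up bot-A1))
          λ h k → ≺-trans (q≺p k) (≺-trans (p≺νp (up A1-A2 h)) (≺-ν (q≺p k))) }

    Θ-B1-B2 : Θ B2 B1
    Θ-B1-B2 = case bases of λ
      { (inj₁ (b , _)) → joinCov B1-B2 b (Cov.up bot-B1)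
          λ h k → ≺-trans (q≺p h) (≺-trans (p≺νp k) (≺-ν (q≺p h)))
      ; (inj₂ (_ , t)) → meetCov B1-B2 t (up B2-B3 (Cov.up B3-top))
          λ h k → ≺-trans (≺-ν (p≺q k)) (≺-trans (νp≺p (dn B2-B3 h)) (p≺q k)) }

    Θ-B2-B3 : Θ B3 B2
    Θ-B2-B3 = case bases of λ
      { (inj₁ (b , _)) → joinCov B2-B3 b (dn B1-B2 (Cov.up bot-B1))
          λ h k → ≺-trans (q≺p (up B1-B2 h)) (p≺νp k)
      ; (inj₂ (_ , t)) → meetCov B2-B3 t (Cov.up B3-top) λ h k → ≺-trans (νp≺p h) (p≺q k) }

    OuterSides : SP n → ℤ → Set
    OuterSides x c = ∀ {f} → c < f → f < + q → idx f ≢ p → (f ≺⟨ x ⟩ + q → L f) × (L f → f ≺⟨ x ⟩ + q)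

    -- Each chain of the octagon has one edge with this label, and p lies on opposite sides of the
    -- two; the side of p in x chooses the chain.
    octagon-νpq : ∀ {y x} → Cov y x -[1+ p ] (+ q) → OuterSides x -[1+ p ] → Θ x y
    octagon-νpq {y} {x} C out = go (≺-cmp x {+ p} {+ q} (ℤ.<⇒≢ (+<+ p<q)))
      where
      sides : ∀ {J} (A : OctRanks J) → (+ p ≺⟨ el J A ⟩ + q → + p ≺⟨ x ⟩ + q) × (+ p ≺⟨ x ⟩ + q → + p ≺⟨ el J A ⟩ + q) →
        SidesAre (el J A) -[1+ p ] (+ q) (_≺⟨ x ⟩ + q)
      sides A h {f} r s with idx f ℕ.≟ p
      sides A h {+ _} r s | yes refl = h
      sides A h { -[1+ _ ]} r s | yes refl = contradiction r (ℤ.<-irrefl refl)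
      ... | no ne = (λ z → proj₂ (out r s ne) (proj₁ o z)) , (λ z → proj₂ o (proj₁ (out r s ne) z))
        where
        b = outer-between ne (ℤ.<-trans (-<- p<q) r) s
        o = outer-side A 3F (proj₁ b) (proj₂ b)
      go : + p ≺⟨ x ⟩ + q ⊎ + q ≺⟨ x ⟩ + p → Θ x y
      go (inj₁ l) = transport C own-sides
        (arc A1-A2 (sides aA2 ((λ _ → l) , λ _ → p≺q (Cov.up A2-A3))) Θ-A1-A2)
      go (inj₂ r) = transport C own-sides
        (arc B2-B3 (sides aB3 ((λ z → contradiction z (≺-asym (q≺p (up B1-B2 (Cov.up B2-B3))))) ,
                               λ z → contradiction z (≺-asym r))) Θ-B2-B3)

    -- Here p and -p both lie inside the label, but adjacency of q and -q puts them on opposite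
    -- sides, so the side of p still decides.
    octagon-νqq : ∀ {y x} → Cov y x -[1+ q ] (+ q) → OuterSides x -[1+ q ] → Θ x y
    octagon-νqq {y} {x} C out = go (≺-cmp x {+ p} {+ q} (ℤ.<⇒≢ (+<+ p<q)))
      where
      sides : ∀ {J} (A : OctRanks J) → (+ p ≺⟨ el J A ⟩ + q → + p ≺⟨ x ⟩ + q) × (+ p ≺⟨ x ⟩ + q → + p ≺⟨ el J A ⟩ + q) →
        (-[1+ p ] ≺⟨ el J A ⟩ + q → -[1+ p ] ≺⟨ x ⟩ + q) × (-[1+ p ] ≺⟨ x ⟩ + q → -[1+ p ] ≺⟨ el J A ⟩ + q) →
        SidesAre (el J A) -[1+ q ] (+ q) (_≺⟨ x ⟩ + q)
      sides A h h' {f} r s with idx f ℕ.≟ p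
      sides A h h' {+ _} r s | yes refl = h
      sides A h h' { -[1+ _ ]} r s | yes refl = h'
      ... | no ne = (λ z → proj₂ (out r s ne) (proj₁ o z)) , (λ z → proj₂ o (proj₁ (out r s ne) z))
        where
        b = outer-between ne r s
        o = outer-side A 3F (proj₁ b) (proj₂ b)
      νp-side : ∀ {u v} → Cov u v -[1+ q ] (+ q) → + p ≺⟨ v ⟩ + q → + q ≺⟨ v ⟩ -[1+ p ]
      νp-side C l = ≺-trans (Cov.d≺c C) (≺-ν l)
      νp-side' : ∀ {u v} → Cov u v -[1+ q ] (+ q) → + q ≺⟨ v ⟩ + p → -[1+ p ] ≺⟨ v ⟩ + q
      νp-side' {u} {v} C l with ≺-cmp v { -[1+ p ]} {+ q} (λ ())
      ... | inj₁ r = r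
      ... | inj₂ r = ⊥-elim (cov-adjacent C (≢-sym (ℤ.<⇒≢ (-<- p<q))) (λ ()) r (≺-ν l))
      go : + p ≺⟨ x ⟩ + q ⊎ + q ≺⟨ x ⟩ + p → Θ x y
      go (inj₁ l) = transport C own-sides
        (arc A2-A3 (sides aA3 ((λ _ → l) , λ _ → lA3)
          ((λ z → contradiction z (≺-asym (νp-side A2-A3 lA3))) , (λ z → contradiction z (≺-asym (νp-side C l))))) Θ-A2-A3)
        where
        lA3 = p≺q {A3} (λ _ i → i)
      go (inj₂ r) = transport C own-sides
        (arc B1-B2 (sides aB2 ((λ z → contradiction z (≺-asym rB2)) , λ z → contradiction z (≺-asym r))
          ((λ _ → νp-side' C r) , λ _ → νp-side' B1-B2 rB2)) Θ-B1-B2)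
        where
        rB2 = q≺p {B2} (Cov.up B1-B2)

  -- With outer values placed as `dd` prescribes, octagon edges are ready-made designated covers;
  -- the chain to take them from depends on the side of p.
  designated-A2 : eps p ≡ left → SidesAre A2 -[1+ p ] (+ q) L
  designated-A2 l {f} r s with idx f ℕ.≟ p
  designated-A2 l {+ _} r s | yes refl = (λ _ → l) , λ _ → p≺q (Cov.up A2-A3)
  designated-A2 l { -[1+ _ ]} r s | yes refl = contradiction r (ℤ.<-irrefl refl)
  ... | no ne = outer-side aA2 3F (proj₁ o) (proj₂ o)
    where o = outer-between ne (ℤ.<-trans (-<- p<q) r) s

  designated-B3 : eps p ≡ right → SidesAre B3 -[1+ p ] (+ q) L
  designated-B3 e {f} r s with idx f ℕ.≟ p
  designated-B3 e {+ _} r s | yes refl =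
    (λ z → contradiction z (≺-asym (q≺p (⊑-trans (Cov.up B1-B2) (Cov.up B2-B3))))) , λ z → case trans (sym e) z of λ ()
  designated-B3 e { -[1+ _ ]} r s | yes refl = contradiction r (ℤ.<-irrefl refl)
  ... | no ne = outer-side aB3 3F (proj₁ o) (proj₂ o)
    where o = outer-between ne (ℤ.<-trans (-<- p<q) r) s

  designated-A3 : eps p ≡ left → SidesAre A3 -[1+ q ] (+ q) L
  designated-A3 l {f} r s with idx f ℕ.≟ p
  designated-A3 l {+ _} r s | yes refl = (λ _ → l) , λ _ → p≺q (λ _ i → i)
  designated-A3 l { -[1+ _ ]} r s | yes refl =
    (λ z → contradiction z (≺-asym (≺-trans (Cov.d≺c A2-A3) (≺-ν (p≺q (λ _ i → i)))))) , λ z → case trans (sym (cong flipSide l)) z of λ ()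
  ... | no ne = outer-side aA3 3F (proj₁ o) (proj₂ o)
    where o = outer-between ne r s

  designated-B2 : eps p ≡ right → SidesAre B2 -[1+ q ] (+ q) L
  designated-B2 e {f} r s with idx f ℕ.≟ p
  designated-B2 e {+ _} r s | yes refl =
    (λ z → contradiction z (≺-asym (q≺p (Cov.up B1-B2)))) , λ z → case trans (sym e) z of λ ()
  designated-B2 e { -[1+ _ ]} r s | yes refl = (λ _ → cong flipSide e) , λ _ → νp≺q
    where
    νp≺q : -[1+ p ] ≺⟨ B2 ⟩ + q
    νp≺q = Cov.c≺d B2-B3
  ... | no ne = outer-side aB2 3F (proj₁ o) (proj₂ o)
    where o = outer-between ne r s

-- The generators

mkWord-isSignedPerm : ∀ {n} (f : ℕ → ℤ) (g h : ℕ → ℕ) →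
  (∀ {k} → k ℕ.< n → ∣ f (suc k) ∣ ≡ suc (g k) × g k ℕ.< n × h (g k) ≡ k) → IsSignedPerm (mkWord n f)
mkWord-isSignedPerm {n} f g h H = getPerm⇒isSignedPerm (mkWord n f)
  ((λ {m} p → subst (λ z → 1 ℕ.≤ z × z ℕ.≤ n) (sym (abs p)) (z<s , proj₁ (proj₂ (H p)))) ,
   (λ {m} {m'} p q e → trans (sym (proj₂ (proj₂ (H p)))) (trans (cong h (ℕ.suc-injective
      (trans (sym (abs p)) (trans e (abs q))))) (proj₂ (proj₂ (H q))))))
  where
  abs : ∀ {m} → m ℕ.< n → ∣ get (mkWord n f) m ∣ ≡ suc (g m)
  abs {m} p = trans (cong ∣_∣ (get-mkWord n f p)) (proj₁ (H p))

-- The words of s_{i-1}s_i and s_i s_{i-1} for i = m + 2, renumbered from 0: mutually inverse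
-- 3-cycles.
rotR rotL : ℕ → ℕ → ℕ
rotR zero zero = 1
rotR zero (suc zero) = 2
rotR zero (suc (suc zero)) = 0
rotR zero (suc (suc (suc k))) = suc (suc (suc k))
rotR (suc m) zero = 0
rotR (suc m) (suc k) = suc (rotR m k)
rotL zero zero = 2
rotL zero (suc zero) = 0
rotL zero (suc (suc zero)) = 1
rotL zero (suc (suc (suc k))) = suc (suc (suc k))
rotL (suc m) zero = 0
rotL (suc m) (suc k) = suc (rotL m k)

rotL-rotR : ∀ m k → rotL m (rotR m k) ≡ k
rotL-rotR zero zero = refl
rotL-rotR zero (suc zero) = refl
rotL-rotR zero (suc (suc zero)) = refl
rotL-rotR zero (suc (suc (suc k))) = refl
rotL-rotR (suc m) zero = refl
rotL-rotR (suc m) (suc k) = cong suc (rotL-rotR m k)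

rotR-rotL : ∀ m k → rotR m (rotL m k) ≡ k
rotR-rotL zero zero = refl
rotR-rotL zero (suc zero) = refl
rotR-rotL zero (suc (suc zero)) = refl
rotR-rotL zero (suc (suc (suc k))) = refl
rotR-rotL (suc m) zero = refl
rotR-rotL (suc m) (suc k) = cong suc (rotR-rotL m k)

rotR-< : ∀ {m k n} → suc (suc m) ℕ.< n → k ℕ.< n → rotR m k ℕ.< n
rotR-< {zero} {zero} p q = ℕ.<-trans (s≤s z<s) p
rotR-< {zero} {suc zero} p q = p
rotR-< {zero} {suc (suc zero)} p q = ℕ.<-trans z<s p
rotR-< {zero} {suc (suc (suc k))} p q = q
rotR-< {suc m} {zero} p q = q
rotR-< {suc m} {suc k} (s≤s p) (s≤s q) = s≤s (rotR-< p q)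

rotL-< : ∀ {m k n} → suc (suc m) ℕ.< n → k ℕ.< n → rotL m k ℕ.< n
rotL-< {zero} {zero} p q = p
rotL-< {zero} {suc zero} p q = ℕ.<-trans z<s p
rotL-< {zero} {suc (suc zero)} p q = ℕ.<-trans (s≤s z<s) p
rotL-< {zero} {suc (suc (suc k))} p q = q
rotL-< {suc m} {zero} p q = q
rotL-< {suc m} {suc k} (s≤s p) (s≤s q) = s≤s (rotL-< p q)

rotR-descent : ∀ m k → rotR m (suc k) ℕ.< rotR m k → k ≡ suc m
rotR-descent zero zero (s≤s ())
rotR-descent zero (suc zero) p = refl
rotR-descent zero (suc (suc zero)) ()
rotR-descent zero (suc (suc (suc k))) p = contradiction p (ℕ.<-asym (ℕ.n<1+n _))
rotR-descent (suc m) zero ()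
rotR-descent (suc m) (suc k) (s≤s p) = cong suc (rotR-descent m k p)

rotL-descent : ∀ m k → rotL m (suc k) ℕ.< rotL m k → k ≡ m
rotL-descent zero zero p = refl
rotL-descent zero (suc zero) ()
rotL-descent zero (suc (suc zero)) (s≤s ())
rotL-descent zero (suc (suc (suc k))) p = contradiction p (ℕ.<-asym (ℕ.n<1+n _))
rotL-descent (suc m) zero ()
rotL-descent (suc m) (suc k) (s≤s p) = cong suc (rotL-descent m k p)

rotR-m : ∀ m → rotR m m ≡ suc m × rotR m (suc m) ≡ suc (suc m) × rotR m (suc (suc m)) ≡ m
rotR-m zero = refl , refl , refl
rotR-m (suc m) with rotR-m m
... | a , b , c = cong suc a , cong suc b , cong suc c

rotL-m : ∀ m → rotL m m ≡ suc (suc m) × rotL m (suc m) ≡ m × rotL m (suc (suc m)) ≡ suc m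
rotL-m zero = refl , refl , refl
rotL-m (suc m) with rotL-m m
... | a , b , c = cong suc a , cong suc b , cong suc c

w-right-rotR : ∀ m k → w-right (suc (suc m)) (suc k) ≡ + suc (rotR m k)
w-right-rotR zero zero = refl
w-right-rotR zero (suc zero) = refl
w-right-rotR zero (suc (suc zero)) = refl
w-right-rotR zero (suc (suc (suc k))) = refl
w-right-rotR (suc m) zero = refl
-- Shifting i and the position together leaves the three tests unchanged, so the entry just grows by
-- one.
w-right-rotR (suc m) (suc k) with k ℕ.≡ᵇ m | k ℕ.≡ᵇ suc m | k ℕ.≡ᵇ suc (m ℕ.+ 1) | w-right-rotR m k
... | true  | _ | _ | e = trans (cong (ℤ.suc) e) refl
... | false | true | _ | e = cong ℤ.suc e
... | false | false | true | e = cong ℤ.suc e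
... | false | false | false | e = cong ℤ.suc e

w-left-rotL : ∀ m k → w-left (suc (suc m)) (suc k) ≡ + suc (rotL m k)
w-left-rotL zero zero = refl
w-left-rotL zero (suc zero) = refl
w-left-rotL zero (suc (suc zero)) = refl
w-left-rotL zero (suc (suc (suc k))) = refl
w-left-rotL (suc m) zero = refl
w-left-rotL (suc m) (suc k) with k ℕ.≡ᵇ m | k ℕ.≡ᵇ suc m | k ℕ.≡ᵇ suc (m ℕ.+ 1) | w-left-rotL m k
... | true  | _ | _ | e = cong ℤ.suc e
... | false | true | _ | e = cong ℤ.suc e
... | false | false | true | e = cong ℤ.suc e
... | false | false | false | e = cong ℤ.suc e

DescentOnly : (ℕ → ℤ) → ℕ → ℤ → Set
DescentOnly v n t₀ = (∀ k → suc k ℕ.< n → v (suc k) < v k → + k ≡ t₀) × (v 0 < ν (v 0) → -[1+ 0 ] ≡ t₀)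

-- `Contracts` provides some lower cover without its label; a word with only one descent leaves no
-- choice.
unique-descent : ∀ {n} {y j : SP n} t₀ → DescentOnly (wv j) n t₀ → y ⋖ j → Cov y j (W j (nxt t₀)) (W j t₀)
unique-descent {n} {y} {j} t₀ (D , D₀) y⋖j with cover⇒Cov {y = y} {j} y⋖j
... | i , C = go (P j d) refl C
  where
  c = W y i
  d = W y (nxt i)
  Wd : ∀ {t} → P j d ≡ t → W j t ≡ d
  Wd e = trans (cong (W j) (sym e)) (W-P j d)
  Wc : ∀ {t} → P j d ≡ t → W j (nxt t) ≡ c
  Wc e = trans (cong (W j) (trans (cong nxt (sym e)) (sym (cov-next C)))) (W-P j c)
  desc : ∀ {t} → P j d ≡ t → W j (nxt t) < W j t
  desc e = subst₂ _<_ (sym (Wc e)) (sym (Wd e)) (Cov.c<d C)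
  small = cov-small C
  rewr : ∀ {t} → t ≡ t₀ → Cov y j (W j (nxt t)) (W j t) → Cov y j (W j (nxt t₀)) (W j t₀)
  rewr refl C = C
  at : ∀ {t} → P j d ≡ t → Cov y j (W j (nxt t)) (W j t)
  at e = subst₂ (Cov y j) (sym (Wc e)) (sym (Wd e)) C
  go : ∀ t → P j d ≡ t → Cov y j c d → Cov y j (W j (nxt t₀)) (W j t₀)
  go (+ k) e _ = rewr (D k (subst (ℕ._< n) (cong idx (trans (cov-next C) (cong nxt e))) (P-small j c (proj₁ small))) (desc e)) (at e)
  go -[1+ zero ] e _ = rewr (D₀ (desc e)) (at e)
  go -[1+ suc k ] e _ = rewr (D k (subst (ℕ._< n) (cong idx e) (P-small j d (proj₂ small))) (ν-anti⁻ (desc e)))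
    (subst (Cov y j (W j (+ suc k))) (ν-involutive (W j (+ k)))
      (subst (λ z → Cov y j z (ν (ν (W j (+ k))))) (ν-involutive (W j (+ suc k))) (mirror (at e))))

module Generators {n : ℕ} {d : ℕ → Side} {Θ : Rel n} (gens : ∀ w → CambGen n d w → ContractsW Θ w) where

  record GenArc (w : Vec ℤ n) (c₀ d₀ : ℤ) (Q : SP n → Set) : Set where
    constructor genArc
    field
      {lower upper} : SP n
      is-word : word upper ≡ w
      covers  : lower ⋖ upper
      cov  : Cov lower upper c₀ d₀
      rel  : Θ upper lower
      good : Q upper

  private
    gen : ∀ f → CambGen n d (mkWord n f) → .(v : IsSignedPerm (mkWord n f)) → (v' : ℕ → ℤ) →
      (∀ {k} → k ℕ.< n → enc (f (suc k)) ≡ v' k) → ∀ t₀ → (2 ℕ.≤ n) → DescentOnly v' n t₀ →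
      ∃ λ j → (∀ {k} → k ℕ.< n → wv j k ≡ v' k) × word j ≡ mkWord n f × ∃ λ y → (y ⋖ j) × Cov y j (W j (nxt t₀)) (W j t₀) × Θ j y
    gen f g v v' e t₀ 2≤n (D , D₀) with gens (mkWord n f) g (sp (mkWord n f) v) refl
    ... | y , y⋖j , r = sp (mkWord n f) v , wv-eq , refl , y , y⋖j , unique-descent {y = y} {j} t₀ (D' , D₀') y⋖j , r
      where
      j = sp (mkWord n f) v
      wv-eq : ∀ {k} → k ℕ.< n → wv j k ≡ v' k
      wv-eq p = trans (wv-in j p) (trans (cong enc (get-mkWord n f p)) (e p))
      0<n : 0 ℕ.< n
      0<n = ℕ.<-trans z<s 2≤n
      D' : ∀ k → suc k ℕ.< n → wv j (suc k) < wv j k → + k ≡ t₀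
      D' k p lt = D k p (subst₂ _<_ (wv-eq p) (wv-eq (ℕ.<-trans (ℕ.n<1+n k) p)) lt)
      D₀' : wv j 0 < ν (wv j 0) → -[1+ 0 ] ≡ t₀
      D₀' lt = D₀ (subst (λ z → z < ν z) (wv-eq 0<n) lt)

    swap-perm : ∀ f → (∀ k → ∣ f (suc k) ∣ ≡ suc (swapℕ 0 k)) → 2 ℕ.≤ n → IsSignedPerm (mkWord n f)
    swap-perm f h 2≤n = mkWord-isSignedPerm f (swapℕ 0) (swapℕ 0) λ {k} p → h k , swapℕ-< 2≤n p , swapℕ-involutive 0 k

    vs : ℤ → ℤ → ℕ → ℤ
    vs a b zero = a
    vs a b (suc zero) = b
    vs a b (suc (suc k)) = + suc (suc k)

    no-tail : ∀ {k} {X : Set} → + suc k < + k → X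
    no-tail (+<+ p) = contradiction p (ℕ.<-asym (ℕ.n<1+n _))

  -- The right point i = m + 2 is the value `+ suc m` here. It stands before the descent, so the arc
  -- passes it on the wrong side.
  rightGen : ∀ {m} → suc (suc m) ℕ.< n → d (suc (suc m)) ≡ right →
    GenArc (mkWord n (w-right (suc (suc m)))) (+ m) (+ suc (suc m)) (λ x → + suc m ≺⟨ x ⟩ + suc (suc m))
  rightGen {m} p dr with gen (w-right (suc (suc m))) (g-right (suc (suc m)) (s≤s z<s) p dr)
      (mkWord-isSignedPerm (w-right (suc (suc m))) (rotR m) (rotL m) λ {k} q → cong ∣_∣ (w-right-rotR m k) , rotR-< p q , rotL-rotR m k)
      (λ k → + rotR m k) (λ {k} _ → cong enc (w-right-rotR m k)) (+ suc m) (ℕ.≤-trans (s≤s z<s) p)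
      ((λ { k _ (+<+ lt) → cong +_ (rotR-descent m k lt) }) , λ ())
  ... | j , e , we , y , y⋖j , C , r = genArc we y⋖j (subst₂ (Cov y j) (trans (e p) (cong +_ (proj₂ (proj₂ (rotR-m m)))))
          (trans (e p') (cong +_ (proj₁ (proj₂ (rotR-m m))))) C) r
          ⟪ subst₂ _<_ (sym (P-unique j {i = + m} (trans (e p'') (cong +_ (proj₁ (rotR-m m))))))
                       (sym (P-unique j {i = + suc m} (trans (e p') (cong +_ (proj₁ (proj₂ (rotR-m m))))))) (+<+ (ℕ.n<1+n m)) ⟫
    where
    p' = ℕ.<-trans (ℕ.n<1+n _) p
    p'' = ℕ.<-trans (ℕ.n<1+n _) p'

  leftGen : ∀ {m} → suc (suc m) ℕ.< n → d (suc (suc m)) ≡ left →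
    GenArc (mkWord n (w-left (suc (suc m)))) (+ m) (+ suc (suc m)) (λ x → + suc (suc m) ≺⟨ x ⟩ + suc m)
  leftGen {m} p dl with gen (w-left (suc (suc m))) (g-left (suc (suc m)) (s≤s z<s) p dl)
      (mkWord-isSignedPerm (w-left (suc (suc m))) (rotL m) (rotR m) λ {k} q → cong ∣_∣ (w-left-rotL m k) , rotL-< p q , rotR-rotL m k)
      (λ k → + rotL m k) (λ {k} _ → cong enc (w-left-rotL m k)) (+ m) (ℕ.≤-trans (s≤s z<s) p)
      ((λ { k _ (+<+ lt) → cong +_ (rotL-descent m k lt) }) , λ ())
  ... | j , e , we , y , y⋖j , C , r = genArc we y⋖j (subst₂ (Cov y j) (trans (e p') (cong +_ (proj₁ (proj₂ (rotL-m m)))))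
          (trans (e p'') (cong +_ (proj₁ (rotL-m m)))) C) r
          ⟪ subst₂ _<_ (sym (P-unique j {i = + m} (trans (e p'') (cong +_ (proj₁ (rotL-m m))))))
                       (sym (P-unique j {i = + suc (suc m)} (trans (e p) (cong +_ (proj₂ (proj₂ (rotL-m m))))))) (+<+ (ℕ.<-trans (ℕ.n<1+n m) (ℕ.n<1+n _))) ⟫
    where
    p' = ℕ.<-trans (ℕ.n<1+n _) p
    p'' = ℕ.<-trans (ℕ.n<1+n _) p'

  module _ (2≤n : 2 ℕ.≤ n) where
    private
      0<n : 0 ℕ.< n
      0<n = ℕ.<-trans z<s 2≤n

    s0s1 : d 1 ≡ right → GenArc (mkWord n w-s0s1) -[1+ 0 ] (+ 1) (λ x → + 0 ≺⟨ x ⟩ + 1)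
    s0s1 dr with gen w-s0s1 (g-s0s1 dr) (swap-perm w-s0s1 (λ { zero → refl ; (suc zero) → refl ; (suc (suc k)) → refl }) 2≤n)
        (vs (+ 1) -[1+ 0 ]) (λ { {zero} _ → refl ; {suc zero} _ → refl ; {suc (suc k)} _ → refl }) (+ 0) 2≤n
        ((λ { zero _ _ → refl ; (suc zero) _ () ; (suc (suc k)) _ lt → no-tail lt }) , λ ())
    ... | j , e , we , y , y⋖j , C , r = genArc we y⋖j (subst₂ (Cov y j) (e 2≤n) (e 0<n) C) r
            ⟪ subst₂ _<_ (sym (P-unique j {i = -[1+ 1 ]} (cong ν (e 2≤n)))) (sym (P-unique j {i = + 0} (e 0<n))) -<+ ⟫

    s1s0s1 : d 1 ≡ left → GenArc (mkWord n w-s1s0s1) -[1+ 0 ] (+ 1) (λ x → + 1 ≺⟨ x ⟩ + 0)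
    s1s0s1 dl with gen w-s1s0s1 (g-s1s0s1 dl)
        (mkWord-isSignedPerm w-s1s0s1 (λ k → k) (λ k → k) (λ { {zero} p → refl , p , refl ; {suc zero} p → refl , p , refl ; {suc (suc k)} p → refl , p , refl }))
        (vs (+ 0) -[1+ 1 ]) (λ { {zero} _ → refl ; {suc zero} _ → refl ; {suc (suc k)} _ → refl }) (+ 0) 2≤n
        ((λ { zero _ _ → refl ; (suc zero) _ () ; (suc (suc k)) _ lt → no-tail lt }) , λ ())
    -- In the original numbering the descent goes from 1 to -2; its mirror image, from 2 to -1, is
    -- the label shared with `s0s1`.
    ... | j , e , we , y , y⋖j , C , r = genArc we y⋖j (mirror (subst₂ (Cov y j) (e 2≤n) (e 0<n) C)) r
            ⟪ subst₂ _<_ (sym (P-unique j {i = -[1+ 1 ]} (cong ν (e 2≤n)))) (sym (P-unique j {i = + 0} (e 0<n))) -<+ ⟫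

    s0s1s0 : d 1 ≡ right → GenArc (mkWord n w-s0s1s0) -[1+ 1 ] (+ 1) (λ x → + 0 ≺⟨ x ⟩ + 1)
    s0s1s0 dr with gen w-s0s1s0 (g-s0s1s0 dr) (swap-perm w-s0s1s0 (λ { zero → refl ; (suc zero) → refl ; (suc (suc k)) → refl }) 2≤n)
        (vs -[1+ 1 ] -[1+ 0 ]) (λ { {zero} _ → refl ; {suc zero} _ → refl ; {suc (suc k)} _ → refl }) -[1+ 0 ] 2≤n
        ((λ { zero _ (-<- ()) ; (suc zero) _ () ; (suc (suc k)) _ lt → no-tail lt }) , λ _ → refl)
    ... | j , e , we , y , y⋖j , C , r = genArc we y⋖j (subst₂ (Cov y j) (e 0<n) (cong ν (e 0<n)) C) r
            ⟪ subst₂ _<_ (sym (P-unique j {i = -[1+ 1 ]} (cong ν (e 2≤n)))) (sym (P-unique j {i = -[1+ 0 ]} (cong ν (e 0<n)))) (-<- z<s) ⟫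

    s1s0 : d 1 ≡ left → GenArc (mkWord n w-s1s0) -[1+ 1 ] (+ 1) (λ x → + 1 ≺⟨ x ⟩ + 0)
    s1s0 dl with gen w-s1s0 (g-s1s0 dl) (swap-perm w-s1s0 (λ { zero → refl ; (suc zero) → refl ; (suc (suc k)) → refl }) 2≤n)
        (vs -[1+ 1 ] (+ 0)) (λ { {zero} _ → refl ; {suc zero} _ → refl ; {suc (suc k)} _ → refl }) -[1+ 0 ] 2≤n
        ((λ { zero _ () ; (suc zero) _ (+<+ ()) ; (suc (suc k)) _ lt → no-tail lt }) , λ _ → refl)
    ... | j , e , we , y , y⋖j , C , r = genArc we y⋖j (subst₂ (Cov y j) (e 0<n) (cong ν (e 0<n)) C) r
            ⟪ subst₂ _<_ (sym (P-unique j {i = -[1+ 0 ]} (cong ν (e 0<n)))) (sym (P-unique j {i = + 1} (e 2≤n))) -<+ ⟫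

-- Nondesignated arcs are contracted by Θ

module Contraction {n : ℕ} (2≤n : 2 ℕ.≤ n) {d : ℕ → Side} {Θ : Rel n} (isC : IsCongruence Θ)
  (gens : ∀ w → CambGen n d w → ContractsW Θ w) where

  open Congruence isC using (transport)
  open Generators gens

  σ : ℤ → Side
  σ = extend d

  -- The bound k is on the length of the label: forcing always goes back to shorter labels.
  Claim : ℕ → Set
  Claim k = ∀ {y x c t e} → Cov y x c t → Wrong σ x c t e → gap c t ℕ.< k → Θ x y

  misplaced-transfer : ∀ {x x' : SP n} {c c' t t' e} → e ≢ t → e ≢ t' → (e ≺⟨ x ⟩ t → e ≺⟨ x' ⟩ t') → (e ≺⟨ x' ⟩ t' → e ≺⟨ x ⟩ t) →
    Misplaced σ x c t e → Misplaced σ x' c' t' e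
  misplaced-transfer {x} {x'} {t' = t'} {e} ne ne' f g (inj₁ (l , p)) = inj₁ (l ,
    [ (λ q → contradiction (g q) (≺-asym p)) , (λ q → q) ]′ (≺-cmp x' {e} {t'} ne'))
  misplaced-transfer ne ne' f g (inj₂ (r , p)) = inj₂ (r , f p)

  -- As e differs from f, it stays strictly inside (c, f) or (f, t), and it is misplaced there as
  -- well.
  hexStep : ∀ {k y x c t e} f → Claim k → (C : Cov y x c t) → (c≢νt : c ≢ ν t) → Wrong σ x c t e →
    (c<f : c < f) (f<t : f < t) (f≢νc : f ≢ ν c) (f≢νt : f ≢ ν t) → f ≢ e →
    HexFamily.Movable C c≢νt c<f f<t f≢νc f≢νt → gap c t ℕ.< suc k → Θ x y
  hexStep {k} {y} {x} {c} {t} {e} f ih C c≢νt (c<e , e<t , w) c<f f<t f≢νc f≢νt f≢e mov (s≤s g) with ℤ.<-cmp e f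
  ... | tri≈ _ z _ = contradiction (sym z) f≢e
  ... | tri< e<f _ _ = HexFamily.hexagon-lower C c≢νt c<f f<t f≢νc f≢νt isC mov λ C' S → ih C'
        (c<e , e<f , misplaced-transfer {c = c} {c} (ℤ.<⇒≢ e<t) (ℤ.<⇒≢ e<f) (proj₂ (S c<e e<f)) (proj₁ (S c<e e<f)) w)
        (ℕ.<-≤-trans (gap-<ʳ c<f f<t) g)
  ... | tri> _ _ f<e = HexFamily.hexagon-upper C c≢νt c<f f<t f≢νc f≢νt isC mov λ C' S → ih C'
        (f<e , e<t , misplaced-transfer {c = c} {f} (ℤ.<⇒≢ e<t) (ℤ.<⇒≢ e<t) (proj₂ (S f<e e<t)) (proj₁ (S f<e e<t)) w)
        (ℕ.<-≤-trans (gap-<ˡ c<f f<t) g)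

  -- The auxiliary value is c + 1, or e + 1 if e is c + 1. None is left only for the label (c, c +
  -- 2), which is that of a generator.
  positive : ∀ {k y x c t e} → Claim k → Cov y x (+ c) (+ t) → Wrong σ x (+ c) (+ t) e → gap (+ c) (+ t) ℕ.< suc k → Θ x y
  positive {e = -[1+ _ ]} ih C (() , _)
  positive {k} {y} {x} {c} {t} {+ e} ih C w@(+<+ c<e , +<+ e<t , _) g with suc c ℕ.≟ e | suc e ℕ.≟ t
  ... | no ne | _ = hexStep (+ suc c) ih C (λ ()) w (i<nxt (+ c)) (+<+ (ℕ.≤-<-trans c<e e<t)) (λ ()) (λ ()) (λ { refl → ne refl }) (λ ()) g
  ... | yes _ | no ne = hexStep (+ suc e) ih C (λ ()) w (+<+ (ℕ.<-trans c<e (ℕ.n<1+n e))) (+<+ (ℕ.≤∧≢⇒< e<t ne)) (λ ()) (λ ())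
        (λ ()) (λ ()) g
  ... | yes refl | yes refl = base (proj₂ (proj₂ w))
    where
    t<n = proj₂ (cov-small C)
    only : ∀ {f} → + c < f → f < + suc (suc c) → f ≡ + suc c
    only {+ f} (+<+ p) (+<+ (s≤s q)) = cong +_ (ℕ.≤-antisym q p)
    sides : ∀ {x' : SP n} → (+ suc c ≺⟨ x' ⟩ + suc (suc c) → + suc c ≺⟨ x ⟩ + suc (suc c)) ×
      (+ suc c ≺⟨ x ⟩ + suc (suc c) → + suc c ≺⟨ x' ⟩ + suc (suc c)) → SidesAre x' (+ c) (+ suc (suc c)) (_≺⟨ x ⟩ + suc (suc c))
    sides h p q with only p q
    ... | refl = h
    base : Misplaced σ x (+ c) (+ suc (suc c)) (+ suc c) → Θ x y
    base (inj₁ (l , p)) = case leftGen t<n l of λ { (genArc _ _ C' r q) → transport C own-sides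
      (arc C' (sides ((λ z → contradiction z (≺-asym q)) , (λ z → contradiction z (≺-asym p)))) r) }
    base (inj₂ (l , p)) = case rightGen t<n l of λ { (genArc _ _ C' r q) → transport C own-sides
      (arc C' (sides ((λ _ → p) , (λ _ → q))) r) }

  module _ {p q : ℕ} (p<q : p ℕ.< q) where

    -- If m and q occupy the same half of x, then m is movable; if they occupy opposite halves and m
    -- < p, then -m is. For m beyond p the value -m lies outside the label, and m is movable at
    -- once.
    hexAny : ∀ {k y x e} m → Claim k → Cov y x -[1+ p ] (+ q) → Wrong σ x -[1+ p ] (+ q) e → m ℕ.< q → m ≢ p → idx e ≢ m →
      gap -[1+ p ] (+ q) ℕ.< suc k → Θ x y
    hexAny {k} {y} {x} {e} m ih C w m<q m≢p e≢m g = go (ℤ.<-cmp (ν (P x (+ q))) (P x (+ q))) (ℤ.<-cmp (ν (P x (+ m))) (P x (+ m))) (m ℕ.<? p)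
      where
      c≢νt : -[1+ p ] ≢ -[1+ q ]
      c≢νt refl = ℕ.<-irrefl refl p<q
      T = P x (+ q)
      plus : ((-[1+ p ] < -[1+ m ]) → (-[1+ m ] ≺⟨ x ⟩ + q → ν T < T) × (ν T < T → -[1+ m ] ≺⟨ x ⟩ + q)) → Θ x y
      plus mov = hexStep (+ m) ih C c≢νt w -<+ (+<+ m<q) (λ { refl → m≢p refl }) (λ ()) (λ z → e≢m (cong idx (sym z))) (λ h _ → mov h) g
      minus : m ℕ.< p → (+ m ≺⟨ x ⟩ + q → ν T < T) × (ν T < T → + m ≺⟨ x ⟩ + q) → Θ x y
      minus m<p mov = hexStep -[1+ m ] ih C c≢νt w (-<- m<p) -<+ (λ ()) (λ { refl → ℕ.<-irrefl refl m<q }) (λ z → e≢m (cong idx (sym z))) (λ _ _ → mov) g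
      neg< : ∀ {i j : ℤ} → ν i < i → j < ν j → j < i
      neg< {+ _} { -[1+ _ ]} _ _ = -<+
      neg< { -[1+ _ ]} ()
      neg< {+ _} {+ _} _ ()
      νneg : ∀ {i} → i < ν i → ν (ν i) < ν i
      νneg {i} h = subst (_< ν i) (sym (ν-involutive i)) h
      νpos : ∀ {i} → ν i < i → ν i < ν (ν i)
      νpos {i} h = subst (ν i <_) (sym (ν-involutive i)) h
      Pνm : P x -[1+ m ] ≡ ν (P x (+ m))
      Pνm = P-ν x (+ m)
      Signed : ℤ → Set
      Signed T = Tri (ν T < T) (ν T ≡ T) (T < ν T)
      go : Signed T → Signed (P x (+ m)) → Dec (m ℕ.< p) → Θ x y
      go (tri≈ _ z _) _ _ = contradiction z ν≢
      go _ (tri≈ _ z _) _ = contradiction z ν≢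
      go (tri< t _ _) (tri< u _ _) _ = plus λ _ → (λ _ → t) , λ _ → ⟪ subst (_< T) (sym Pνm) (neg< t (νpos u)) ⟫
      go (tri> ¬t _ t) (tri> _ _ u) _ = plus λ _ → (λ h → contradiction (P< h)
        (ℤ.<-asym (subst (T <_) (sym Pνm) (neg< (νneg u) t)))) , λ h → contradiction h ¬t
      go (tri< t _ _) (tri> _ _ u) (yes m<p) = minus m<p ((λ _ → t) , λ _ → ⟪ neg< t u ⟫)
      go (tri> ¬t _ t) (tri< u _ _) (yes m<p) = minus m<p ((λ h → contradiction (P< h) (ℤ.<-asym (neg< u t))) , λ h → contradiction h ¬t)
      go _ _ (no m≮p) = plus λ { (-<- h) → contradiction h m≮p }

    -- If m and -m both precede q, then -q precedes m and hence q, and likewise on the other side.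
    -- So both are movable, and one of them differs from e.
    sameSide : ∀ {k y x e} m → Claim k → Cov y x -[1+ p ] (+ q) → Wrong σ x -[1+ p ] (+ q) e → m ℕ.< p →
      (+ m ≺⟨ x ⟩ + q × -[1+ m ] ≺⟨ x ⟩ + q) ⊎ (+ q ≺⟨ x ⟩ + m × + q ≺⟨ x ⟩ -[1+ m ]) →
      gap -[1+ p ] (+ q) ℕ.< suc k → Θ x y
    sameSide {k} {y} {x} {e} m ih C w m<p same g with e ℤ.≟ + m
    ... | yes refl = hexStep -[1+ m ] ih C (λ { refl → ℕ.<-irrefl refl p<q }) w (-<- m<p) -<+ (λ ())
            (λ { refl → ℕ.<-asym m<p p<q }) (λ ()) (λ _ _ → half same (P-ν x (+ m))) g
      where
      half : ∀ {a b} → (a ≺⟨ x ⟩ + q × b ≺⟨ x ⟩ + q) ⊎ (+ q ≺⟨ x ⟩ a × + q ≺⟨ x ⟩ b) → P x b ≡ ν (P x a) →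
        (a ≺⟨ x ⟩ + q → ν (P x (+ q)) < P x (+ q)) × (ν (P x (+ q)) < P x (+ q) → a ≺⟨ x ⟩ + q)
      half (inj₁ (⟪ r ⟫ , ⟪ s ⟫)) e = (λ _ → ℤ.<-trans (ν-swapˡ (subst (_< _) e s)) r) , λ _ → ⟪ r ⟫
      half (inj₂ (⟪ r ⟫ , ⟪ s ⟫)) e = (λ h → contradiction (P< h) (ℤ.<-asym r)) ,
        λ h → contradiction h (ℤ.<-asym (ℤ.<-trans r (ν-swapʳ (subst (_ <_) e s))))
    ... | no ne = hexStep (+ m) ih C (λ { refl → ℕ.<-irrefl refl p<q }) w -<+ (+<+ (ℕ.<-trans m<p p<q))
            (λ { refl → ℕ.<-irrefl refl m<p }) (λ ()) (λ z → ne (sym z)) (λ _ _ → half same) g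
      where
      half : (+ m ≺⟨ x ⟩ + q × -[1+ m ] ≺⟨ x ⟩ + q) ⊎ (+ q ≺⟨ x ⟩ + m × + q ≺⟨ x ⟩ -[1+ m ]) →
        (-[1+ m ] ≺⟨ x ⟩ + q → ν (P x (+ q)) < P x (+ q)) × (ν (P x (+ q)) < P x (+ q) → -[1+ m ] ≺⟨ x ⟩ + q)
      half (inj₁ (⟪ r ⟫ , ⟪ s ⟫)) = (λ _ → ℤ.<-trans (ν-swapˡ (subst (_< _) (P-ν x (+ m)) s)) r) , λ _ → ⟪ s ⟫
      half (inj₂ (⟪ r ⟫ , ⟪ s ⟫)) = (λ h → contradiction h (≺-asym ⟪ s ⟫)) ,
        λ h → contradiction h (ℤ.<-asym (ℤ.<-trans r (ν-swapʳ (subst (_ <_) (P-ν x (+ m)) s))))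

    -- When every m below p is opposite to -m, the sides in x come from a designation of points;
    -- with it the octagon contains the arc, and e lies strictly inside (-p, p) or (p, q).
    octStep : ∀ {k y x e} → Claim k → Cov y x -[1+ p ] (+ q) → Wrong σ x -[1+ p ] (+ q) e → e ≢ + p →
      (∀ m → m ℕ.< p → ¬ ((+ m ≺⟨ x ⟩ + q × -[1+ m ] ≺⟨ x ⟩ + q) ⊎ (+ q ≺⟨ x ⟩ + m × + q ≺⟨ x ⟩ -[1+ m ]))) →
      gap -[1+ p ] (+ q) ℕ.< suc k → Θ x y
    octStep {k} {y} {x} {e} ih C (c<e , e<t , w) e≢p opposite (s≤s g) =
      octagon-νpq isC basic C λ {f} → out f
      where
      q<n = proj₂ (cov-small C)
      eps : ℕ → Side
      -- A default: points are numbered from 1.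
      eps zero = left
      eps (suc m) with ≺-dec x (+ m) (+ q)
      ... | yes _ = left
      ... | no  _ = right
      open OctFamily p<q q<n eps
      out : ∀ f → -[1+ p ] < f → f < + q → idx f ≢ p → (f ≺⟨ x ⟩ + q → L f) × (L f → f ≺⟨ x ⟩ + q)
      out (+ m) _ _ _ with ≺-dec x (+ m) (+ q)
      ... | yes r = (λ _ → refl) , λ _ → r
      ... | no ¬r = (λ r → contradiction r ¬r) , λ ()
      out -[1+ m ] (-<- m<p) _ _ with ≺-dec x (+ m) (+ q)
      ... | yes r = (λ s → contradiction (inj₁ (r , s)) (opposite m m<p)) , λ ()
      ... | no ¬r = (λ _ → refl) , λ _ → [ (λ s → s) , (λ s → contradiction (inj₂
              ([ (λ r → contradiction r ¬r) , (λ r → r) ]′ (≺-cmp x { + m} {+ q} (λ { refl → ℕ.<-asym m<p p<q })) , s)) (opposite m m<p)) ]′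
              (≺-cmp x { -[1+ m ]} {+ q} (λ ()))
      e-out : idx e ≢ p → (e ≺⟨ x ⟩ + q → L e) × (L e → e ≺⟨ x ⟩ + q)
      e-out = out e c<e e<t
      within : ∀ {e} → e ≢ + p → -[1+ p ] < e → e < + q → (idx e ≢ p × e < + p) ⊎ (idx e ≢ p × + p < e)
      within { -[1+ m ]} _ (-<- r) _ = inj₁ ((ℕ.<⇒≢ r) , -<+)
      within {+ m} ne _ _ with ℕ.<-cmp m p
      ... | tri< r _ _ = inj₁ ((ℕ.<⇒≢ r) , +<+ r)
      ... | tri≈ _ z _ = contradiction (cong +_ z) ne
      ... | tri> _ _ r = inj₂ ((≢-sym (ℕ.<⇒≢ r)) , +<+ r)
      basic : ArcContracted Θ -[1+ p ] (+ p) L ⊎ ArcContracted Θ (+ p) (+ q) L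
      basic with within e≢p c<e e<t
      ... | inj₁ (ne , e<p) = inj₁ (arc bot-A1 (sides-p aA1) (ih bot-A1 (c<e , e<p ,
              misplaced-transfer {c = -[1+ p ]} { -[1+ p ]} (ℤ.<⇒≢ e<t) (ℤ.<⇒≢ e<p)
                (λ z → proj₂ (sides-p aA1 c<e e<p) (proj₁ (e-out ne) z)) (λ z → proj₂ (e-out ne) (proj₁ (sides-p aA1 c<e e<p) z)) w)
              (ℕ.<-≤-trans (gap-<ʳ -<+ (+<+ p<q)) g)))
      ... | inj₂ (ne , p<e) = inj₂ (arc bot-B1 (sides-pq aB1) (ih bot-B1 (p<e , e<t ,
              misplaced-transfer {c = -[1+ p ]} {+ p} (ℤ.<⇒≢ e<t) (ℤ.<⇒≢ e<t)
                (λ z → proj₂ (sides-pq aB1 p<e e<t) (proj₁ (e-out ne) z)) (λ z → proj₂ (e-out ne) (proj₁ (sides-pq aB1 p<e e<t) z)) w)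
              (ℕ.<-≤-trans (gap-<ˡ -<+ (+<+ p<q)) g)))

    -- The case e = p is separate because p is an inner value of the octagon. There 0 or 1 serves as
    -- auxiliary value, except for p = 0 and q = 1, the label of a generator.
    mixed : ∀ {k y x e} → Claim k → Cov y x -[1+ p ] (+ q) → Wrong σ x -[1+ p ] (+ q) e → gap -[1+ p ] (+ q) ℕ.< suc k → Θ x y
    mixed {k} {y} {x} {e} ih C w g with e ℤ.≟ + p
    ... | no e≢p = [ (λ { (m , m<p , s) → sameSide m ih C w m<p s g }) , (λ o → octStep ih C w e≢p o g) ]′ found
      where
      Same : ℕ → Set
      Same m = (+ m ≺⟨ x ⟩ + q × -[1+ m ] ≺⟨ x ⟩ + q) ⊎ (+ q ≺⟨ x ⟩ + m × + q ≺⟨ x ⟩ -[1+ m ])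
      same? : ∀ m → Dec (Same m)
      same? m = (≺-dec x (+ m) (+ q) ×-dec ≺-dec x -[1+ m ] (+ q)) ⊎-dec (≺-dec x (+ q) (+ m) ×-dec ≺-dec x (+ q) -[1+ m ])
      found : (∃ λ m → m ℕ.< p × Same m) ⊎ (∀ m → m ℕ.< p → ¬ Same m)
      found with ℕ.anyUpTo? same? p
      ... | yes r = inj₁ r
      ... | no ¬r = inj₂ λ m m<p s → ¬r (m , m<p , s)
    ... | yes refl = small p q p<q refl refl
      where
      small : ∀ p' q' → p' ℕ.< q' → p' ≡ p → q' ≡ q → Θ x y
      small (suc _) (suc _) _ refl refl = hexAny 0 ih C w (ℕ.<-trans z<s p<q) (λ ()) (λ ()) g
      small zero (suc (suc _)) _ refl refl = hexAny 1 ih C w (s≤s z<s) (λ ()) (λ ()) g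
      small zero (suc zero) _ refl refl = base (proj₂ (proj₂ w))
        where
        only : ∀ {f} → -[1+ 0 ] < f → f < + 1 → f ≡ + 0
        only {+ zero} _ _ = refl
        only {+ suc _} _ (+<+ (s≤s ()))
        only { -[1+ _ ]} (-<- ())
        sides : ∀ {x' : SP n} → (+ 0 ≺⟨ x' ⟩ + 1 → + 0 ≺⟨ x ⟩ + 1) × (+ 0 ≺⟨ x ⟩ + 1 → + 0 ≺⟨ x' ⟩ + 1) →
          SidesAre x' -[1+ 0 ] (+ 1) (_≺⟨ x ⟩ + 1)
        sides h r s with only r s
        ... | refl = h
        base : Misplaced σ x -[1+ 0 ] (+ 1) (+ 0) → Θ x y
        base (inj₁ (l , r)) = case s1s0s1 2≤n l of λ { (genArc _ _ C' rel s) → transport C own-sides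
          (arc C' (sides ((λ z → contradiction z (≺-asym s)) , (λ z → contradiction z (≺-asym r)))) rel) }
        base (inj₂ (l , r)) = case s0s1 2≤n l of λ { (genArc _ _ C' rel s) → transport C own-sides
          (arc C' (sides ((λ _ → r) , (λ _ → s))) rel) }

  flip-opposite : ∀ {y x : SP n} {q m} → m ℕ.< q → Cov y x -[1+ q ] (+ q) →
    (+ m ≺⟨ x ⟩ + q → + q ≺⟨ x ⟩ -[1+ m ]) × (+ q ≺⟨ x ⟩ + m → -[1+ m ] ≺⟨ x ⟩ + q)
  flip-opposite {y} {x} {q} {m} m<q C = (λ l → ≺-trans (Cov.d≺c C) (≺-ν l)) , back
    where
    back : + q ≺⟨ x ⟩ + m → -[1+ m ] ≺⟨ x ⟩ + q
    back l with ≺-cmp x { -[1+ m ]} {+ q} (λ ())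
    ... | inj₁ r = r
    ... | inj₂ r = ⊥-elim (cov-adjacent C (≢-sym (ℤ.<⇒≢ (-<- m<q))) (λ ()) r (≺-ν l))

  -- A label (-q, q) puts each j opposite to -j, so the sides in x always come from a designation.
  -- As e differs from m, it lies inside (-m, m) or (m, q).
  flipOct : ∀ {k y x q e} m → Claim k → Cov y x -[1+ q ] (+ q) → Wrong σ x -[1+ q ] (+ q) (+ e) → m ℕ.< q → e ≢ m →
    gap -[1+ q ] (+ q) ℕ.< suc k → Θ x y
  flipOct {k} {y} {x} {q} {e} m ih C (c<e , +<+ e<q , w) m<q e≢m (s≤s g) = octagon-νqq isC basic C λ {f} → out f
    where
    q<n = proj₂ (cov-small C)
    eps : ℕ → Side
    eps zero = left
    eps (suc j) with ≺-dec x (+ j) (+ q)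
    ... | yes _ = left
    ... | no  _ = right
    open OctFamily m<q q<n eps
    out : ∀ f → -[1+ q ] < f → f < + q → idx f ≢ m → (f ≺⟨ x ⟩ + q → L f) × (L f → f ≺⟨ x ⟩ + q)
    out (+ j) _ _ _ with ≺-dec x (+ j) (+ q)
    ... | yes r = (λ _ → refl) , λ _ → r
    ... | no ¬r = (λ r → contradiction r ¬r) , λ ()
    out -[1+ j ] (-<- j<q) _ _ with ≺-dec x (+ j) (+ q)
    ... | yes r = (λ s → contradiction s (≺-asym (proj₁ (flip-opposite j<q C) r))) , λ ()
    ... | no ¬r = (λ _ → refl) , λ _ → proj₂ (flip-opposite j<q C)
            ([ (λ r → contradiction r ¬r) , (λ r → r) ]′ (≺-cmp x { + j} {+ q} (λ { refl → ℕ.<-irrefl refl j<q })))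
    e-out = out (+ e) c<e (+<+ e<q) e≢m
    basic : ArcContracted Θ -[1+ m ] (+ m) L ⊎ ArcContracted Θ (+ m) (+ q) L
    basic with ℕ.<-cmp e m
    ... | tri≈ _ z _ = contradiction z e≢m
    ... | tri< r _ _ = inj₁ (arc bot-A1 (sides-p aA1) (ih bot-A1 (-<+ , +<+ r ,
            misplaced-transfer {c = -[1+ q ]} { -[1+ m ]} (λ { refl → ℕ.<-irrefl refl e<q }) (λ { refl → ℕ.<-irrefl refl r })
              (λ z → proj₂ (sides-p aA1 -<+ (+<+ r)) (proj₁ e-out z)) (λ z → proj₂ e-out (proj₁ (sides-p aA1 -<+ (+<+ r)) z)) w)
            (ℕ.<-≤-trans (ℕ.<-trans (gap-<ʳ -<+ (+<+ m<q)) (gap-<ˡ (-<- m<q) -<+)) g)))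
    ... | tri> _ _ r = inj₂ (arc bot-B1 (sides-pq aB1) (ih bot-B1 (+<+ r , +<+ e<q ,
            misplaced-transfer {c = -[1+ q ]} {+ m} (λ { refl → ℕ.<-irrefl refl e<q }) (λ { refl → ℕ.<-irrefl refl e<q })
              (λ z → proj₂ (sides-pq aB1 (+<+ r) (+<+ e<q)) (proj₁ e-out z)) (λ z → proj₂ e-out (proj₁ (sides-pq aB1 (+<+ r) (+<+ e<q)) z)) w)
            (ℕ.<-≤-trans (gap-<ˡ -<+ (+<+ m<q)) g)))

  -- The octagon needs some m below q other than e; only q = 1 and e = 0 leaves none, and there the
  -- generators of the central flip take over.
  flipNonneg : ∀ {k y x q e} → Claim k → Cov y x -[1+ q ] (+ q) → Wrong σ x -[1+ q ] (+ q) (+ e) → gap -[1+ q ] (+ q) ℕ.< suc k → Θ x y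
  flipNonneg {q = q} {suc e} ih C w@(_ , +<+ e<q , _) g = flipOct 0 ih C w (ℕ.<-trans z<s e<q) (λ ()) g
  flipNonneg {q = suc (suc q)} {zero} ih C w g = flipOct 1 ih C w (s≤s z<s) (λ ()) g
  flipNonneg {q = zero} {zero} ih C (_ , +<+ () , _) g
  flipNonneg {y = y} {x} {q = suc zero} {zero} ih C (_ , _ , w) g = base w
    where
    sides : ∀ {y' x' : SP n} → Cov y' x' -[1+ 1 ] (+ 1) → (+ 0 ≺⟨ x' ⟩ + 1 → + 0 ≺⟨ x ⟩ + 1) × (+ 0 ≺⟨ x ⟩ + 1 → + 0 ≺⟨ x' ⟩ + 1) →
      SidesAre x' -[1+ 1 ] (+ 1) (_≺⟨ x ⟩ + 1)
    sides C' h {+ zero} _ _ = h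
    sides C' h {+ suc _} _ (+<+ (s≤s ()))
    sides C' h { -[1+ suc _ ]} (-<- (s≤s ()))
    sides {y'} {x'} C' h { -[1+ zero ]} _ _ = back C C' (proj₂ h) , back C' C (proj₁ h)
      where
      back : ∀ {u v u' v' : SP n} → Cov u v -[1+ 1 ] (+ 1) → Cov u' v' -[1+ 1 ] (+ 1) → (+ 0 ≺⟨ v ⟩ + 1 → + 0 ≺⟨ v' ⟩ + 1) →
        -[1+ 0 ] ≺⟨ v' ⟩ + 1 → -[1+ 0 ] ≺⟨ v ⟩ + 1
      back {v = v} C C' h l with ≺-cmp v {+ 0} {+ 1} (λ ())
      ... | inj₁ r = contradiction l (≺-asym (proj₁ (flip-opposite z<s C') (h r)))
      ... | inj₂ r = proj₂ (flip-opposite z<s C) r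
    base : Misplaced σ x -[1+ 1 ] (+ 1) (+ 0) → Θ x y
    base (inj₁ (l , r)) = case s1s0 2≤n l of λ { (genArc _ _ C' rel s) → transport C own-sides
      (arc C' (sides C' ((λ z → contradiction z (≺-asym s)) , (λ z → contradiction z (≺-asym r)))) rel) }
    base (inj₂ (l , r)) = case s0s1s0 2≤n l of λ { (genArc _ _ C' rel s) → transport C own-sides
      (arc C' (sides C' ((λ _ → r) , (λ _ → s))) rel) }

  wrongMirror : ∀ {y x : SP n} {c t e} → Cov y x c t → Wrong σ x c t e → Wrong σ x (ν t) (ν c) (ν e)
  wrongMirror {e = e} C w = wrong-mirror {e = e} (extend-equivariant d) C w

  step : ∀ {k} → Claim k → Claim (suc k)
  step ih {c = + c} {+ t} C w g = positive ih C w g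
  step ih {c = + c} { -[1+ t ]} C w g = case Cov.c<d C of λ ()
  step {k} ih {c = -[1+ c ]} { -[1+ t ]} C w g = positive ih (mirror C) (wrongMirror C w) (subst (ℕ._< suc k) (sym (gap-ν -[1+ c ] -[1+ t ])) g)
  step {k} ih {c = -[1+ p ]} {+ q} {e} C w g with ℕ.<-cmp p q
  ... | tri< p<q _ _ = mixed p<q ih C w g
  ... | tri> _ _ q<p = mixed q<p ih (mirror C) (wrongMirror C w) (subst (ℕ._< suc k) (sym (gap-ν -[1+ p ] (+ q))) g)
  ... | tri≈ _ refl _ = signs e w
    where
    signs : ∀ e → Wrong σ _ -[1+ p ] (+ p) e → _
    signs (+ e) w = flipNonneg ih C w g
    signs -[1+ e ] w = flipNonneg ih C (wrongMirror C w) g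

  claim : ∀ k → Claim k
  claim zero C w ()
  claim (suc k) = step (claim k)

  wrong⇒Θ : ∀ {y x c t e} → Cov y x c t → Wrong σ x c t e → Θ x y
  wrong⇒Θ {e = e} C w = claim _ {e = e} C w ℕ.≤-refl

-- Designated arcs force β_o, β_l or β_r

relabel : ∀ {n} {Θ : Rel n} {c t S S'} → ArcContracted Θ c t S → (∀ {g} → c < g → g < t → (S' g → S g) × (S g → S' g)) → ArcContracted Θ c t S'
relabel (arc C sides r) h = arc C (λ p q → (λ z → proj₂ (h p q) (proj₁ (sides p q) z)) , λ z → proj₂ (sides p q) (proj₁ (h p q) z)) r

module Upward {N : ℕ} (d : ℕ → Side) {Θ : Rel (suc N)} (isC : IsCongruence Θ) where

  open Congruence isC using (transport)

  σ : ℤ → Side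
  σ = extend d

  DC : ℤ → ℤ → Set
  DC c t = ArcContracted Θ c t (λ f → σ f ≡ left)

  N<n : N ℕ.< suc N
  N<n = ℕ.≤-refl

  Forces : ℤ → ℤ → Set
  Forces c t = ∀ {y x} → Cov y x c t → Designated σ c t x → Θ x y

  DC⇒Forces : ∀ {c t} → DC c t → Forces c t
  DC⇒Forces a C D = transport C D a

  -- An octagon supplies a designated cover labelled (c, N), and the given arc is the lower part of
  -- its hexagon at t. All values inside the label are positive, so no reflection interferes.
  raise-ordinary : ∀ {c t} → c ℕ.< t → t ℕ.≤ N → DC (+ c) (+ t) → DC (+ c) (+ N)
  raise-ordinary {c} {t} c<t t≤N a with ℕ.m≤n⇒m<n∨m≡n t≤N
  ... | inj₂ refl = a
  ... | inj₁ t<N = arc bot-B1 (sides-pq aB1) (HexFamily.hexagon bot-B1 (λ ()) (+<+ c<t) (+<+ t<N) (λ ()) (λ ()) isC (λ ())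
          (inj₂ (relabel a λ p q → sides-pq aB1 p (ℤ.<-trans q (+<+ t<N)))))
    where open OctFamily (ℕ.<-trans c<t t<N) N<n d

  ordinary⇒orbifold : ∀ {c t} → c ℕ.< t → t ℕ.≤ N → DC (+ c) (+ t) → Forces -[1+ N ] (+ N)
  ordinary⇒orbifold {c} c<t t≤N a C D = octagon-νqq isC (inj₂ (raise-ordinary c<t t≤N a)) C λ p q _ → D p q
    where open OctFamily (ℕ.<-≤-trans c<t t≤N) N<n d

  orbifold⇒orbifold : ∀ {p} → p ℕ.≤ N → DC -[1+ p ] (+ p) → Forces -[1+ N ] (+ N)
  orbifold⇒orbifold {p} p≤N a C D with ℕ.m≤n⇒m<n∨m≡n p≤N
  ... | inj₂ refl = DC⇒Forces a C D
  ... | inj₁ p<N = octagon-νqq isC (inj₁ a) C λ r s _ → D r s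
    where open OctFamily p<N N<n d

  ν≢ν : ∀ {a b} → a ℕ.< b → -[1+ a ] ≢ -[1+ b ]
  ν≢ν lt refl = ℕ.<-irrefl refl lt

  ν≮ν : ∀ {a b} → a ℕ.< b → ¬ -[1+ a ] < -[1+ b ]
  ν≮ν lt (-<- gt) = ℕ.<-asym lt gt

  module _ {p q : ℕ} (p<q : p ℕ.< q) (q≤N : q ℕ.≤ N) where

    private p<N = ℕ.<-≤-trans p<q q≤N
    open OctFamily p<N N<n d

    -- For a left point p the designated cover labelled (-p, N) is on the A chain. The hexagon at q
    -- is harmless since -q lies outside the label.
    raise-left : d (suc p) ≡ left → DC -[1+ p ] (+ q) → DC -[1+ p ] (+ N)
    raise-left l a with ℕ.m≤n⇒m<n∨m≡n q≤N
    ... | inj₂ refl = a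
    ... | inj₁ q<N = arc A1-A2 (designated-A2 l) (HexFamily.hexagon A1-A2 (ν≢ν p<N) -<+ (+<+ q<N)
            (λ { refl → ℕ.<-irrefl refl p<q }) (λ ()) isC (λ h _ → contradiction h (ν≮ν p<q))
            (inj₂ (relabel a λ r s → designated-A2 l r (ℤ.<-trans s (+<+ q<N)))))

    raise-right : d (suc p) ≡ right → DC -[1+ p ] (+ q) → DC -[1+ p ] (+ N)
    raise-right e a with ℕ.m≤n⇒m<n∨m≡n q≤N
    ... | inj₂ refl = a
    ... | inj₁ q<N = arc B2-B3 (designated-B3 e) (HexFamily.hexagon B2-B3 (ν≢ν p<N) -<+ (+<+ q<N)
            (λ { refl → ℕ.<-irrefl refl p<q }) (λ ()) isC (λ h _ → contradiction h (ν≮ν p<q))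
            (inj₂ (relabel a λ r s → designated-B3 e r (ℤ.<-trans s (+<+ q<N)))))

  -- The hexagon is taken at -p, whose reflection p also lies inside the label. It stays put because
  -- in `A2` both the left point p and -N precede N.
  lower-left : ∀ {p l} → p ℕ.≤ l → l ℕ.< N → d (suc p) ≡ left → d (suc l) ≡ left → DC -[1+ p ] (+ N) → Forces -[1+ l ] (+ N)
  lower-left {p} {l} p≤l l<N dp dl a with ℕ.m≤n⇒m<n∨m≡n p≤l
  ... | inj₂ refl = DC⇒Forces a
  ... | inj₁ p<l = DC⇒Forces (arc A1-A2 (designated-A2 dl) (HexFamily.hexagon A1-A2 (ν≢ν l<N) (-<- p<l) -<+ (λ ())
          (ν≢ν (ℕ.<-trans p<l l<N)) isC
          (λ r s → (λ _ → subst (_< P A2 (+ N)) (P-ν A2 (+ N)) (P< (Cov.c≺d A2-A3))) , λ _ → proj₂ (designated-A2 dl r s) dp)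
          (inj₁ (relabel a λ r s → designated-A2 dl (ℤ.<-trans (-<- p<l) r) s))))
    where open OctFamily l<N N<n d

  lower-right : ∀ {p l} → p ℕ.≤ l → l ℕ.< N → d (suc p) ≡ right → d (suc l) ≡ right → DC -[1+ p ] (+ N) → Forces -[1+ l ] (+ N)
  lower-right {p} {l} p≤l l<N dp dl a with ℕ.m≤n⇒m<n∨m≡n p≤l
  ... | inj₂ refl = DC⇒Forces a
  ... | inj₁ p<l = DC⇒Forces (arc B2-B3 (designated-B3 dl) (HexFamily.hexagon B2-B3 (ν≢ν l<N) (-<- p<l) -<+ (λ ())
          (ν≢ν (ℕ.<-trans p<l l<N)) isC
          (λ r s → (λ h → case trans (sym dp) (proj₁ (designated-B3 dl r s) h) of λ ()) ,
                   λ h → contradiction h (ℤ.<-asym (subst (P B3 (+ N) <_) (P-ν B3 (+ N)) (P< (Cov.up B2-B3 -<+ (Cov.d≺c B1-B2))))))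
          (inj₁ (relabel a λ r s → designated-B3 dl (ℤ.<-trans (-<- p<l) r) s))))
    where open OctFamily l<N N<n d

  mixed-left : ∀ {p q l} → p ℕ.< q → q ℕ.≤ N → p ℕ.≤ l → l ℕ.< N → d (suc p) ≡ left → d (suc l) ≡ left →
    DC -[1+ p ] (+ q) → Forces -[1+ l ] (+ N)
  mixed-left p<q q≤N p≤l l<N dp dl a = lower-left p≤l l<N dp dl (raise-left p<q q≤N dp a)

  mixed-right : ∀ {p q l} → p ℕ.< q → q ℕ.≤ N → p ℕ.≤ l → l ℕ.< N → d (suc p) ≡ right → d (suc l) ≡ right →
    DC -[1+ p ] (+ q) → Forces -[1+ l ] (+ N)
  mixed-right p<q q≤N p≤l l<N dp dl a = lower-right p≤l l<N dp dl (raise-right p<q q≤N dp a)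

-- Join-irreducible elements and their arcs

record AdjDesc {n : ℕ} (x : SP n) (c t : ℤ) : Set where
  constructor adjDesc
  field
    c<t : c < t
    t≺c : t ≺⟨ x ⟩ c
    adj : ∀ {f} → f ≢ c → f ≢ t → t ≺⟨ x ⟩ f → f ≺⟨ x ⟩ c → ⊥

Cov⇒AdjDesc : ∀ {n} {y x : SP n} {c t} → Cov y x c t → AdjDesc x c t
Cov⇒AdjDesc C = adjDesc (Cov.c<d C) (Cov.d≺c C) (cov-adjacent C)

next⇒AdjDesc : ∀ {n} {x : SP n} {c t i} → W x i ≡ t → W x (nxt i) ≡ c → c < t → AdjDesc x c t
next⇒AdjDesc {x = x} {c} {t} {i} refl refl lt = adjDesc lt ⟪ subst₂ _<_ (sym (P-W x i)) (sym (P-W x (nxt i))) (i<nxt i) ⟫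
  λ { {f} _ f≢c ⟪ p ⟫ ⟪ q ⟫ → case nxt-≤ (subst (_< P x f) (P-W x i) p) of λ
    { (inj₁ e) → ℤ.<-irrefl (sym e) (subst (P x f <_) (P-W x (nxt i)) q)
    ; (inj₂ r) → ℤ.<-asym r (subst (P x f <_) (P-W x (nxt i)) q) } }

-- Descents come in mirror pairs, so uniqueness is up to reflection.
OnlyLabel : ∀ {n} → SP n → ℤ → ℤ → Set
OnlyLabel x c t = ∀ {c' t'} → AdjDesc x c' t' → (c' ≡ c × t' ≡ t) ⊎ (c' ≡ ν t × t' ≡ ν c)

cov-lower-unique : ∀ {n} {y y' x : SP n} {c t} → Cov y x c t → Cov y' x c t → y ≡ y'
cov-lower-unique C C' = ⊑-antisym (cov-greatest C' (Cov.up C) (Cov.c≺d C)) (cov-greatest C (Cov.up C') (Cov.c≺d C'))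

lower-unique : ∀ {n} {y x : SP n} {c t} → Cov y x c t → OnlyLabel x c t → ∀ y' → y' ⋖ x → y' ≡ y
lower-unique {y = y} {x} {c} {t} C uniq y' y'⋖x = by (proj₂ (cover⇒Cov {y = y'} {x} y'⋖x))
  where
  by : ∀ {c' t'} → Cov y' x c' t' → y' ≡ y
  by C' with uniq (Cov⇒AdjDesc C')
  ... | inj₁ (refl , refl) = cov-lower-unique C' C
  ... | inj₂ (refl , refl) = cov-lower-unique (subst₂ (Cov y' x) (ν-involutive c) (ν-involutive t) (mirror C')) C

-- The first step of a chain of covers from y to x makes an inversion that y lacks, which can only
-- be the label or its mirror image; so that step already reaches x.
Cov⇒⋖ : ∀ {n} {y x : SP n} {c t} → Cov y x c t → y ⋖ x
Cov⇒⋖ {y = y} {x} {c} {t} C with ⊑⇒≤ (Cov.up C)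
... | ε = ⊥-elim (≺-asym (Cov.c≺d C) (Cov.d≺c C))
... | _◅_ {j = u} y⋖u u≤x = by (proj₂ (cover⇒Cov {y = y} {u} y⋖u))
  where
  u⊑x = ≤⇒⊑ u≤x
  by : ∀ {c' t'} → Cov y u c' t' → y ⋖ x
  by {c'} {t'} C' = subst (y ⋖_) (⊑-antisym u⊑x (cov-least C (Cov.up C') (at (Cov.down C (Cov.c<d C') (u⊑x (Cov.c<d C') (Cov.d≺c C')))))) y⋖u
    where
    at : (c' ≡ c × t' ≡ t) ⊎ (c' ≡ ν t × t' ≡ ν c) ⊎ t' ≺⟨ y ⟩ c' → t ≺⟨ u ⟩ c
    at (inj₁ (refl , refl)) = Cov.d≺c C'
    at (inj₂ (inj₁ (refl , refl))) = ≺-ν⁻ (Cov.d≺c C')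
    at (inj₂ (inj₂ r)) = ⊥-elim (≺-asym r (Cov.c≺d C'))

joinIrreducible : ∀ {n} {y x : SP n} {c t} → Cov y x c t → OnlyLabel x c t → JoinIrreducible x
joinIrreducible {y = y} C uniq = y , Cov⇒⋖ C , lower-unique C uniq

contracts⇒ : ∀ {n} {Φ : Rel n} {y x c t} → Cov y x c t → OnlyLabel x c t → Contracts Φ x → Φ x y
contracts⇒ {Φ = Φ} {y} {x} C uniq (y' , y'⋖x , r) = subst (Φ x) (lower-unique C uniq y' y'⋖x) r

module OctDescents {n p q : ℕ} (p<q : p ℕ.< q) (q<n : q ℕ.< n) (dd : ℕ → Side) where
  open OctFamily p<q q<n dd

  val-mono : ∀ s t → s Fin.< t → val s < val t
  val-mono 0F 1F _ = -<- p<q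
  val-mono 0F 2F _ = -<+
  val-mono 0F 3F _ = -<+
  val-mono 1F 2F _ = -<+
  val-mono 1F 3F _ = -<+
  val-mono 2F 3F _ = +<+ p<q
  val-mono 1F 1F (s≤s ())
  val-mono 2F 1F (s≤s ())
  val-mono 2F 2F (s≤s (s≤s ()))
  val-mono 3F 1F (s≤s ())
  val-mono 3F 2F (s≤s (s≤s ()))
  val-mono 3F 3F (s≤s (s≤s (s≤s ())))

  val-mono⁻ : ∀ s t → val s < val t → s Fin.< t
  val-mono⁻ s t lt with Fin.<-cmp s t
  ... | tri< r _ _ = r
  ... | tri≈ _ refl _ = contradiction lt (ℤ.<-irrefl refl)
  ... | tri> _ _ r = contradiction lt (ℤ.<-asym (val-mono t s r))

  module _ {J : Fin 4 → ℤ} (A : OctRanks J) where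

    x : SP n
    x = el J A

    -- This value and its reflection have the consecutive ranks `+ 0` and `-[1+ 0 ]`. Were it
    -- farther right, the value at the first position would have to fit between the two.
    inner-first : ∀ s → J s ≡ + 0 → P x (val s) ≡ + 0
    inner-first s e with P x (val s) in eq
    ... | -[1+ m ] = contradiction (subst₂ _<_ (trans (cong (P x) (val-opp s)) (trans (P-ν x (val s)) (cong ν eq))) eq
            (P< (≺-in {s = opp s} {s} A (subst₂ _<_ (sym (trans (proj₁ (proj₁ A s)) (cong ν e))) (sym e) -<+)))) (λ ())
    ... | + zero = refl
    ... | + suc m = ⊥-elim (lem (realize⁻ (ord J A) f≺s) (realize⁻ (ord J A) νs≺f))
      where
      f = W x (+ 0)
      f≺s : f ≺⟨ x ⟩ val s
      f≺s = ⟪ subst₂ _<_ (sym (P-W x (+ 0))) (sym eq) (+<+ z<s) ⟫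
      νs≺f : ν (val s) ≺⟨ x ⟩ f
      νs≺f = ⟪ subst₂ _<_ (sym (trans (P-ν x (val s)) (cong ν eq))) (sym (P-W x (+ 0))) -<+ ⟫
      ps : pkey J (val s) ≡ + 0
      ps = trans (pkey-inner A s) e
      pνs : pkey J (ν (val s)) ≡ -[1+ 0 ]
      pνs = trans (odd-ν (key J) (val s)) (cong ν ps)
      none : ∀ {z} → z < + 0 → -[1+ 0 ] < z → ⊥
      none -<+ (-<- ())
      none (+<+ ()) _
      small : ∀ {z w} → idx z ℕ.≤ 0 → Class w → pkey J w ≡ z → ∃ λ t → w ≡ val t × J t ≡ z
      small p (inner t refl) h = t , refl , trans (sym (pkey-inner A t)) h
      small {z} {w} p (outer o) h = contradiction (subst (2 ℕ.≤_) (cong idx (trans (sym (pkey-outer w o)) h)) (2≤okey w)) (ℕ.<⇒≱ (s≤s (ℕ.≤-trans p z≤n)))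
      lem : Lex (pkey J) (λ a → a) f (val s) → Lex (pkey J) (λ a → a) (ν (val s)) f → ⊥
      lem (inj₂ (h , lt)) _ with small z≤n (classify f) (trans h ps)
      ... | t , h' , h'' = ℤ.<-irrefl (trans h' (cong val (proj₂ A t s (trans h'' (sym e))))) lt
      lem (inj₁ _) (inj₂ (h , lt)) with small z≤n (classify f) (trans (sym h) pνs)
      ... | t , h' , h'' = ℤ.<-irrefl (sym (trans h' (trans (cong val (proj₂ A t (opp s) (trans h'' (sym (trans (proj₁ (proj₁ A s)) (cong ν e)))))) (val-opp s)))) lt
      lem (inj₁ h) (inj₁ h') = none (subst (pkey J f <_) ps h) (subst (_< pkey J f) pνs h')

  OnlyInner : (Fin 4 → ℤ) → Fin 4 → Fin 4 → Set
  OnlyInner J u v = ∀ s t → J s < J t → t Fin.< s →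
    (∃ λ r → J s < J r × J r < J t) ⊎ (s ≡ v × t ≡ u) ⊎ (s ≡ opp u × t ≡ opp v)

  onlyInner? : ∀ J u v → Dec (OnlyInner J u v)
  onlyInner? J u v = Fin.all? λ s → Fin.all? λ t → (J s ℤ.<? J t) →-dec ((t Fin.<? s) →-dec
    (Fin.any? (λ r → (J s ℤ.<? J r) ×-dec (J r ℤ.<? J t)) ⊎-dec
    (((s Fin.≟ v) ×-dec (t Fin.≟ u)) ⊎-dec ((s Fin.≟ opp u) ×-dec (t Fin.≟ opp v)))))

  -- The outer values are sorted on each half, so descents can only occur at the inner positions.
  onlyLabel : ∀ {J} (A : OctRanks J) u v m → OnlyInner J u v → J m ≡ + 1 →
    (∀ c → OuterIdx (idx c) → idx c ℕ.< n → epsZ c ≡ right → c < val m → ⊥) → OnlyLabel (el J A) (val u) (val v)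
  onlyLabel {J} A u v m only Jm sorted {c} {t} (adjDesc c<t t≺c adj) = go (≺-el A t≺c)
    where
    small = inverted-small (el J A) c<t t≺c
    inner≢outer : ∀ {a} r → OuterIdx (idx a) → val r ≢ a
    inner≢outer r o refl = inner-not-outer r o
    right-side : ∀ a → idx a ℕ.< n → + 0 < okey a → epsZ a ≡ right
    right-side a r h with epsZ a in e
    ... | right = refl
    ... | left  = contradiction (proj₂ (okey-side a r) e) (ℤ.<-asym h)
    top-rank : ∀ {z} → idx z ℕ.≤ 1 → z ≢ + 1 → z < + 1
    top-rank {+ zero} _ _ = +<+ z<s
    top-rank {+ suc zero} _ ne = contradiction refl ne
    top-rank {+ suc (suc _)} (s≤s ()) _
    top-rank { -[1+ _ ]} _ _ = -<+
    side-cmp : ∀ a → (okey a < + 0) ⊎ (+ 0 < okey a)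
    side-cmp a with okey a | 2≤okey a
    ... | + suc m | _ = inj₂ (+<+ z<s)
    ... | -[1+ m ] | _ = inj₁ -<+
    -- A descent from an inner to an outer value on the right must start at the last inner value
    -- `val m`, and `sorted` excludes that.
    rightmost : ∀ {c t} s → t ≡ val s → c < t → OuterIdx (idx c) → idx c ℕ.< n → + 0 < okey c →
      (∀ {f} → f ≢ c → f ≢ t → t ≺⟨ el J A ⟩ f → f ≺⟨ el J A ⟩ c → ⊥) → ⊥
    rightmost {c} s refl lt o r h adj with J s ℤ.≟ + 1
    ... | yes e = sorted c o r (right-side c r h) (subst (λ s → c < val s) (proj₂ A s m (trans e (sym Jm))) lt)
    ... | no ne = adj (inner≢outer m o) (λ e → ne (trans (sym (pkey-inner A s)) (trans (sym (cong (pkey J) e)) (trans (pkey-inner A m) Jm)))) (≺-in A (subst (J s <_) (sym Jm) (top-rank (proj₂ (proj₁ A s)) ne)))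
            (≺-out A (in-out m refl o h))
    inside : ∀ {c t} s r → t ≡ val s → c ≡ val r → c < t → J s < J r →
      (∀ {f} → f ≢ c → f ≢ t → t ≺⟨ el J A ⟩ f → f ≺⟨ el J A ⟩ c → ⊥) → (c ≡ val u × t ≡ val v) ⊎ (c ≡ ν (val v) × t ≡ ν (val u))
    inside s r refl refl lt h adj with only s r h (val-mono⁻ r s lt)
    ... | inj₁ (w , a , b) = ⊥-elim (adj (λ e → ℤ.<-irrefl (rank≡ w r e) b) (λ e → ℤ.<-irrefl (rank≡ s w (sym e)) a) (≺-in A a) (≺-in A b))
      where
      rank≡ : ∀ s t → val s ≡ val t → J s ≡ J t
      rank≡ s t e = trans (sym (pkey-inner A s)) (trans (cong (pkey J) e) (pkey-inner A t))
    ... | inj₂ (inj₁ (refl , refl)) = inj₁ (refl , refl)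
    ... | inj₂ (inj₂ (refl , refl)) = inj₂ (val-opp v , val-opp u)
    go : Out t c ⊎ In J t c ⊎ In J (ν c) (ν t) → (c ≡ val u × t ≡ val v) ⊎ (c ≡ ν (val v) × t ≡ ν (val u))
    go (inj₁ (in-out s e o h)) = ⊥-elim (rightmost s e c<t o (proj₁ small) h adj)
    go (inj₁ (out-in o s refl h)) = ⊥-elim (rightmost (opp s) (sym (val-opp s)) (ν-anti c<t)
      (subst OuterIdx (sym (idx-ν t)) o) (subst (ℕ._< n) (sym (idx-ν t)) (proj₂ small))
      (subst (+ 0 <_) (sym (odd-ν outKey t)) (flipped (okey t) (2≤okey t) h))
      λ {f} f≢ f≢' p q → adj {ν f} (λ e → f≢' (ν-fix e)) (λ e → f≢ (ν-fix e)) (≺-νʳ⁻ q) (≺-νˡ p))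
      where
      flipped : ∀ z → 2 ℕ.≤ idx z → z < + 0 → + 0 < ν z
      flipped -[1+ suc m ] (s≤s _) _ = +<+ z<s
      flipped (+ _) _ (+<+ ())
      ≺-νʳ⁻ : ∀ {f} → f ≺⟨ el J A ⟩ ν t → t ≺⟨ el J A ⟩ ν f
      ≺-νʳ⁻ = ≺-νʳ
    go (inj₁ (out-out o o' (inj₂ (_ , lt)))) = contradiction lt (ℤ.<-asym c<t)
    go (inj₁ (out-out o o' (inj₁ h))) = ⊥-elim (apart (side-cmp t) (side-cmp c))
      where
      same : ∀ a b → idx a ℕ.< n → idx b ℕ.< n → (∀ s → epsZ a ≡ s → epsZ b ≡ s) → okey a ≡ okey b
      same a b r r' hh = trans (key-side a r) (trans (cong (sideKey 2) (sym (hh _ refl))) (sym (key-side b r')))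
        where
        key-side : ∀ a → idx a ℕ.< n → okey a ≡ sideKey 2 (epsZ a)
        key-side (+ k) r = outKey-small r
        key-side -[1+ k ] r = trans (cong ν (outKey-small r)) (by (eps k))
          where
          by : ∀ s → ν (sideKey 2 s) ≡ sideKey 2 (flipSide s)
          by left  = refl
          by right = refl
      apart : (okey t < + 0) ⊎ (+ 0 < okey t) → (okey c < + 0) ⊎ (+ 0 < okey c) → ⊥
      apart (inj₁ a) (inj₂ b) = adj (inner≢outer 3F o') (inner≢outer 3F o) (≺-out A (out-in o 3F refl a)) (≺-out A (in-out 3F refl o' b))
      apart (inj₁ a) (inj₁ b) = ℤ.<-irrefl (same t c (proj₂ small) (proj₁ small) (λ s e → trans (proj₁ (okey-side c (proj₁ small)) b) (trans (sym (proj₁ (okey-side t (proj₂ small)) a)) e))) h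
      apart (inj₂ a) (inj₂ b) = ℤ.<-irrefl (same t c (proj₂ small) (proj₁ small) (λ s e → trans (right-side c (proj₁ small) b) (trans (sym (right-side t (proj₂ small) a)) e))) h
      apart (inj₂ a) (inj₁ b) = ℤ.<-asym h (ℤ.<-trans b a)
    go (inj₂ (inj₁ (s , r , e , e' , h))) = inside s r e e' c<t h adj
    go (inj₂ (inj₂ (s , r , e , e' , h))) = inside (opp r) (opp s)
      (trans (ν-fix e') (sym (val-opp r))) (trans (ν-fix e) (sym (val-opp s))) c<t
      (subst₂ _<_ (sym (proj₁ (proj₁ A r))) (sym (proj₁ (proj₁ A s))) (ν-anti h)) adj

-- From positions of values to arc diagrams

get-out : ∀ {n} (w : Vec ℤ n) {m} → n ℕ.≤ m → get w m ≡ + 0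
get-out [] _ = refl
get-out (x ∷ w) (s≤s p) = get-out w p

dec-ν : ∀ a → dec (ν a) ≡ - dec a
dec-ν (+ m) = refl
dec-ν -[1+ m ] = refl

dec-extend : ∀ {k c} → c < -[1+ k ] → enc c < -[1+ k ]
dec-extend {c = -[1+ _ ]} p = p

module _ {n : ℕ} (x : SP n) where

  -- A nonzero value rules out the junk value of `lval`, so c is a genuine position.
  lval⇒W : ∀ c {v} → lval (word x) c ≡ v → v ≢ + 0 → W x (enc c) ≡ enc v × c ≢ + 0
  lval⇒W (+ zero) refl ne = contradiction refl ne
  lval⇒W (+ suc m) e ne with m ℕ.<? n
  ... | yes p = trans (wv-in x p) (cong enc e) , λ ()
  ... | no  p = contradiction (trans (sym e) (get-out (word x) (ℕ.≮⇒≥ p))) ne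
  lval⇒W -[1+ m ] refl ne with m ℕ.<? n
  ... | yes p = trans (cong ν (wv-in x p)) (sym (enc-neg (get (word x) m) (proj₁ (proj₁ (getPerm x) p)))) , λ ()
  ... | no  p = contradiction (cong -_ (get-out (word x) (ℕ.≮⇒≥ p))) ne

  get-dec : ∀ {m} → m ℕ.< n → get (word x) m ≡ dec (wv x m)
  get-dec p = sym (trans (cong dec (wv-in x p)) (dec-enc _ (proj₁ (proj₁ (getPerm x) p))))

  W⇒lval : ∀ i → idx i ℕ.< n → lval (word x) (dec i) ≡ dec (W x i)
  W⇒lval (+ m) p = get-dec p
  W⇒lval -[1+ m ] p = trans (cong -_ (get-dec p)) (sym (dec-ν (wv x m)))

  lval⇒P : ∀ {k c} → lval (word x) c ≡ + suc k → P x (+ k) ≡ enc c × c ≢ + 0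
  lval⇒P {k} {c} e with lval⇒W c e (λ ())
  ... | e' , ne = P-unique x e' , ne

  P⇒lval : ∀ {k} → k ℕ.< n → lval (word x) (dec (P x (+ k))) ≡ + suc k
  P⇒lval {k} p = trans (W⇒lval (P x (+ k)) (P-small x (+ k) p)) (cong dec (W-P x (+ k)))

enc-> : ∀ {m c} → -[1+ m ] < c → c ≢ + 0 → -[1+ m ] < enc c
enc-> { c = -[1+ _ ]} p _ = p
enc-> { c = + zero} _ ne = contradiction refl ne
enc-> { c = + suc _} _ _ = -<+

enc->⁺ : ∀ {m c} → + suc m < c → + m < enc c
enc->⁺ (+<+ {n = suc _} (s≤s p)) = +<+ p

enc-<⁺ : ∀ {m c} → c < + suc m → c ≢ + 0 → enc c < + m
enc-<⁺ { c = -[1+ _ ]} _ _ = -<+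
enc-<⁺ { c = + zero} _ ne = contradiction refl ne
enc-<⁺ { c = + suc _} (+<+ (s≤s p)) _ = +<+ p

module Diagram {n : ℕ} (d : ℕ → Side) {y x : SP n} {c t : ℤ} (C : Cov y x c t)
  (D : Designated (extend d) c t x) (uniq : OnlyLabel x c t) where

  left-of : ∀ {k} → c < + k → + k < t → P x (+ k) < P x t → d (suc k) ≡ left
  left-of p q h = proj₁ (D p q) ⟪ h ⟫

  right-of : ∀ {k} → c < + k → + k < t → P x t < P x (+ k) → d (suc k) ≡ right
  right-of {k} p q h with d (suc k) in e
  ... | right = refl
  ... | left  = contradiction (P< (proj₂ (D p q) e)) (ℤ.<-asym h)

  -- The descent behind an ordinary arc joins values of equal sign, whereas the only label and its
  -- mirror image each join values of opposite signs.
  ordinary-free : (∃ λ A → c ≡ -[1+ A ]) → (∃ λ B → ν t ≡ -[1+ B ]) → ∀ {t' b s} → ¬ InDelta (word x) (ordinary t' b s)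
  ordinary-free (A , refl) (B , νt) (ordPos {suc i} {suc t'} {suc b} _ _ e e' _ b<t' _)
    with uniq (next⇒AdjDesc {i = + i} (proj₁ (lval⇒W x (+ suc i) e λ ())) (proj₁ (lval⇒W x (+ suc (suc i)) e' λ ())) (+<+ (ℕ.s≤s⁻¹ b<t')))
  ... | inj₁ (() , _)
  ... | inj₂ (z , _) = case trans z νt of λ ()
  ordinary-free (A , refl) (B , νt) (ordNeg {suc i} {suc t'} {suc b} _ _ e e' _ b<t' _)
    with uniq (next⇒AdjDesc {i = -[1+ suc i ]} (proj₁ (lval⇒W x -[1+ suc i ] e λ ())) (proj₁ (lval⇒W x -[1+ i ] e' λ ())) (+<+ (ℕ.s≤s⁻¹ b<t')))
  ... | inj₁ (() , _)
  ... | inj₂ (z , _) = case trans z νt of λ ()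

-- A point on the wrong side of the mirror image would reflect back to one on the wrong side of the
-- arc.
designated-mirror : ∀ {n} {σ} {y x : SP n} {c t} → Equivariant σ → Cov y x c t → Designated σ c t x → Designated σ (ν t) (ν c) x
designated-mirror {σ = σ} {y} {x} {c} {t} eqv C D with designated-or-wrong σ x (ν t) (ν c)
... | inj₁ D' = D'
... | inj₂ (e , w) = ⊥-elim (clash (subst₂ (λ c t → Wrong σ x c t (ν e)) (ν-involutive c) (ν-involutive t) (wrong-mirror {e = e} eqv (mirror C) w)))
  where
  clash : ∀ {e} → ¬ Wrong σ x c t e
  clash (p , q , inj₁ (l , r)) = ≺-asym r (proj₂ (D p q) l)
  clash (p , q , inj₂ (r , l)) = case trans (sym r) (proj₁ (D p q) l) of λ ()

delta-orbifold : ∀ {N} (d : ℕ → Side) {y x : SP (suc N)} → Cov y x -[1+ N ] (+ N) → Designated (extend d) -[1+ N ] (+ N) x →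
  OnlyLabel x -[1+ N ] (+ N) → DeltaIs x (β-o (suc N) d)
delta-orbifold {N} d {y} {x} C D uniq = exists , unique
  where
  open Diagram d C D uniq
  -- The values N and -N are adjacent and mirror images of each other, which is possible only at the
  -- centre.
  center : ∀ T → nxt T ≡ ν T → T ≡ -[1+ 0 ]
  center -[1+ zero ] _ = refl
  PN : P x (+ N) ≡ -[1+ 0 ]
  PN = center _ (trans (sym (cov-next C)) (P-ν x (+ N)))
  PνN : P x -[1+ N ] ≡ + 0
  PνN = trans (P-ν x (+ N)) (cong ν PN)
  WN : W x -[1+ 0 ] ≡ + N
  WN = trans (cong (W x) (sym PN)) (W-P x (+ N))
  WνN : W x (+ 0) ≡ -[1+ N ]
  WνN = trans (cong (W x) (sym PνN)) (W-P x -[1+ N ])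
  at-left : ∀ {k} → k ℕ.< N → P x (+ k) < -[1+ 0 ] → d (suc k) ≡ left
  at-left p h = left-of -<+ (+<+ p) (subst (P x _ <_) (sym PN) h)
  at-right : ∀ {k} → k ℕ.< N → + 0 < P x (+ k) → d (suc k) ≡ right
  at-right p h = right-of -<+ (+<+ p) (subst (_< P x _) (sym PN) (ℤ.<-trans -<+ h))
  lval-1 : lval (word x) -[1+ 0 ] ≡ + suc N
  lval-1 = trans (W⇒lval x -[1+ 0 ] z<s) (cong dec WN)
  lval+1 : lval (word x) (+ 1) ≡ -[1+ N ]
  lval+1 = trans (W⇒lval x (+ 0) z<s) (cong dec WνN)
  exists : InDelta (word x) (orbifold (suc N) d)
  exists = mid lval-1 (subst₂ _<_ (sym lval+1) (sym lval-1) -<+) λ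
    { (suc k) c _ (s≤s k<N) e → (λ h → at-left k<N (subst (_< -[1+ 0 ]) (sym (proj₁ (lval⇒P x e))) (dec-extend h))) ,
        λ h → at-right k<N (subst (+ 0 <_) (sym (proj₁ (lval⇒P x e))) (enc->⁺ h)) }
  unique : ∀ α → InDelta (word x) α → α ≈ᵃ orbifold (suc N) d
  unique (ordinary t b s) i = ordinary-free (N , refl) (N , refl) i
  unique (long l r a b) (longD {suc i} {suc l'} {suc r'} _ _ e e' _ _ _ _)
    with uniq (next⇒AdjDesc {i = + i} (proj₁ (lval⇒W x (+ suc i) e λ ())) (proj₁ (lval⇒W x (+ suc (suc i)) e' λ ())) -<+)
  ... | inj₁ (_ , refl) = case trans (sym PN) (P-unique x {i = + i} (proj₁ (lval⇒W x (+ suc i) e λ ()))) of λ ()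
  ... | inj₂ (_ , refl) = case trans (sym PN) (P-unique x {i = + i} (proj₁ (lval⇒W x (+ suc i) e λ ()))) of λ ()
  unique (orbifold p s) (mid e _ h) with ℤ.+-injective (trans (sym e) lval-1)
  ... | refl = refl , λ { (suc k) _ (s≤s k<N) → sides k k<N }
    where
    sides : ∀ k → k ℕ.< N → s (suc k) ≡ d (suc k)
    sides k k<N with P x (+ k) in eq | P⇒lval x (ℕ.<-trans k<N (ℕ.n<1+n N))
    ... | + zero | _ = case trans (sym WνN) (trans (cong (W x) (sym eq)) (W-P x (+ k))) of λ ()
    ... | -[1+ zero ] | _ = contradiction (ℤ.+-injective (trans (sym WN) (trans (cong (W x) (sym eq)) (W-P x (+ k))))) (≢-sym (ℕ.<⇒≢ k<N))
    ... | + suc m | lv = trans (proj₂ (h (suc k) (+ suc (suc m)) z<s (s≤s k<N) lv) (+<+ (s≤s z<s)))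
            (sym (at-right k<N (subst (+ 0 <_) (sym eq) (+<+ z<s))))
    ... | -[1+ suc m ] | lv = trans (proj₁ (h (suc k) -[1+ suc m ] z<s (s≤s k<N) lv) (-<- z<s))
            (sym (at-left k<N (subst (_< -[1+ 0 ]) (sym eq) (-<- z<s))))

-- The last hypothesis puts the descent at the one-line positions 1 and 2. Points beside the left
-- piece are compared with +A, the upper end of the mirrored label, whence the second copy `M` of
-- `Diagram`.
delta-long : ∀ {N A B} (d : ℕ → Side) {y x : SP (suc N)} → 0 ℕ.< N → A ℕ.≤ N → B ℕ.≤ N → A ≢ B → Cov y x -[1+ A ] (+ B) →
  Designated (extend d) -[1+ A ] (+ B) x → OnlyLabel x -[1+ A ] (+ B) → P x (+ B) ≡ + 0 →
  DeltaIs x (long (suc A) (suc B) (λ k → isL (d k)) (λ k → isR (d k)))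
delta-long {N} {A} {B} d {y} {x} 0<N A≤N B≤N A≢B C D uniq PB = exists , unique
  where
  open Diagram d C D uniq
  D' : Designated (extend d) -[1+ B ] (+ A) x
  D' = designated-mirror (extend-equivariant d) C D
  module M = Diagram d (mirror C) D' (λ a → [ inj₂ , inj₁ ]′ (uniq a))
  PνA : P x -[1+ A ] ≡ + 1
  PνA = trans (cov-next C) (cong nxt PB)
  PA : P x (+ A) ≡ -[1+ 1 ]
  PA = trans (P-ν x -[1+ A ]) (cong ν PνA)
  W0 : W x (+ 0) ≡ + B
  W0 = trans (cong (W x) (sym PB)) (W-P x (+ B))
  W1 : W x (+ 1) ≡ -[1+ A ]
  W1 = trans (cong (W x) (sym PνA)) (W-P x -[1+ A ])
  La : ∀ {k} → k ℕ.< A → P x (+ k) < -[1+ 1 ] → isL (d (suc k)) ≡ true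
  La p h = cong isL (M.left-of -<+ (+<+ p) (subst (P x _ <_) (sym PA) h))
  La' : ∀ {k} → k ℕ.< A → -[1+ 1 ] < P x (+ k) → isL (d (suc k)) ≡ false
  La' p h = cong isL (M.right-of -<+ (+<+ p) (subst (_< P x _) (sym PA) h))
  Rb : ∀ {k} → k ℕ.< B → + 1 < P x (+ k) → isR (d (suc k)) ≡ true
  Rb p h = cong isR (right-of -<+ (+<+ p) (subst (_< P x _) (sym PB) (ℤ.<-trans (+<+ z<s) h)))
  Rb' : ∀ {k} → k ℕ.< B → P x (+ k) < + 1 → isR (d (suc k)) ≡ false
  Rb' {k} p h with ≺-cmp x {+ k} {+ B} (λ e → ℕ.<-irrefl (ℤ.+-injective e) p)
  ... | inj₁ ⟪ q ⟫ = cong isR (left-of -<+ (+<+ p) q)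
  ... | inj₂ ⟪ q ⟫ = ⊥-elim (none (subst (_< P x (+ k)) PB q) h)
    where
    none : ∀ {z} → + 0 < z → z < + 1 → ⊥
    none (+<+ (s≤s _)) (+<+ (s≤s ()))
  1<n : 1 ℕ.< suc N
  1<n = s≤s 0<N
  lval+1 : lval (word x) (+ 1) ≡ + suc B
  lval+1 = trans (W⇒lval x (+ 0) z<s) (cong dec W0)
  lval-1 : lval (word x) -[1+ 0 ] ≡ -[1+ B ]
  lval-1 = trans (W⇒lval x -[1+ 0 ] z<s) (cong (dec ∘ ν) W0)
  exists : InDelta (word x) (long (suc A) (suc B) (λ k → isL (d k)) (λ k → isR (d k)))
  exists = longD {i = 1} z<s 1<n lval+1 (trans (W⇒lval x (+ 1) 1<n) (cong dec W1)) z<s z<s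
    (λ { (suc k) c _ (s≤s p) e → let (e' , ne) = lval⇒P x e in
        (λ h → La p (subst (_< -[1+ 1 ]) (sym e') (dec-extend h))) , (λ h → La' p (subst (-[1+ 1 ] <_) (sym e') (enc-> h ne))) })
    (λ { (suc k) c _ (s≤s p) e → let (e' , ne) = lval⇒P x e in
        (λ h → Rb p (subst (+ 1 <_) (sym e') (enc->⁺ h))) , (λ h → Rb' p (subst (_< + 1) (sym e') (enc-<⁺ h ne))) })
  at-B : ∀ {i} → W x (+ i) ≡ + B → i ≡ 0
  at-B {i} e = ℤ.+-injective (trans (sym (P-unique x {i = + i} e)) PB)
  unique : ∀ α → InDelta (word x) α → α ≈ᵃ long (suc A) (suc B) (λ k → isL (d k)) (λ k → isR (d k))
  unique (ordinary t b s) i = ordinary-free (A , refl) (B , refl) i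
  unique (orbifold p s) (mid e _ _) = case trans (sym lval-1) e of λ ()
  unique (long l r a b) (longD {suc i} {suc l'} {suc r'} _ _ e e' _ _ ha hb)
    with proj₁ (lval⇒W x (+ suc i) e λ ()) | proj₁ (lval⇒W x (+ suc (suc i)) e' λ ())
  ... | w | w' with uniq (next⇒AdjDesc {i = + i} w w' -<+)
  ... | inj₂ (_ , refl) = case trans (sym PA) (P-unique x {i = + i} w) of λ ()
  ... | inj₁ (refl , refl) with at-B w
  ... | refl = refl , refl , (λ { (suc k) _ (s≤s p) → sideA k p }) , (λ { (suc k) _ (s≤s p) → sideB k p })
    where
    sideA : ∀ k → k ℕ.< A → a (suc k) ≡ isL (d (suc k))
    sideA k p with P x (+ k) in eq | P⇒lval x {k} (ℕ.<-trans p (s≤s A≤N))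
    ... | + m | lv = trans (proj₂ (ha (suc k) (+ suc m) z<s (s≤s p) lv) -<+) (sym (La' p (subst (-[1+ 1 ] <_) (sym eq) -<+)))
    ... | -[1+ zero ] | lv = trans (proj₂ (ha (suc k) -[1+ 0 ] z<s (s≤s p) lv) (-<- z<s)) (sym (La' p (subst (-[1+ 1 ] <_) (sym eq) (-<- z<s))))
    ... | -[1+ suc zero ] | lv = contradiction (ℤ.+-injective (P-injective x (trans eq (sym PA)))) (ℕ.<⇒≢ p)
    ... | -[1+ suc (suc m) ] | lv = trans (proj₁ (ha (suc k) -[1+ suc (suc m) ] z<s (s≤s p) lv) (-<- (s≤s z<s))) (sym (La p (subst (_< -[1+ 1 ]) (sym eq) (-<- (s≤s z<s)))))
    sideB : ∀ k → k ℕ.< B → b (suc k) ≡ isR (d (suc k))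
    sideB k p with P x (+ k) in eq | P⇒lval x {k} (ℕ.<-trans p (s≤s B≤N))
    ... | + zero | lv = trans (proj₂ (hb (suc k) (+ 1) z<s (s≤s p) lv) (+<+ (s≤s z<s))) (sym (Rb' p (subst (_< + 1) (sym eq) (+<+ z<s))))
    ... | + suc zero | lv = case P-injective x (trans eq (sym PνA)) of λ ()
    ... | + suc (suc m) | lv = trans (proj₁ (hb (suc k) (+ suc (suc (suc m))) z<s (s≤s p) lv) (+<+ (s≤s (s≤s z<s)))) (sym (Rb p (subst (+ 1 <_) (sym eq) (+<+ (s≤s z<s)))))
    ... | -[1+ m ] | lv = trans (proj₂ (hb (suc k) -[1+ m ] z<s (s≤s p) lv) -<+) (sym (Rb' p (subst (_< + 1) (sym eq) -<+)))

-- The Cambrian congruence as a meet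

module _ {n : ℕ} where

  -- The last step of a chain of covers from the identity to x. Even the total relation contracts a
  -- word only if such a cover exists.
  lower-cover : (x : SP n) → word x ≢ mkWord n +_ → ∃ λ y → y ⋖ x
  lower-cover x ne with ⊑⇒≤ {x = identity} {x} (identity-below (toOrd x))
  ... | s = final s (λ e → ne (sym (cong word e)))
    where
    final : ∀ {u v : SP n} → u ≤w v → u ≢ v → ∃ λ y → y ⋖ v
    final ε ne = contradiction refl ne
    final {u} (_◅_ c ε) _ = u , c
    final {v = v} (_◅_ {j = w} c (_◅_ {j = w'} c' s)) _ = final {w} {v} (_◅_ {j = w'} c' s) λ { refl → ≺-asym (Cov.c≺d C) (≤⇒⊑ s (Cov.c<d C) (Cov.d≺c C)) }
      where C = proj₂ (cover⇒Cov {n} {w} {w'} c')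

  mkWord-differs : ∀ (f : ℕ → ℤ) k → k ℕ.< n → f (suc k) ≢ + suc k → mkWord n f ≢ mkWord n +_
  mkWord-differs f k k<n ne e = ne (trans (sym (get-mkWord n f k<n)) (trans (cong (λ w → get w k) e) (get-mkWord n +_ k<n)))

module Main {N : ℕ} (0<N : 0 ℕ.< N) (d : ℕ → Side) where

  n : ℕ
  n = suc N

  2≤n : 2 ℕ.≤ n
  2≤n = s≤s 0<N

  N<n : N ℕ.< n
  N<n = ℕ.≤-refl

  σ : ℤ → Side
  σ = extend d

  gen-differs : ∀ {w} → CambGen n d w → w ≢ mkWord n +_
  gen-differs (g-s0s1 _) = mkWord-differs w-s0s1 0 z<s (λ ())
  gen-differs (g-s0s1s0 _) = mkWord-differs w-s0s1s0 0 z<s (λ ())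
  gen-differs (g-s1s0 _) = mkWord-differs w-s1s0 0 z<s (λ ())
  gen-differs (g-s1s0s1 _) = mkWord-differs w-s1s0s1 1 2≤n (λ ())
  gen-differs (g-right (suc (suc m)) _ p _) = mkWord-differs (w-right (suc (suc m))) m (ℕ.<-trans (ℕ.n<1+n m) (ℕ.<-trans (ℕ.n<1+n _) p))
    λ e → ℕ.1+n≢n (trans (sym (proj₁ (rotR-m m))) (ℕ.suc-injective (ℤ.+-injective (trans (sym (w-right-rotR m m)) e))))
  gen-differs (g-left (suc (suc m)) _ p _) = mkWord-differs (w-left (suc (suc m))) (suc m) (ℕ.<-trans (ℕ.n<1+n _) p)
    λ e → ℕ.1+n≢n (sym (trans (sym (proj₁ (proj₂ (rotL-m m)))) (ℕ.suc-injective (ℤ.+-injective (trans (sym (w-left-rotL m (suc m))) e)))))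
  gen-differs (g-right (suc zero) (s≤s ()) _ _)
  gen-differs (g-left (suc zero) (s≤s ()) _ _)

  -- Only the words and labels of the generators matter for Ψ, so Generators is used with the total relation.
  gens-⊤ : ∀ w → CambGen n d w → ContractsW {n} (λ _ _ → ⊤) w
  gens-⊤ w g j e with lower-cover j (λ e' → gen-differs g (trans (sym e) e'))
  ... | y , c = y , c , tt

  word-injective : ∀ {x y : SP n} → word x ≡ word y → x ≡ y
  word-injective refl = refl

  -- The only descent of a generator passes one designated point, namely 1 or i, on the wrong side.
  gens-Ψ : ∀ w → CambGen n d w → ContractsW (Ψ σ) w
  gens-Ψ w g j e = go g
    where
    open Generators {n} {d} gens-⊤
    conclude : ∀ {c t Q e} → (∀ {x} → Q x → Wrong σ x c t e) → GenArc w c t Q → Contracts (Ψ σ) j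
    conclude {e = e₀} wrong (genArc {lower} {upper} is-word covers C _ q) with word-injective {upper} {j} (trans is-word (sym e))
    ... | refl = lower , covers , wrong⇒Ψ {e = e₀} (extend-equivariant d) C (wrong q)
    go : CambGen n d w → Contracts (Ψ σ) j
    go (g-s0s1 r) = conclude {e = + 0} (λ q → -<+ , +<+ z<s , inj₂ (r , q)) (s0s1 2≤n r)
    go (g-s0s1s0 r) = conclude {e = + 0} (λ q → -<+ , +<+ z<s , inj₂ (r , q)) (s0s1s0 2≤n r)
    go (g-s1s0 l) = conclude {e = + 0} (λ q → -<+ , +<+ z<s , inj₁ (l , q)) (s1s0 2≤n l)
    go (g-s1s0s1 l) = conclude {e = + 0} (λ q → -<+ , +<+ z<s , inj₁ (l , q)) (s1s0s1 2≤n l)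
    go (g-right (suc (suc m)) _ p r) = conclude {e = + suc m} (λ q → i<nxt (+ m) , i<nxt (+ suc m) , inj₂ (r , q)) (rightGen p r)
    go (g-left (suc (suc m)) _ p l) = conclude {e = + suc m} (λ q → i<nxt (+ m) , i<nxt (+ suc m) , inj₁ (l , q)) (leftGen p l)
    go (g-right (suc zero) (s≤s ()) _ _)
    go (g-left (suc zero) (s≤s ()) _ _)

  record Highest (s : Side) : Set where
    constructor highest
    field
      peak   : ℕ
      peak<N : peak ℕ.< N
      side   : d (suc peak) ≡ s
      beyond : ∀ k → peak ℕ.< k → k ℕ.< N → d (suc k) ≡ flipSide s

  _≟ˢ_ : (s t : Side) → s ≡ t ⊎ s ≡ flipSide t
  left  ≟ˢ left  = inj₁ refl
  left  ≟ˢ right = inj₂ refl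
  right ≟ˢ left  = inj₂ refl
  right ≟ˢ right = inj₁ refl

  find-highest : ∀ s → Highest s ⊎ (∀ k → k ℕ.< N → d (suc k) ≡ flipSide s)
  find-highest s = go N ℕ.≤-refl (λ k p q → contradiction q (ℕ.≤⇒≯ p))
    where
    go : ∀ m → m ℕ.≤ N → (∀ k → m ℕ.≤ k → k ℕ.< N → d (suc k) ≡ flipSide s) → Highest s ⊎ (∀ k → k ℕ.< N → d (suc k) ≡ flipSide s)
    go zero _ h = inj₂ λ k → h k z≤n
    go (suc m) m<N h with d (suc m) ≟ˢ s
    ... | inj₁ e = inj₁ (highest m m<N e h)
    ... | inj₂ e = go m (ℕ.<⇒≤ m<N) λ k p q → [ (λ lt → h k lt q) , (λ { refl → e }) ]′ (ℕ.m≤n⇒m<n∨m≡n p)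

  below-highest : ∀ {s} (H : Highest s) {k} → k ℕ.< N → d (suc k) ≡ s → k ℕ.≤ Highest.peak H
  below-highest {s} H {k} k<N e with k ℕ.≤? Highest.peak H
  ... | yes p = p
  ... | no ¬p = contradiction (trans (sym e) (Highest.beyond H k (ℕ.≰⇒> ¬p) k<N)) (≢flip s)
    where
    ≢flip : ∀ s → s ≢ flipSide s
    ≢flip left ()
    ≢flip right ()

  no-highest : ∀ {s} {X : Set} → (∀ k → k ℕ.< N → d (suc k) ≡ flipSide s) → (∃ λ k → 1 ℕ.≤ k × k ℕ.< n × d k ≡ s) → X
  no-highest {left} h (suc k , _ , s≤s p , e) = case trans (sym (h k p)) e of λ ()
  no-highest {right} h (suc k , _ , s≤s p , e) = case trans (sym (h k p)) e of λ ()

  highestLeft : (H : Highest left) → HighestLeft n d (suc (Highest.peak H))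
  highestLeft (highest l p e b) = z<s , s≤s p , e , λ { (suc k) (s≤s q) (s≤s r) → b k q r }

  highestRight : (H : Highest right) → HighestRight n d (suc (Highest.peak H))
  highestRight (highest l p e b) = z<s , s≤s p , e , λ { (suc k) (s≤s q) (s≤s r) → b k q r }

  record ArcElement (c t : ℤ) : Set where
    constructor arcElement
    field
      {lower upper} : SP n
      cov   : Cov lower upper c t
      des   : Designated σ c t upper
      only  : OnlyLabel upper c t

  flipSide-right : ∀ {s} → flipSide s ≡ right → s ≡ left
  flipSide-right {left} _ = refl

  -- A negative value on the right half reflects a left point; below -l it would come from a left
  -- point higher than l.
  outer-below : ∀ {l} c → idx c ≢ N → idx c ℕ.< n → σ c ≡ right → c < -[1+ l ] → ∃ λ k → l ℕ.< k × k ℕ.< N × d (suc k) ≡ left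
  outer-below -[1+ k ] ne (s≤s p) e (-<- lt) = k , lt , ℕ.≤∧≢⇒< p ne , flipSide-right e

  -- Join-irreducibility asks for an increasing right half. With the highest left point as p, the
  -- half starts with -N and -p, and -p is the lowest of the reflected left points. With no left
  -- point only -N is negative there, and p is the point 1, the smallest positive value.
  element-o : Highest left ⊎ (∀ k → k ℕ.< N → d (suc k) ≡ right) → ArcElement -[1+ N ] (+ N)
  element-o (inj₁ (highest l l<N e b)) = arcElement A2-A3 (designated-A3 e)
    (onlyLabel aA3 0F 3F 1F (toWitness {a? = onlyInner? jA3 0F 3F} _) refl λ c o p r lt →
      case outer-below c (proj₂ o) p r lt of λ { (k , q , q' , f) → case trans (sym f) (b k q q') of λ () })
    where
    open OctFamily l<N N<n d
    open OctDescents l<N N<n d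
  element-o (inj₂ h) = arcElement B1-B2 (designated-B2 (h 0 0<N))
    (onlyLabel aB2 0F 3F 2F (toWitness {a? = onlyInner? jB2 0F 3F} _) refl λ
      { (+ _) _ _ _ (+<+ ()) ; -[1+ k ] o (s≤s p) r lt → case trans (sym (flipSide-right r)) (h k (ℕ.≤∧≢⇒< p (proj₂ o))) of λ () })
    where
    open OctFamily 0<N N<n d
    open OctDescents 0<N N<n d

  module _ (H : Highest left) where
    open Highest H
    open OctFamily peak<N N<n d
    open OctDescents peak<N N<n d

    -- The right half of `A2` descends from N to -p and then increases, as no left point is higher
    -- than p.
    element-l : ArcElement -[1+ peak ] (+ N)
    element-l = arcElement A1-A2 (designated-A2 side)
      (onlyLabel aA2 1F 3F 1F (toWitness {a? = onlyInner? jA2 1F 3F} _) refl λ c o p r lt →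
        case outer-below c (proj₂ o) p r lt of λ { (k , q , q' , f) → case trans (sym f) (beyond k q q') of λ () })

    delta-l : DeltaIs (ArcElement.upper element-l) (β-l n d (suc peak))
    delta-l = delta-long d 0<N (ℕ.<⇒≤ peak<N) ℕ.≤-refl (ℕ.<⇒≢ peak<N)
      (ArcElement.cov element-l) (ArcElement.des element-l) (ArcElement.only element-l) (inner-first aA2 3F refl)

  module _ (H : Highest right) where
    open Highest H
    open OctFamily peak<N N<n d
    open OctDescents peak<N N<n d

    -- The right half of `B3` descends from p to -N, and nothing after -N can be smaller. The mirror
    -- image is taken because the left endpoint of β_r is n.
    element-r : ArcElement -[1+ N ] (+ peak)
    element-r = arcElement (mirror B2-B3) (designated-mirror (extend-equivariant d) B2-B3 (designated-B3 side))
      (onlyLabel aB3 0F 2F 0F (toWitness {a? = onlyInner? jB3 0F 2F} _) refl λ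
        { -[1+ k ] o (s≤s p) r (-<- lt) → ℕ.<⇒≱ lt p })

    delta-r : DeltaIs (ArcElement.upper element-r) (β-r n d (suc peak))
    delta-r = delta-long d 0<N ℕ.≤-refl (ℕ.<⇒≤ peak<N) (≢-sym (ℕ.<⇒≢ peak<N))
      (ArcElement.cov element-r) (ArcElement.des element-r) (ArcElement.only element-r) (inner-first aB3 2F refl)

  module Proof {Θ Θo Θr Θl : Rel n} (camb : IsCambrian n d Θ) (isO : IsThetaArc n (β-o n d) Θo)
    (isR : ∀ r → HighestRight n d r → IsThetaArc n (β-r n d r) Θr)
    (isL : ∀ l → HighestLeft n d l → IsThetaArc n (β-l n d l) Θl) where

    isC : IsCongruence Θ
    isC = proj₁ camb

    Θ⊆Ψ : Θ ⊆ᴿ Ψ σ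
    Θ⊆Ψ = proj₂ (proj₂ camb) (Ψ σ) (Ψ-isCongruence σ) gens-Ψ

    Coarsest : ∀ {c t} → ArcElement c t → Rel n → Set₁
    Coarsest E Φ = IsCoarsestNotContracting (ArcElement.upper E) Φ

    Θ⊆coarsest : ∀ {c t Φ} (E : ArcElement c t) → Coarsest E Φ → Θ ⊆ᴿ Φ
    Θ⊆coarsest (arcElement C D only) (_ , _ , coarsest) =
      coarsest Θ isC λ h → designated⇒¬Ψ C D (Θ⊆Ψ (contracts⇒ {Φ = Θ} C only h))

    not-contracted : ∀ {c t Φ} (E : ArcElement c t) → Coarsest E Φ → ¬ Φ (ArcElement.upper E) (ArcElement.lower E)
    not-contracted (arcElement C D only) (_ , ¬con , _) r = ¬con (_ , Cov⇒⋖ C , r)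

    irreducible : ∀ {c t} (E : ArcElement c t) → JoinIrreducible (ArcElement.upper E)
    irreducible (arcElement C _ only) = joinIrreducible C only

    Eo : ArcElement -[1+ N ] (+ N)
    Eo = element-o (find-highest left)

    coarsest-o : Coarsest Eo Θo
    coarsest-o = isO (ArcElement.upper Eo) (irreducible Eo) (delta-orbifold d (ArcElement.cov Eo) (ArcElement.des Eo) (ArcElement.only Eo))

    coarsest-r : (H : Highest right) → Coarsest (element-r H) Θr
    coarsest-r H = isR _ (highestRight H) (ArcElement.upper (element-r H)) (irreducible (element-r H)) (delta-r H)

    coarsest-l : (H : Highest left) → Coarsest (element-l H) Θl
    coarsest-l H = isL _ (highestLeft H) (ArcElement.upper (element-l H)) (irreducible (element-l H)) (delta-l H)

    hasLeft : HasLeft n d → Highest left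
    hasLeft h = [ (λ H → H) , (λ none → no-highest none h) ]′ (find-highest left)

    hasRight : HasRight n d → Highest right
    hasRight h = [ (λ H → H) , (λ none → no-highest none h) ]′ (find-highest right)

    All : Rel n
    All x y = Θo x y × (HasRight n d → Θr x y) × (HasLeft n d → Θl x y)

    forward : Θ ⊆ᴿ All
    forward r = Θ⊆coarsest Eo coarsest-o r ,
      (λ h → Θ⊆coarsest (element-r (hasRight h)) (coarsest-r (hasRight h)) r) ,
      (λ h → Θ⊆coarsest (element-l (hasLeft h)) (coarsest-l (hasLeft h)) r)

    isCo : IsCongruence Θo
    isCo = proj₁ coarsest-o

    isCr : HasRight n d → IsCongruence Θr
    isCr h = proj₁ (coarsest-r (hasRight h))

    isCl : HasLeft n d → IsCongruence Θl
    isCl h = proj₁ (coarsest-l (hasLeft h))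

    designated-uncontracted : ∀ {y x c t} → Cov y x c t → Designated σ c t x → ¬ All x y
    designated-uncontracted {y} {x} C D (ro , rr , rl) = by _ _ C D
      where
      orbifold-forced : Upward.Forces d isCo -[1+ N ] (+ N) → ⊥
      orbifold-forced F = not-contracted Eo coarsest-o (F (ArcElement.cov Eo) (ArcElement.des Eo))
      left-arc : ∀ {p q} → p ℕ.< q → q ℕ.≤ N → d (suc p) ≡ left → Cov y x -[1+ p ] (+ q) → Designated σ -[1+ p ] (+ q) x → ⊥
      left-arc {p} p<q q≤N e C D = not-contracted E (coarsest-l H)
          (Upward.mixed-left d (isCl h) p<q q≤N (below-highest H p<N e) (Highest.peak<N H) e (Highest.side H) (arc C D (rl h))
            (ArcElement.cov E) (ArcElement.des E))
        where
        p<N = ℕ.<-≤-trans p<q q≤N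
        h : HasLeft n d
        h = suc p , z<s , s≤s p<N , e
        H = hasLeft h
        E = element-l H
      right-arc : ∀ {p q} → p ℕ.< q → q ℕ.≤ N → d (suc p) ≡ right → Cov y x -[1+ p ] (+ q) → Designated σ -[1+ p ] (+ q) x → ⊥
      right-arc {p} p<q q≤N e C D = not-contracted E (coarsest-r H)
          (Upward.mixed-right d (isCr h) p<q q≤N (below-highest H p<N e) (Highest.peak<N H) e (Highest.side H) (arc C D (rr h))
            (mirror (ArcElement.cov E)) (designated-mirror (extend-equivariant d) (ArcElement.cov E) (ArcElement.des E)))
        where
        p<N = ℕ.<-≤-trans p<q q≤N
        h : HasRight n d
        h = suc p , z<s , s≤s p<N , e
        H = hasRight h
        E = element-r H
      -- The endpoint p itself lies strictly between -p and q; its side decides between β_l and β_r.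
      mixed : ∀ {p q} → p ℕ.< q → Cov y x -[1+ p ] (+ q) → Designated σ -[1+ p ] (+ q) x → ⊥
      mixed {p} p<q C D with d (suc p) in e
      ... | left  = left-arc p<q (ℕ.s≤s⁻¹ (proj₂ (cov-small C))) e C D
      ... | right = right-arc p<q (ℕ.s≤s⁻¹ (proj₂ (cov-small C))) e C D
      ordinary-arc : ∀ {c t} → Cov y x (+ c) (+ t) → Designated σ (+ c) (+ t) x → ⊥
      ordinary-arc {c} {t} C D with Cov.c<d C
      ... | +<+ c<t = orbifold-forced (Upward.ordinary⇒orbifold d isCo c<t
              (ℕ.s≤s⁻¹ (proj₂ (cov-small C))) (arc C D ro))
      by : ∀ c t → Cov y x c t → Designated σ c t x → ⊥
      by (+ c) (+ t) C D = ordinary-arc C D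
      by (+ c) -[1+ t ] C D = case Cov.c<d C of λ ()
      by -[1+ c ] -[1+ t ] C D = ordinary-arc (mirror C) (designated-mirror (extend-equivariant d) C D)
      by -[1+ p ] (+ q) C D with ℕ.<-cmp p q
      ... | tri< p<q _ _ = mixed p<q C D
      ... | tri> _ _ q<p = mixed q<p (mirror C) (designated-mirror (extend-equivariant d) C D)
      ... | tri≈ _ refl _ = orbifold-forced (Upward.orbifold⇒orbifold d isCo
              (ℕ.s≤s⁻¹ (proj₂ (cov-small C))) (arc C D ro))

    module o = Congruence isCo
    module r (h : HasRight n d) = Congruence (isCr h)
    module l (h : HasLeft n d) = Congruence (isCl h)
    module Θ = Congruence isC

    -- By convexity each cover of a chain from u to v is contracted by every factor, so its arc is
    -- not designated and Θ contracts it too.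
    interval : ∀ {u v} → u ≤w v → All v u → Θ v u
    interval ε _ = Θ.Θ-refl
    interval {u} {v} (_◅_ {j = w} u⋖w w≤v) (ro , rr , rl) = Θ.Θ-trans
        (interval w≤v (o.Θ-trans ro (o.Θ-sym (cut o.convex ro)) ,
          (λ h → r.Θ-trans h (rr h) (r.Θ-sym h (cut (r.convex h) (rr h)))) ,
          (λ h → l.Θ-trans h (rl h) (l.Θ-sym h (cut (l.convex h) (rl h))))))
        (cover (proj₂ (cover⇒Cov {y = u} {w} u⋖w)))
      where
      cut : ∀ {Φ : Rel n} → (∀ {u v w} → u ⊑ v → v ⊑ w → Φ w u → Φ v u) → Φ v u → Φ w u
      cut convex z = convex (cover⇒⊑ {x = u} {w} u⋖w) (≤⇒⊑ w≤v) z
      cover : ∀ {c t} → Cov u w c t → Θ w u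
      cover {c} {t} C with designated-or-wrong σ w c t
      ... | inj₂ (e , wr) = Contraction.wrong⇒Θ 2≤n isC (proj₁ (proj₂ camb)) {e = e} C wr
      ... | inj₁ D = ⊥-elim (designated-uncontracted C D
              (cut o.convex ro , (λ h → cut (r.convex h) (rr h)) , (λ h → cut (l.convex h) (rl h))))

    -- Related elements are both related to their meet, which reduces the claim to intervals.
    backward : All ⊆ᴿ Θ
    backward {x} {y} (ro , rr , rl) = Θ.Θ-trans (interval m≤x (o.Θ-meet ro X Y , (λ h → r.Θ-meet h (rr h) X Y) , (λ h → l.Θ-meet h (rl h) X Y)))
        (Θ.Θ-sym (interval m≤y (o.Θ-meet (o.Θ-sym ro) Y' X' , (λ h → r.Θ-meet h (r.Θ-sym h (rr h)) Y' X') , (λ h → l.Θ-meet h (l.Θ-sym h (rl h)) Y' X'))))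
      where
      m = proj₁ (meet x y)
      M : IsMeet x y m
      M = meet-isMeet x y
      m≤x = proj₁ M
      m≤y = proj₁ (proj₂ M)
      X : IsMeet x x x
      X = isMeetˡ (λ _ i → i)
      Y : IsMeet y x m
      Y = isMeet-swap M
      Y' : IsMeet y y y
      Y' = isMeetˡ (λ _ i → i)
      X' : IsMeet x y m
      X' = M

theorem6p6 : (n : ℕ) → 2 ≤ n → (d : ℕ → Side) →
    (Θ Θo Θr Θl : Rel n) →
    IsCambrian n d Θ →
    IsThetaArc n (β-o n d) Θo →
    (∀ r → HighestRight n d r → IsThetaArc n (β-r n d r) Θr) →
    (∀ l → HighestLeft n d l → IsThetaArc n (β-l n d l) Θl) →
    ∀ x y → Θ x y ⇔ (Θo x y × (HasRight n d → Θr x y) × (HasLeft n d → Θl x y))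
theorem6p6 (suc N) (s≤s 0<N) d Θ Θo Θr Θl camb isO isR isL x y = mk⇔ (P.forward) (P.backward)
  where module P = Main.Proof 0<N d camb isO isR isL
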